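{- Let $0<q<1$ and let $n,s\ge 0$ be integers. Then \[ \frac{1}{q^{\binom{s}{2}}[s]_q!\,c(q)}\int_{ -\nu}^{\nu}x^{2n}H_s(x,q)^2\,w_G(x)\,d_qx=\sum_{\mu\in Y(n,s)}\prod_{i=1}^n q^{\mu_i-i}[\mu_i-i+1]_q, \] where \[ \nu=\frac{1}{\sqrt{1-q}}\qquad\text{and}\qquad c(q)=2(1-q)^{\frac12}\sum_{m=0}^{\infty}\frac{(-1)^m q^{m(m+1)}}{(1-q^{2m+1})\prod_{i=0}^{m-1}(1-q^{2i+2})}. \]
   Context: For an integer $m$, $[m]_q=\frac{1-q^m}{1-q}$, and for $m\ge0$, $[m]_q!=\prod_{i=1}^m[i]_q$. The $q$-Hermite polynomials $H_n(x,q)$ are defined by $H_0=1$, $H_1=x$, and $H_{n+1}(x,q)=xH_n(x,q)-q^{n-1}[n]_qH_{n-1}(x,q)$ for $n\ge1$. The Gaussian $q$-distribution is $w_G(x)=E_{q^2}^{ -q^2x^2/[2]_q}$, where $E_q^x=\sum_{m=0}^\infty q^{\binom m2}\frac{x^m}{[m]_q!}$ (and $E_{q^2}$ is obtained by replacing $q$ by $q^2$); explicitly, $w_G(x)=\sum_{m=0}^{\infty}\frac{q^{m(m+1)}(q-1)^m}{\prod_{i=0}^{m-1}(1-q^{2i+2})}x^{2m}$. The Jackson $q$-integral is $\int_0^b f(x)\,d_qx=(1-q)\,b\sum_{m=0}^\infty q^m f(q^m b)$ and $\int_a^b f\,d_qx=\int_0^b f\,d_qx-\int_0^a f\,d_qx$.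 $Y(n,s)$ is the set of integer sequences $\mu=(\mu_1,\ldots,\mu_n)$ with $s\le\mu_1\le\mu_2\le\cdots\le\mu_n\le n+s$. -}

module Defs where

open import Level using (0ℓ)
open import Algebra.Bundles using (CommutativeRing; Semiring)
open import Algebra.Structures using (IsCommutativeRing)
open import Data.Nat.Base as ℕ using (ℕ; zero; suc)
import Data.Nat.Properties as ℕ
open import Data.Nat.Combinatorics using (_C_)
open import Data.Integer.Base as ℤ using (ℤ; +_; -[1+_])
import Data.Integer.Properties as ℤ
open import Data.Rational.Base as ℚ using (ℚ; 0ℚ; 1ℚ; ½)
import Data.Rational.Properties as ℚ
open import Data.Rational.Solver using (module +-*-Solver)
open import Data.Vec.Base using (Vec; []; _∷_; _∷ʳ_)
open import Data.Vec.Properties using (∷-injective)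
open import Data.Vec.Relation.Unary.All using (All; []; _∷_)
open import Data.Vec.Relation.Unary.Linked using (Linked; _∷_; linked?)
open import Data.List.Base as List using (List; []; _∷_; upTo; filter; cartesianProductWith)
open import Data.List.Membership.Propositional using (_∈_)
import Data.List.Membership.Propositional.Properties as ∈
open import Data.List.Relation.Unary.Any using (here)
open import Data.List.Relation.Unary.All using ([])
open import Data.List.Relation.Unary.AllPairs using ([]; _∷_)
open import Data.List.Relation.Unary.Unique.Propositional using (Unique)
import Data.List.Relation.Unary.Unique.Propositional.Properties as Unique
open import Data.Product.Base using (∃-syntax; _×_; _,_; proj₂)
open import Data.Sum.Base using (inj₁; inj₂)
open import Relation.Unary using (Decidable)
open import Relation.Binary.PropositionalEquality.Core using (_≡_; refl; sym; trans; cong; cong₂; subst; subst₂)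
open import Function.Bundles using (_⇔_; mk⇔)

module ℚ-Lemmas where
  open +-*-Solver using (solve; _:=_; _:+_; _:*_; _:-_; :-_)

  ½*_ : ℚ → ℚ
  ½* ε = ½ ℚ.* ε

  ½-pos : ∀ {ε} → 0ℚ ℚ.< ε → 0ℚ ℚ.< ½* ε
  ½-pos {ε} 0<ε = subst (ℚ._< ½* ε) (ℚ.*-zeroʳ ½) (ℚ.*-monoʳ-<-pos ½ 0<ε)

  ½+½ : ∀ ε → ½* ε ℚ.+ ½* ε ≡ ε
  ½+½ ε = trans (sym (ℚ.*-distribʳ-+ ε ½ ½)) (ℚ.*-identityˡ ε)

  0<1 : 0ℚ ℚ.< 1ℚ
  0<1 = ℚ.positive⁻¹ 1ℚ

  +-pos : ∀ {p r} → 0ℚ ℚ.< p → 0ℚ ℚ.< r → 0ℚ ℚ.< p ℚ.+ r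
  +-pos {p} {r} 0<p 0<r = subst (ℚ._< p ℚ.+ r) (ℚ.+-identityˡ 0ℚ) (ℚ.+-mono-< 0<p 0<r)

  *-pos : ∀ {p r} → 0ℚ ℚ.< p → 0ℚ ℚ.< r → 0ℚ ℚ.< p ℚ.* r
  *-pos {p} {r} 0<p 0<r =
    subst (ℚ._< p ℚ.* r) (ℚ.*-zeroʳ p) (ℚ.*-monoʳ-<-pos p {{ℚ.positive 0<p}} 0<r)

  recip : ∀ {p} → 0ℚ ℚ.< p → ℚ
  recip {p} 0<p = (ℚ.1/ p) {{ℚ.>-nonZero 0<p}}

  recip-pos : ∀ {p} (0<p : 0ℚ ℚ.< p) → 0ℚ ℚ.< recip 0<p
  recip-pos {p} 0<p = ℚ.positive⁻¹ _ {{ℚ.1/pos⇒pos p {{ℚ.positive 0<p}}}}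

  split : ∀ {B ε} → 0ℚ ℚ.< B → 0ℚ ℚ.< ε → ∃[ δ ] 0ℚ ℚ.< δ × B ℚ.* δ ≡ ½* ε
  split {B} {ε} 0<B 0<ε = B⁻¹ ℚ.* ½* ε , *-pos (recip-pos 0<B) (½-pos 0<ε) ,
    trans (sym (ℚ.*-assoc B B⁻¹ (½* ε)))
      (trans (cong (ℚ._* ½* ε) (ℚ.*-inverseʳ B {{ℚ.>-nonZero 0<B}})) (ℚ.*-identityˡ _))
    where B⁻¹ = recip 0<B

  halves : ∀ {a b ε} → a ℚ.< ½* ε → b ℚ.< ½* ε → a ℚ.+ b ℚ.< ε
  halves {a} {b} {ε} p r = subst (a ℚ.+ b ℚ.<_) (½+½ ε) (ℚ.+-mono-< p r)

  ∣∣-cong-≤ : ∀ u v {B} → u ≡ v → ℚ.∣ u ∣ ℚ.≤ B → ℚ.∣ v ∣ ℚ.≤ B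
  ∣∣-cong-≤ _ _ refl p = p

  neg-sub : ∀ a b → ℚ.- (a ℚ.- b) ≡ b ℚ.- a
  neg-sub = solve 2 (λ a b → :- (a :- b) := b :- a) refl

  telescope : ∀ a b c → (a ℚ.- b) ℚ.+ (b ℚ.- c) ≡ a ℚ.- c
  telescope = solve 3 (λ a b c → (a :- b) :+ (b :- c) := a :- c) refl

  +-sub : ∀ a b c d → (a ℚ.- c) ℚ.+ (b ℚ.- d) ≡ (a ℚ.+ b) ℚ.- (c ℚ.+ d)
  +-sub = solve 4 (λ a b c d → (a :- c) :+ (b :- d) := (a :+ b) :- (c :+ d)) refl

  *-sub : ∀ a b c d → a ℚ.* (b ℚ.- d) ℚ.+ d ℚ.* (a ℚ.- c) ≡ a ℚ.* b ℚ.- c ℚ.* d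
  *-sub = solve 4 (λ a b c d → a :* (b :- d) :+ d :* (a :- c) := a :* b :- c :* d) refl

  sub-cancel : ∀ a b → (a ℚ.- b) ℚ.+ b ≡ a
  sub-cancel = solve 2 (λ a b → (a :- b) :+ b := a) refl

  +-cancel : ∀ d b → (d ℚ.+ b) ℚ.- b ≡ d
  +-cancel = solve 2 (λ d b → (d :+ b) :- b := d) refl

  dist-sym : ∀ a b → ℚ.∣ a ℚ.- b ∣ ≡ ℚ.∣ b ℚ.- a ∣
  dist-sym a b = trans (sym (ℚ.∣-p∣≡∣p∣ (a ℚ.- b))) (cong ℚ.∣_∣ (neg-sub a b))

  dist-self : ∀ a → ℚ.∣ a ℚ.- a ∣ ≡ 0ℚ
  dist-self a = cong ℚ.∣_∣ (ℚ.+-inverseʳ a)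

  dist-tri : ∀ a b c → ℚ.∣ a ℚ.- c ∣ ℚ.≤ ℚ.∣ a ℚ.- b ∣ ℚ.+ ℚ.∣ b ℚ.- c ∣
  dist-tri a b c = ∣∣-cong-≤ _ _ (telescope a b c) (ℚ.∣p+q∣≤∣p∣+∣q∣ (a ℚ.- b) (b ℚ.- c))

  dist-+ : ∀ a b c d →
    ℚ.∣ (a ℚ.+ b) ℚ.- (c ℚ.+ d) ∣ ℚ.≤ ℚ.∣ a ℚ.- c ∣ ℚ.+ ℚ.∣ b ℚ.- d ∣
  dist-+ a b c d = ∣∣-cong-≤ _ _ (+-sub a b c d) (ℚ.∣p+q∣≤∣p∣+∣q∣ (a ℚ.- c) (b ℚ.- d))

  dist-neg : ∀ a b → ℚ.∣ (ℚ.- a) ℚ.- (ℚ.- b) ∣ ≡ ℚ.∣ a ℚ.- b ∣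
  dist-neg a b = trans (cong ℚ.∣_∣ (sym (ℚ.neg-distrib-+ a (ℚ.- b)))) (ℚ.∣-p∣≡∣p∣ _)

  dist-* : ∀ a b c d → ℚ.∣ (a ℚ.* b) ℚ.- (c ℚ.* d) ∣
         ℚ.≤ ℚ.∣ a ∣ ℚ.* ℚ.∣ b ℚ.- d ∣ ℚ.+ ℚ.∣ d ∣ ℚ.* ℚ.∣ a ℚ.- c ∣
  dist-* a b c d = ∣∣-cong-≤ _ _ (*-sub a b c d)
    (subst (ℚ.∣ a ℚ.* (b ℚ.- d) ℚ.+ d ℚ.* (a ℚ.- c) ∣ ℚ.≤_)
      (cong₂ ℚ._+_ (ℚ.∣p*q∣≡∣p∣*∣q∣ a (b ℚ.- d)) (ℚ.∣p*q∣≡∣p∣*∣q∣ d (a ℚ.- c)))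
      (ℚ.∣p+q∣≤∣p∣+∣q∣ (a ℚ.* (b ℚ.- d)) (d ℚ.* (a ℚ.- c))))

  ∣a∣≤∣a-b∣+∣b∣ : ∀ a b → ℚ.∣ a ∣ ℚ.≤ ℚ.∣ a ℚ.- b ∣ ℚ.+ ℚ.∣ b ∣
  ∣a∣≤∣a-b∣+∣b∣ a b = ∣∣-cong-≤ _ _ (sub-cancel a b) (ℚ.∣p+q∣≤∣p∣+∣q∣ (a ℚ.- b) b)

  ∣a∣-∣b∣≤ : ∀ a b → ℚ.∣ a ∣ ℚ.- ℚ.∣ b ∣ ℚ.≤ ℚ.∣ a ℚ.- b ∣
  ∣a∣-∣b∣≤ a b = subst (ℚ.∣ a ∣ ℚ.- ℚ.∣ b ∣ ℚ.≤_) (+-cancel ℚ.∣ a ℚ.- b ∣ ℚ.∣ b ∣)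
    (ℚ.+-monoˡ-≤ (ℚ.- ℚ.∣ b ∣) {ℚ.∣ a ∣} {ℚ.∣ a ℚ.- b ∣ ℚ.+ ℚ.∣ b ∣} (∣a∣≤∣a-b∣+∣b∣ a b))

  dist-∣∣ : ∀ a b → ℚ.∣ ℚ.∣ a ∣ ℚ.- ℚ.∣ b ∣ ∣ ℚ.≤ ℚ.∣ a ℚ.- b ∣
  dist-∣∣ a b with ℚ.∣p∣≡p∨∣p∣≡-p (ℚ.∣ a ∣ ℚ.- ℚ.∣ b ∣)
  ... | inj₁ e = subst (ℚ._≤ ℚ.∣ a ℚ.- b ∣) (sym e) (∣a∣-∣b∣≤ a b)
  ... | inj₂ e = subst₂ ℚ._≤_
    (trans (sym (neg-sub ℚ.∣ a ∣ ℚ.∣ b ∣)) (sym e)) (dist-sym b a) (∣a∣-∣b∣≤ b a)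

  ∣b∣<∣a∣+1 : ∀ a b → ℚ.∣ b ℚ.- a ∣ ℚ.< 1ℚ → ℚ.∣ b ∣ ℚ.< ℚ.∣ a ∣ ℚ.+ 1ℚ
  ∣b∣<∣a∣+1 a b p = ℚ.≤-<-trans (∣a∣≤∣a-b∣+∣b∣ b a)
    (subst (ℚ._< ℚ.∣ a ∣ ℚ.+ 1ℚ) (ℚ.+-comm ℚ.∣ a ∣ ℚ.∣ b ℚ.- a ∣) (ℚ.+-monoʳ-< ℚ.∣ a ∣ p))

  ∣*∣-bound : ∀ {a B d δ} → ℚ.∣ a ∣ ℚ.< B → ℚ.∣ d ∣ ℚ.< δ →
              ℚ.∣ a ∣ ℚ.* ℚ.∣ d ∣ ℚ.< B ℚ.* δ
  ∣*∣-bound {a} {B} {d} {δ} p r = ℚ.≤-<-trans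
    (ℚ.*-monoʳ-≤-nonNeg ℚ.∣ d ∣ {{ℚ.∣-∣-nonNeg d}} (ℚ.<⇒≤ p))
    (ℚ.*-monoʳ-<-pos B {{ℚ.positive (ℚ.≤-<-trans (ℚ.0≤∣p∣ a) p)}} r)

  ∣∣-mono : ∀ p → p ℚ.≤ ℚ.∣ p ∣
  ∣∣-mono p with ℚ.≤-total 0ℚ p
  ... | inj₁ 0≤p = ℚ.≤-reflexive (sym (ℚ.0≤p⇒∣p∣≡p 0≤p))
  ... | inj₂ p≤0 = ℚ.≤-trans p≤0 (ℚ.0≤∣p∣ p)

  0+< : ∀ g {p} → g ℚ.< p → 0ℚ ℚ.+ g ℚ.< p
  0+< g {p} = subst (ℚ._< p) (sym (ℚ.+-identityˡ g))

  0+<⁻¹ : ∀ g {p} → 0ℚ ℚ.+ g ℚ.< p → g ℚ.< p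
  0+<⁻¹ g {p} = subst (ℚ._< p) (ℚ.+-identityˡ g)

  gap-sub : ∀ {g} a b → a ℚ.+ g ℚ.< b → 0ℚ ℚ.+ g ℚ.< b ℚ.- a
  gap-sub {g} a b p = subst (ℚ._< b ℚ.- a) (eq a g) (ℚ.+-monoˡ-< (ℚ.- a) p)
    where
      eq : ∀ a g → (a ℚ.+ g) ℚ.- a ≡ 0ℚ ℚ.+ g
      eq a g = trans (cong (ℚ._- a) (ℚ.+-comm a g)) (trans (+-cancel g a) (sym (ℚ.+-identityˡ g)))

  shift-gap : ∀ {g} a b c → a ℚ.+ g ℚ.< b → ℚ.∣ b ℚ.- c ∣ ℚ.< ½* g → a ℚ.+ ½* g ℚ.< c
  shift-gap {g} a b c p r = subst₂ ℚ._<_ (eq₁ a (½* g)) (sub-sub b c)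
    (ℚ.+-mono-< (subst (λ z → a ℚ.+ z ℚ.< b) (sym (½+½ g)) p)
      (ℚ.neg-antimono-< (ℚ.≤-<-trans (∣∣-mono (b ℚ.- c)) r)))
    where
      eq₁ : ∀ a h → (a ℚ.+ (h ℚ.+ h)) ℚ.- h ≡ a ℚ.+ h
      eq₁ = solve 2 (λ a h → (a :+ (h :+ h)) :- h := a :+ h) refl

      sub-sub : ∀ b c → b ℚ.- (b ℚ.- c) ≡ c
      sub-sub = solve 2 (λ b c → b :- (b :- c) := c) refl

  *-mono-<-pos : ∀ {a b c d} → 0ℚ ℚ.< a → 0ℚ ℚ.< b → a ℚ.< c → b ℚ.< d → a ℚ.* b ℚ.< c ℚ.* d
  *-mono-<-pos {a} {b} {c} {d} 0<a 0<b a<c b<d = ℚ.<-trans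
    (ℚ.*-monoˡ-<-pos b {{ℚ.positive 0<b}} a<c)
    (ℚ.*-monoʳ-<-pos c {{ℚ.positive (ℚ.<-trans 0<a a<c)}} b<d)

  recip-inverseˡ : ∀ {p} (0<p : 0ℚ ℚ.< p) → recip 0<p ℚ.* p ≡ 1ℚ
  recip-inverseˡ {p} 0<p = ℚ.*-inverseˡ p {{ℚ.>-nonZero 0<p}}

  recip-inverseʳ : ∀ {p} (0<p : 0ℚ ℚ.< p) → p ℚ.* recip 0<p ≡ 1ℚ
  recip-inverseʳ {p} 0<p = ℚ.*-inverseʳ p {{ℚ.>-nonZero 0<p}}

  recip-anti : ∀ {p r} (0<p : 0ℚ ℚ.< p) (0<r : 0ℚ ℚ.< r) → p ℚ.< r → recip 0<r ℚ.< recip 0<p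
  recip-anti {p} {r} 0<p 0<r p<r = subst₂ ℚ._<_
    (trans (cong (ℚ._* r⁻¹) (recip-inverseˡ 0<p)) (ℚ.*-identityˡ r⁻¹))
    (trans (ℚ.*-assoc p⁻¹ r r⁻¹) (trans (cong (p⁻¹ ℚ.*_) (recip-inverseʳ 0<r)) (ℚ.*-identityʳ p⁻¹)))
    (ℚ.*-monoˡ-<-pos r⁻¹ {{ℚ.positive (recip-pos 0<r)}}
      (ℚ.*-monoʳ-<-pos p⁻¹ {{ℚ.positive (recip-pos 0<p)}} p<r))
    where
      p⁻¹ = recip 0<p
      r⁻¹ = recip 0<r

  recip-dist : ∀ {g a b ε} → 0ℚ ℚ.< g → g ℚ.< a → g ℚ.< b → (0<a : 0ℚ ℚ.< a) (0<b : 0ℚ ℚ.< b) →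
    ℚ.∣ a ℚ.- b ∣ ℚ.< (g ℚ.* g) ℚ.* ε → ℚ.∣ recip 0<a ℚ.- recip 0<b ∣ ℚ.< ε
  recip-dist {g} {a} {b} {ε} 0<g g<a g<b 0<a 0<b p =
    ℚ.*-cancelˡ-<-nonNeg (g ℚ.* g) {{ℚ.nonNegative (ℚ.<⇒≤ 0<gg)}}
      (ℚ.≤-<-trans (ℚ.*-monoʳ-≤-nonNeg ℚ.∣ d ∣ {{ℚ.∣-∣-nonNeg d}} (ℚ.<⇒≤ gg<ab))
        (subst (ℚ._< (g ℚ.* g) ℚ.* ε) eq p))
    where
      d = recip 0<a ℚ.- recip 0<b

      0<gg : 0ℚ ℚ.< g ℚ.* g
      0<gg = *-pos 0<g 0<g

      gg<ab : g ℚ.* g ℚ.< a ℚ.* b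
      gg<ab = *-mono-<-pos 0<g 0<g g<a g<b

      expand : ∀ a b u v → (a ℚ.* b) ℚ.* (u ℚ.- v) ≡ (a ℚ.* u) ℚ.* b ℚ.- (b ℚ.* v) ℚ.* a
      expand = solve 4 (λ a b u v → (a :* b) :* (u :- v) := (a :* u) :* b :- (b :* v) :* a) refl

      ab*d : (a ℚ.* b) ℚ.* d ≡ b ℚ.- a
      ab*d = trans (expand a b (recip 0<a) (recip 0<b)) (cong₂ ℚ._-_
        (trans (cong (ℚ._* b) (recip-inverseʳ 0<a)) (ℚ.*-identityˡ b))
        (trans (cong (ℚ._* a) (recip-inverseʳ 0<b)) (ℚ.*-identityˡ a)))

      eq : ℚ.∣ a ℚ.- b ∣ ≡ (a ℚ.* b) ℚ.* ℚ.∣ d ∣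
      eq = trans (dist-sym a b) (trans (cong ℚ.∣_∣ (sym ab*d))
        (trans (ℚ.∣p*q∣≡∣p∣*∣q∣ (a ℚ.* b) d)
          (cong (ℚ._* ℚ.∣ d ∣) (ℚ.0≤p⇒∣p∣≡p (ℚ.<⇒≤ (*-pos 0<a 0<b))))))

  inverse-dist : ∀ {ε} a b (0<b : 0ℚ ℚ.< b) → ℚ.∣ recip 0<b ∣ ℚ.* ℚ.∣ a ℚ.- b ∣ ℚ.< ½* ε →
    0ℚ ℚ.< ε → ℚ.∣ a ℚ.* recip 0<b ℚ.- 1ℚ ∣ ℚ.< ε
  inverse-dist {ε} a b 0<b p 0<ε = ℚ.<-trans
    (subst (ℚ._< ½* ε) (trans (sym (ℚ.∣p*q∣≡∣p∣*∣q∣ (recip 0<b) (a ℚ.- b))) (cong ℚ.∣_∣ eq)) p)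
    (subst₂ ℚ._<_ (ℚ.+-identityʳ (½* ε)) (½+½ ε) (ℚ.+-monoʳ-< (½* ε) (½-pos 0<ε)))
    where
      expand : ∀ a b u → u ℚ.* (a ℚ.- b) ≡ a ℚ.* u ℚ.- u ℚ.* b
      expand = solve 3 (λ a b u → u :* (a :- b) := a :* u :- u :* b) refl

      eq : recip 0<b ℚ.* (a ℚ.- b) ≡ a ℚ.* recip 0<b ℚ.- 1ℚ
      eq = trans (expand a b (recip 0<b)) (cong (λ z → a ℚ.* recip 0<b ℚ.- z) (recip-inverseˡ 0<b))

open ℚ-Lemmas renaming (0<1 to ℚ-0<1; +-pos to ℚ-+-pos; *-pos to ℚ-*-pos)

infix 4 _≈_ _<_

-- The reals are Cauchy sequences of rationals up to _≈_.  Since ∃ is a Σ-type,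
-- a modulus of convergence is part of the data.
record ℝ : Set where
  constructor mkℝ
  field
    seq    : ℕ → ℚ
    cauchy : ∀ ε → 0ℚ ℚ.< ε →
             ∃[ N ] ∀ m n → N ℕ.≤ m → N ℕ.≤ n → ℚ.∣ seq m ℚ.- seq n ∣ ℚ.< ε

open ℝ public

record _≈_ (x y : ℝ) : Set where
  constructor mk≈
  field
    close : ∀ ε → 0ℚ ℚ.< ε →
            ∃[ N ] ∀ n → N ℕ.≤ n → ℚ.∣ seq x n ℚ.- seq y n ∣ ℚ.< ε

open _≈_ public

record _<_ (x y : ℝ) : Set where
  constructor mk<
  field
    gap     : ℚ
    gap-pos : 0ℚ ℚ.< gap
    from    : ℕ
    apart   : ∀ n → from ℕ.≤ n → seq x n ℚ.+ gap ℚ.< seq y n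

open _<_ public

private
  ⊔₂ : ∀ M N {k} → M ℕ.⊔ N ℕ.≤ k → M ℕ.≤ k × N ℕ.≤ k
  ⊔₂ M N p = ℕ.m⊔n≤o⇒m≤o M N p , ℕ.m⊔n≤o⇒n≤o M N p

  ⊔₄ : ∀ K L M N {k} → (K ℕ.⊔ L) ℕ.⊔ (M ℕ.⊔ N) ℕ.≤ k →
       (K ℕ.≤ k × L ℕ.≤ k) × (M ℕ.≤ k × N ℕ.≤ k)
  ⊔₄ K L M N p = let (r , t) = ⊔₂ (K ℕ.⊔ L) (M ℕ.⊔ N) p in ⊔₂ K L r , ⊔₂ M N t

  bound : ∀ x → ∃[ B ] 0ℚ ℚ.< B × ∃[ N ] ∀ n → N ℕ.≤ n → ℚ.∣ seq x n ∣ ℚ.< B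
  bound x with cauchy x 1ℚ ℚ-0<1
  ... | N , c = ℚ.∣ seq x N ∣ ℚ.+ 1ℚ , ℚ.≤-<-trans (ℚ.0≤∣p∣ _) (∣b∣<∣a∣+1 (seq x N) (seq x N)
                  (subst (ℚ._< 1ℚ) (sym (dist-self (seq x N))) ℚ-0<1))
              , N , λ n N≤n → ∣b∣<∣a∣+1 (seq x N) (seq x n) (c n N N≤n ℕ.≤-refl)

pointwise : ∀ {x y} → (∀ n → seq x n ≡ seq y n) → x ≈ y
pointwise {x} {y} e = mk≈ λ ε 0<ε → 0 , λ n _ →
  subst (ℚ._< ε) (sym (trans (cong (λ z → ℚ.∣ seq x n ℚ.- z ∣) (sym (e n))) (dist-self (seq x n)))) 0<ε

≈-refl : ∀ {x} → x ≈ x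
≈-refl = pointwise λ _ → refl

≈-sym : ∀ {x y} → x ≈ y → y ≈ x
≈-sym {x} {y} e = mk≈ λ ε 0<ε → let (N , c) = close e ε 0<ε in
  N , λ n N≤n → subst (ℚ._< ε) (dist-sym (seq x n) (seq y n)) (c n N≤n)

≈-trans : ∀ {x y z} → x ≈ y → y ≈ z → x ≈ z
≈-trans {x} {y} {z} e f = mk≈ λ ε 0<ε →
  let (M , c) = close e (½* ε) (½-pos 0<ε)
      (N , d) = close f (½* ε) (½-pos 0<ε)
  in M ℕ.⊔ N , λ n p → let (Mn , Nn) = ⊔₂ M N p in
    ℚ.≤-<-trans (dist-tri (seq x n) (seq y n) (seq z n)) (halves (c n Mn) (d n Nn))

-- The operations are opaque only to keep type checking from unfolding them
-- to sequences.
opaque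

  infixl 7 _*_
  infixl 6 _+_
  infix  8 -_

  fromℚ : ℚ → ℝ
  fromℚ p = mkℝ (λ _ → p) λ ε 0<ε → 0 , λ _ _ _ _ → subst (ℚ._< ε) (sym (dist-self p)) 0<ε

  _+_ : ℝ → ℝ → ℝ
  x + y = mkℝ (λ n → seq x n ℚ.+ seq y n) λ ε 0<ε →
    let (M , c) = cauchy x (½* ε) (½-pos 0<ε)
        (N , d) = cauchy y (½* ε) (½-pos 0<ε)
    in M ℕ.⊔ N , λ m n p r →
      let (Mm , Nm) = ⊔₂ M N p ; (Mn , Nn) = ⊔₂ M N r in
      ℚ.≤-<-trans (dist-+ (seq x m) (seq y m) (seq x n) (seq y n))
        (halves (c m n Mm Mn) (d m n Nm Nn))

  -_ : ℝ → ℝ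
  - x = mkℝ (λ n → ℚ.- seq x n) λ ε 0<ε → let (N , c) = cauchy x ε 0<ε in
    N , λ m n p r → subst (ℚ._< ε) (sym (dist-neg (seq x m) (seq x n))) (c m n p r)

  _*_ : ℝ → ℝ → ℝ
  x * y = mkℝ (λ n → seq x n ℚ.* seq y n) λ ε 0<ε →
    let (A , 0<A , K , a) = bound x
        (B , 0<B , L , b) = bound y
        (α , 0<α , Aα) = split 0<A 0<ε
        (β , 0<β , Bβ) = split 0<B 0<ε
        (M , c) = cauchy x β 0<β
        (N , d) = cauchy y α 0<α
    in (K ℕ.⊔ L) ℕ.⊔ (M ℕ.⊔ N) , λ m n p r →
      let ((Km , _) , (Mm , Nm)) = ⊔₄ K L M N p
          ((_ , Ln) , (Mn , Nn)) = ⊔₄ K L M N r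
      in ℚ.≤-<-trans (dist-* (seq x m) (seq y m) (seq x n) (seq y n))
        (halves
          (subst (_ ℚ.<_) Aα (∣*∣-bound {seq x m} {d = seq y m ℚ.- seq y n} (a m Km) (d m n Nm Nn)))
          (subst (_ ℚ.<_) Bβ (∣*∣-bound {seq y n} {d = seq x m ℚ.- seq x n} (b n Ln) (c m n Mm Mn))))

  ∣_∣ : ℝ → ℝ
  ∣ x ∣ = mkℝ (λ n → ℚ.∣ seq x n ∣) λ ε 0<ε → let (N , c) = cauchy x ε 0<ε in
    N , λ m n p r → ℚ.≤-<-trans (dist-∣∣ (seq x m) (seq x n)) (c m n p r)

0ℝ 1ℝ : ℝ
0ℝ = fromℚ 0ℚ
1ℝ = fromℚ 1ℚ

opaque
  unfolding fromℚ

  private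
    +-cong : ∀ {x y u v} → x ≈ y → u ≈ v → x + u ≈ y + v
    +-cong {x} {y} {u} {v} e f = mk≈ λ ε 0<ε →
      let (M , c) = close e (½* ε) (½-pos 0<ε)
          (N , d) = close f (½* ε) (½-pos 0<ε)
      in M ℕ.⊔ N , λ n p → let (Mn , Nn) = ⊔₂ M N p in
        ℚ.≤-<-trans (dist-+ (seq x n) (seq u n) (seq y n) (seq v n))
          (halves (c n Mn) (d n Nn))

    -‿cong : ∀ {x y} → x ≈ y → - x ≈ - y
    -‿cong {x} {y} e = mk≈ λ ε 0<ε → let (N , c) = close e ε 0<ε in
      N , λ n p → subst (ℚ._< ε) (sym (dist-neg (seq x n) (seq y n))) (c n p)

    *-cong : ∀ {x y u v} → x ≈ y → u ≈ v → x * u ≈ y * v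
    *-cong {x} {y} {u} {v} e f = mk≈ λ ε 0<ε →
      let (A , 0<A , K , a) = bound x
          (B , 0<B , L , b) = bound v
          (α , 0<α , Aα) = split 0<A 0<ε
          (β , 0<β , Bβ) = split 0<B 0<ε
          (M , c) = close e β 0<β
          (N , d) = close f α 0<α
      in (K ℕ.⊔ L) ℕ.⊔ (M ℕ.⊔ N) , λ n p →
        let ((Kn , Ln) , (Mn , Nn)) = ⊔₄ K L M N p in
        ℚ.≤-<-trans (dist-* (seq x n) (seq u n) (seq y n) (seq v n))
          (halves
            (subst (_ ℚ.<_) Aα (∣*∣-bound {seq x n} {d = seq u n ℚ.- seq v n} (a n Kn) (d n Nn)))
            (subst (_ ℚ.<_) Bβ (∣*∣-bound {seq v n} {d = seq x n ℚ.- seq y n} (b n Ln) (c n Mn))))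

  ℝ-isCommutativeRing : IsCommutativeRing _≈_ _+_ _*_ -_ 0ℝ 1ℝ
  ℝ-isCommutativeRing = record
    { isRing = record
      { +-isAbelianGroup = record
        { isGroup = record
          { isMonoid = record
            { isSemigroup = record
              { isMagma = record
                { isEquivalence = record { refl = ≈-refl ; sym = ≈-sym ; trans = ≈-trans }
                ; ∙-cong = +-cong }
              ; assoc = λ x y z → pointwise λ n → ℚ.+-assoc (seq x n) (seq y n) (seq z n) }
            ; identity = (λ x → pointwise λ n → ℚ.+-identityˡ (seq x n))
                       , (λ x → pointwise λ n → ℚ.+-identityʳ (seq x n)) }
          ; inverse = (λ x → pointwise λ n → ℚ.+-inverseˡ (seq x n))
                    , (λ x → pointwise λ n → ℚ.+-inverseʳ (seq x n))
          ; ⁻¹-cong = -‿cong }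
        ; comm = λ x y → pointwise λ n → ℚ.+-comm (seq x n) (seq y n) }
      ; *-cong = *-cong
      ; *-assoc = λ x y z → pointwise λ n → ℚ.*-assoc (seq x n) (seq y n) (seq z n)
      ; *-identity = (λ x → pointwise λ n → ℚ.*-identityˡ (seq x n))
                   , (λ x → pointwise λ n → ℚ.*-identityʳ (seq x n))
      ; distrib = (λ x y z → pointwise λ n → ℚ.*-distribˡ-+ (seq x n) (seq y n) (seq z n))
                , (λ x y z → pointwise λ n → ℚ.*-distribʳ-+ (seq x n) (seq y n) (seq z n)) }
    ; *-comm = λ x y → pointwise λ n → ℚ.*-comm (seq x n) (seq y n) }

ℝ-commutativeRing : CommutativeRing 0ℓ 0ℓ
ℝ-commutativeRing = record { isCommutativeRing = ℝ-isCommutativeRing }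

open import Algebra.Definitions.RawSemiring (Semiring.rawSemiring (CommutativeRing.semiring ℝ-commutativeRing)) public
  using (_^_; product)

infixl 6 _-_

_-_ : ℝ → ℝ → ℝ
x - y = x + - y

opaque
  unfolding fromℚ

  <-respʳ-≈ : ∀ {x y z} → y ≈ z → x < y → x < z
  <-respʳ-≈ {x} {y} {z} e (mk< g 0<g N p) =
    let (M , c) = close e (½* g) (½-pos 0<g) in
    mk< (½* g) (½-pos 0<g) (M ℕ.⊔ N) λ n r → let (Mn , Nn) = ⊔₂ M N r in
      shift-gap (seq x n) (seq y n) (seq z n) (p n Nn) (c n Mn)

  <⇒0<- : ∀ {x y} → x < y → 0ℝ < y - x
  <⇒0<- {x} {y} (mk< g 0<g N p) = mk< g 0<g N λ n r →
    gap-sub (seq x n) (seq y n) (p n r)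

  0<1 : 0ℝ < 1ℝ
  0<1 = mk< ½ (ℚ.positive⁻¹ ½) 0 λ _ _ → ℚ.*<* (ℤ.+<+ (ℕ.s≤s (ℕ.s≤s ℕ.z≤n)))

  +-pos : ∀ {x y} → 0ℝ < x → 0ℝ < y → 0ℝ < x + y
  +-pos {x} {y} (mk< g 0<g M p) (mk< h 0<h N r) = mk< (g ℚ.+ h) (ℚ-+-pos 0<g 0<h) (M ℕ.⊔ N)
    λ n k → let (Mn , Nn) = ⊔₂ M N k in
      0+< (g ℚ.+ h) (ℚ.+-mono-< (0+<⁻¹ g (p n Mn)) (0+<⁻¹ h (r n Nn)))

  *-pos : ∀ {x y} → 0ℝ < x → 0ℝ < y → 0ℝ < x * y
  *-pos {x} {y} (mk< g 0<g M p) (mk< h 0<h N r) = mk< (g ℚ.* h) (ℚ-*-pos 0<g 0<h) (M ℕ.⊔ N)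
    λ n k → let (Mn , Nn) = ⊔₂ M N k in
      0+< (g ℚ.* h) (*-mono-<-pos 0<g 0<h (0+<⁻¹ g (p n Mn)) (0+<⁻¹ h (r n Nn)))

  -- The sequence of x is invertible only from some index on; the inverse
  -- drops the terms before it.
  1/_⟨_⟩ : ∀ x → 0ℝ < x → ℝ
  1/ x ⟨ mk< g 0<g N p ⟩ = mkℝ (λ n → recip (x⁺ n)) λ ε 0<ε →
    let (M , c) = cauchy x ((g ℚ.* g) ℚ.* ε) (ℚ-*-pos (ℚ-*-pos 0<g 0<g) 0<ε) in
    M , λ m n r t → recip-dist 0<g (g< m) (g< n) (x⁺ m) (x⁺ n)
      (c (N ℕ.+ m) (N ℕ.+ n) (ℕ.m≤n⇒m≤o+n N r) (ℕ.m≤n⇒m≤o+n N t))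
    where
      g< : ∀ n → g ℚ.< seq x (N ℕ.+ n)
      g< n = 0+<⁻¹ g (p (N ℕ.+ n) (ℕ.m≤m+n N n))

      x⁺ : ∀ n → 0ℚ ℚ.< seq x (N ℕ.+ n)
      x⁺ n = ℚ.<-trans 0<g (g< n)

  1/-pos : ∀ {x} (0<x : 0ℝ < x) → 0ℝ < 1/ x ⟨ 0<x ⟩
  1/-pos {x} (mk< g 0<g N p) =
    let (B , 0<B , M , b) = bound x in
    mk< (recip 0<B) (recip-pos 0<B) M λ n r →
      0+< (recip 0<B) (recip-anti (ℚ.<-trans 0<g (0+<⁻¹ g (p (N ℕ.+ n) (ℕ.m≤m+n N n)))) 0<B
        (ℚ.≤-<-trans (∣∣-mono (seq x (N ℕ.+ n))) (b (N ℕ.+ n) (ℕ.m≤n⇒m≤o+n N r))))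

  *-inverseʳ : ∀ {x} (0<x : 0ℝ < x) → x * 1/ x ⟨ 0<x ⟩ ≈ 1ℝ
  *-inverseʳ {x} 0<x@(mk< g 0<g N p) = mk≈ λ ε 0<ε →
    let (A , 0<A , K , a) = bound (1/ x ⟨ 0<x ⟩)
        (δ , 0<δ , Aδ) = split 0<A 0<ε
        (M , c) = cauchy x δ 0<δ
    in K ℕ.⊔ M , λ n r → let (Kn , Mn) = ⊔₂ K M r in
      inverse-dist (seq x n) _ (x⁺ n)
        (subst (_ ℚ.<_) Aδ (∣*∣-bound {recip (x⁺ n)} {d = seq x n ℚ.- seq x (N ℕ.+ n)} (a n Kn)
          (c n (N ℕ.+ n) Mn (ℕ.m≤n⇒m≤o+n N Mn))))
        0<ε
    where
      x⁺ : ∀ n → 0ℚ ℚ.< seq x (N ℕ.+ n)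
      x⁺ n = ℚ.<-trans 0<g (0+<⁻¹ g (p (N ℕ.+ n) (ℕ.m≤m+n N n)))

infixl 7 _/_⟨_⟩

_/_⟨_⟩ : ∀ (x y : ℝ) → 0ℝ < y → ℝ
x / y ⟨ 0<y ⟩ = x * 1/ y ⟨ 0<y ⟩

/-pos : ∀ {x y} → 0ℝ < x → (0<y : 0ℝ < y) → 0ℝ < x / y ⟨ 0<y ⟩
/-pos 0<x 0<y = *-pos 0<x (1/-pos 0<y)

^-pos : ∀ {x} → 0ℝ < x → ∀ n → 0ℝ < x ^ n
^-pos 0<x zero    = 0<1
^-pos 0<x (suc n) = *-pos 0<x (^-pos 0<x n)

opaque
  unfolding fromℚ

  private
    open +-*-Solver using (solve; _:=_; _:+_; _:*_; _:-_; con)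

    1-x*1 : ∀ x → 1ℝ - x ≈ 1ℝ - x * 1ℝ
    1-x*1 x = pointwise λ n → cong (λ z → 1ℚ ℚ.- z) (sym (ℚ.*-identityʳ (seq x n)))

    1-x*y : ∀ x y → (1ℝ - x) + x * (1ℝ - y) ≈ 1ℝ - x * y
    1-x*y x y = pointwise λ n → eq (seq x n) (seq y n)
      where
        eq : ∀ a b → (1ℚ ℚ.- a) ℚ.+ a ℚ.* (1ℚ ℚ.- b) ≡ 1ℚ ℚ.- a ℚ.* b
        eq = solve 2 (λ a b → (con 1ℚ :- a) :+ a :* (con 1ℚ :- b) := con 1ℚ :- a :* b) refl

    1-[1-x] : ∀ x y → (1ℝ - x * y) + x * y ≈ 1ℝ
    1-[1-x] x y = pointwise λ n → sub-cancel 1ℚ (seq (x * y) n)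

  0<x⇒y<y+x : ∀ {x y} → 0ℝ < x → y < x + y
  0<x⇒y<y+x {x} {y} (mk< g 0<g N p) = mk< g 0<g N λ n r →
    subst (ℚ._< seq x n ℚ.+ seq y n) (ℚ.+-comm g (seq y n))
      (ℚ.+-monoˡ-< (seq y n) {g} {seq x n} (0+<⁻¹ g (p n r)))

0<1-x^suc : ∀ {x} → 0ℝ < x → x < 1ℝ → ∀ n → 0ℝ < 1ℝ - x ^ suc n
0<1-x^suc {x} 0<x x<1 zero    = <-respʳ-≈ (1-x*1 x) (<⇒0<- x<1)
0<1-x^suc {x} 0<x x<1 (suc n) = <-respʳ-≈ (1-x*y x (x ^ suc n))
  (+-pos (<⇒0<- x<1) (*-pos 0<x (0<1-x^suc 0<x x<1 n)))

*-<1 : ∀ {x y} → 0ℝ < x → x < 1ℝ → y < 1ℝ → 0ℝ < y → x * y < 1ℝ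
*-<1 {x} {y} 0<x x<1 y<1 0<y = <-respʳ-≈ (1-[1-x] x y)
  (0<x⇒y<y+x (<-respʳ-≈ (1-x*y x y) (+-pos (<⇒0<- x<1) (*-pos 0<x (<⇒0<- y<1)))))

∏< : ℕ → (ℕ → ℝ) → ℝ
∏< zero    f = 1ℝ
∏< (suc m) f = ∏< m f * f m

∏<-pos : ∀ {f} → (∀ i → 0ℝ < f i) → ∀ m → 0ℝ < ∏< m f
∏<-pos 0<f zero    = 0<1
∏<-pos 0<f (suc m) = *-pos (∏<-pos 0<f m) (0<f m)

∑< : ℕ → (ℕ → ℝ) → ℝ
∑< zero    f = 0ℝ
∑< (suc m) f = ∑< m f + f m

infix 4 _⟶_

_⟶_ : (ℕ → ℝ) → ℝ → Set
u ⟶ l = ∀ ε → 0ℝ < ε → ∃[ N ] ∀ n → N ℕ.≤ n → ∣ u n - l ∣ < ε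

-- ∑∞ f ≈ S says that the series converges and that its sum is S.
∑∞_≈_ : (ℕ → ℝ) → ℝ → Set
∑∞ f ≈ S = (λ n → ∑< n f) ⟶ S

module q-Calculus (q : ℝ) (0<q : 0ℝ < q) (q<1 : q < 1ℝ) where

  0<1-q : 0ℝ < 1ℝ - q
  0<1-q = <⇒0<- q<1

  q^_ : ℤ → ℝ
  q^ (+ n)    = q ^ n
  q^ -[1+ n ] = (1/ q ⟨ 0<q ⟩) ^ suc n

  [_] : ℤ → ℝ
  [ m ] = (1ℝ - q^ m) / (1ℝ - q) ⟨ 0<1-q ⟩

  [suc_]-pos : ∀ i → 0ℝ < [ + suc i ]
  [suc i ]-pos = /-pos (0<1-x^suc 0<q q<1 i) 0<1-q

  [_]! : ℕ → ℝ
  [ m ]! = ∏< m λ i → [ + suc i ]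

  [_]!-pos : ∀ m → 0ℝ < [ m ]!
  [ m ]!-pos = ∏<-pos [suc_]-pos m

  -- The defining series of E_q converges at x, with sum e.
  E[_]≈_ : ℝ → ℝ → Set
  E[ x ]≈ e = ∑∞ (λ m → q ^ (m C 2) * x ^ m / [ m ]! ⟨ [ m ]!-pos ⟩) ≈ e

  H : ℕ → ℝ → ℝ
  H zero          x = 1ℝ
  H (suc zero)    x = x
  H (suc (suc n)) x = x * H (suc n) x - q ^ n * [ + suc n ] * H n x

  -- The Jackson integral ∫₀ᵇ f(x) d_q x converges, with value J.
  ∫[0,_]_≈_ : ℝ → (ℝ → ℝ) → ℝ → Set
  ∫[0, b ] f ≈ J = ∃[ S ] (∑∞ (λ m → q ^ m * f (q ^ m * b)) ≈ S) × J ≈ (1ℝ - q) * b * S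

  ∫[_,_]_≈_ : ℝ → ℝ → (ℝ → ℝ) → ℝ → Set
  ∫[ a , b ] f ≈ J = ∃[ Jb ] ∃[ Ja ] (∫[0, b ] f ≈ Jb) × (∫[0, a ] f ≈ Ja) × J ≈ Jb - Ja

module Gaussian (q : ℝ) (0<q : 0ℝ < q) (q<1 : q < 1ℝ) where

  open q-Calculus q 0<q q<1

  module q² = q-Calculus (q * q) (*-pos 0<q 0<q) (*-<1 0<q q<1 q<1 0<q)

  -- E_{q²} evaluated at -q²x²/[2]_q, where [2]_q keeps the base q.
  IsGaussianWeight : (ℝ → ℝ) → Set
  IsGaussianWeight w = ∀ x → q².E[ - (q ^ 2 * x ^ 2 / [ + 2 ] ⟨ [suc 1 ]-pos ⟩) ]≈ w x

  denominator : ℕ → ℝ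
  denominator m = (1ℝ - q ^ suc (2 ℕ.* m)) * ∏< m λ i → 1ℝ - q ^ suc (suc (2 ℕ.* i))

  denominator-pos : ∀ m → 0ℝ < denominator m
  denominator-pos m = *-pos (0<1-x^suc 0<q q<1 (2 ℕ.* m))
    (∏<-pos (λ i → 0<1-x^suc 0<q q<1 (suc (2 ℕ.* i))) m)

  -- c = c(q), where the argument √ is to be the positive square root of 1 - q.
  IsNormalization : (√ c : ℝ) → Set
  IsNormalization √ c =
    ∃[ S ] (∑∞ (λ m → (- 1ℝ) ^ m * q ^ (m ℕ.* (m ℕ.+ 1)) / denominator m ⟨ denominator-pos m ⟩) ≈ S)
         × c ≈ (1ℝ + 1ℝ) * √ * S

-- s ≤ μ₁ ≤ ⋯ ≤ μₙ ≤ n + s as one chain, so that n = 0 needs no special case.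
InY : ∀ n (s : ℕ) → Vec ℤ n → Set
InY n s μ = Linked ℤ._≤_ ((+ s) ∷ (μ ∷ʳ (+ (n ℕ.+ s))))

InY? : ∀ n s → Decidable (InY n s)
InY? n s μ = linked? ℤ._≤?_ _

tuples : ∀ {A : Set} → List A → ∀ n → List (Vec A n)
tuples xs zero    = [] ∷ []
tuples xs (suc n) = cartesianProductWith _∷_ xs (tuples xs n)

range : ℕ → ℕ → List ℤ
range n s = List.map (λ j → + (s ℕ.+ j)) (upTo (suc n))

Y : ∀ n s → List (Vec ℤ n)
Y n s = filter (InY? n s) (tuples (range n s) n)

∈Y⇔InY : ∀ {n s} {μ : Vec ℤ n} → μ ∈ Y n s ⇔ InY n s μ
∈Y⇔InY {n} {s} {μ} = mk⇔
  (λ μ∈Y → proj₂ (∈.∈-filter⁻ (InY? n s) {xs = tuples (range n s) n} μ∈Y))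
  (λ inY → ∈.∈-filter⁺ (InY? n s) (∈-tuples μ (entries ℤ.≤-refl inY)) inY)
  where
    ∈-tuples : ∀ {m xs} (ν : Vec ℤ m) → All (_∈ xs) ν → ν ∈ tuples xs m
    ∈-tuples []      []        = here refl
    ∈-tuples (x ∷ ν) (px ∷ pν) = ∈.∈-cartesianProductWith⁺ _∷_ px (∈-tuples ν pν)

    ≤-last : ∀ {m lo hi} {ν : Vec ℤ m} → Linked ℤ._≤_ (lo ∷ (ν ∷ʳ hi)) → lo ℤ.≤ hi
    ≤-last {ν = []}    (p ∷ _) = p
    ≤-last {ν = _ ∷ _} (p ∷ l) = ℤ.≤-trans p (≤-last l)

    ∈-range : ∀ {x} → + s ℤ.≤ x → x ℤ.≤ + (n ℕ.+ s) → x ∈ range n s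
    ∈-range {+ k} (ℤ.+≤+ s≤k) (ℤ.+≤+ k≤n+s) =
      subst (λ z → + z ∈ range n s) (ℕ.m+[n∸m]≡n s≤k)
        (∈.∈-map⁺ _ (∈.∈-upTo⁺ (ℕ.s≤s (subst (k ℕ.∸ s ℕ.≤_) (ℕ.m+n∸n≡m n s) (ℕ.∸-monoˡ-≤ s k≤n+s)))))

    entries : ∀ {m lo} {ν : Vec ℤ m} → + s ℤ.≤ lo →
              Linked ℤ._≤_ (lo ∷ (ν ∷ʳ (+ (n ℕ.+ s)))) → All (_∈ range n s) ν
    entries {ν = []}    _    _       = []
    entries {ν = _ ∷ _} s≤lo (p ∷ l) =
      let s≤x = ℤ.≤-trans s≤lo p in ∈-range s≤x (≤-last l) ∷ entries s≤x l

Y-unique : ∀ n s → Unique (Y n s)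
Y-unique n s = Unique.filter⁺ (InY? n s) (tuples-unique n)
  where
    range-unique : Unique (range n s)
    range-unique = Unique.map⁺ (λ e → ℕ.+-cancelˡ-≡ s _ _ (ℤ.+-injective e)) (Unique.upTo⁺ (suc n))

    tuples-unique : ∀ m → Unique (tuples (range n s) m)
    tuples-unique zero    = [] ∷ []
    tuples-unique (suc m) = Unique.cartesianProductWith⁺ _∷_ ∷-injective range-unique (tuples-unique m)

∑∈ : ∀ {A : Set} → List A → (A → ℝ) → ℝ
∑∈ xs f = List.foldr (λ x y → f x + y) 0ℝ xs

module Submission where

-- On the lattice ± ν qᵏ the weight takes the values W k = (q^{2k+2}; q²)_∞, and
-- W k = (1 - q^{2k+2}) W (k+1).  Shifting the lattice in the Jackson sum for x^{j+2}
-- turns this into ∫ x^{j+2} w = [j+1] ∫ xʲ w.  By induction on a the moments then satisfy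
--     ∫ x^{j+1} H_{a+1} w = q^a [j+1] ∫ xʲ H_a w   and   ∫ H_{a+1} w = 0,
-- so the H_a are orthogonal.  Expanding x^{2n} H_s with x H_a = H_{a+1} + q^{a-1} [a] H_{a-1}
-- gives the weight sum of the paths from height s to height s with n up-steps and n
-- down-steps, and μ_j - s counts the up-steps before the j-th down-step.

-- The theorem asserts that √(1 - q), the weight, c(q) > 0 and the integral exist as Cauchy reals
-- with moduli, so every limit has to be constructed. The limits come from comparison with a
-- geometric series, and its explicit tail bounds also do the work of continuity and of exchanging
-- sums. The constant c(q) is given by an alternating series, whereas the integral of w produces 2
-- √(1 - q) ∑ qᵏ W k. Expanding W k in powers of q²ᵏ and summing over k first shows that the two
-- agree. Positivity of c(q), hidden in the alternating form, is read off from the second form, as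
-- all W k are positive. The endpoint ν is what makes the lattice shift close up: one step outside
-- the lattice, at ν / q, the product would be (1; q²)_∞ = 0, so no boundary term appears. `Y n s`
-- also contains sequences whose path would drop below height 0. Such a path takes a down-step from
-- height 0, whose weight contains [0]_q = 0, so they add nothing to the sum.

open import Defs
open import Data.Nat.Base as ℕ using (ℕ; zero; suc; pred)
open import Data.Nat.Combinatorics using (_C_; nC1≡n; nCk+nC[k+1]≡[n+1]C[k+1])
open import Data.Integer.Base as ℤ using (ℤ; +_; -[1+_])
open import Data.Fin.Base using (Fin; toℕ)
open import Data.Vec.Base using (Vec; []; _∷_; _∷ʳ_; lookup)
open import Data.Product.Base using (Σ-syntax; ∃-syntax; _×_; _,_; proj₁; proj₂)

open import Algebra.Bundles using (CommutativeRing)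
import Algebra.Properties.CommutativeSemiring.Exp as Exp
import Algebra.Solver.Ring as RingSolver
open import Algebra.Solver.Ring.AlmostCommutativeRing using (AlmostCommutativeRing; fromCommutativeRing; _-Raw-AlmostCommutative⟶_)
open import Data.Bool.Base using (Bool; true; false; if_then_else_; _∧_)
open import Data.Empty using (⊥; ⊥-elim)
import Data.Integer.Properties as ℤ
open import Data.List.Base as List using (List; []; _∷_; _++_; filter; cartesianProductWith; applyUpTo; upTo)
open import Data.Maybe.Base using (Maybe; just; nothing)
open import Data.Nat.Coprimality as Coprime using (1-coprimeTo)
import Data.Nat.Properties as ℕ
open import Data.Nat.Solver renaming (module +-*-Solver to ℕSolver)
open import Data.Rational.Base as ℚ using (ℚ; mkℚ; 0ℚ; 1ℚ; ½)
import Data.Rational.Properties as ℚ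
open import Data.Rational.Solver renaming (module +-*-Solver to ℚSolver)
open import Data.Rational.Unnormalised.Base using (*≡*)
import Data.Rational.Unnormalised.Properties as ℚᵘ
open import Data.Sum.Base using (inj₁; inj₂)
open import Data.Vec.Relation.Unary.Linked using (linked?)
open import Function.Base using (_∘_)
import Relation.Binary.Reasoning.Base.Triple as Triple
import Relation.Binary.Reasoning.Setoid as SetoidReasoning
open import Relation.Binary.PropositionalEquality.Core using (_≡_; _≢_; refl; sym; trans; cong; cong₂; subst; subst₂)
open import Relation.Binary.Structures using (IsPreorder)
open import Relation.Nullary using (does; yes; no; contradiction)
open import Relation.Nullary.Decidable using (dec-true; dec-false)
open import Relation.Unary using (Decidable)

open ℚ-Lemmas using (½*_; ½-pos; ½+½; halves; split; ∣∣-mono; telescope; +-sub; neg-sub)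

-- The order of the reals

module R = CommutativeRing ℝ-commutativeRing

infix 4 _≤_

-- Not the negation of `y < x`: the index supplied for each tolerance is what later constructions of
-- moduli consume.
record _≤_ (x y : ℝ) : Set where
  constructor mk≤
  field
    excess : ∀ ε → 0ℚ ℚ.< ε → ∃[ N ] ∀ n → N ℕ.≤ n → seq x n ℚ.- seq y n ℚ.< ε

open _≤_ public

⊔-bounds : ∀ M N {k} → M ℕ.⊔ N ℕ.≤ k → M ℕ.≤ k × N ℕ.≤ k
⊔-bounds M N p = ℕ.m⊔n≤o⇒m≤o M N p , ℕ.m⊔n≤o⇒n≤o M N p

opaque
  unfolding fromℚ

  fromℚ-+ : ∀ p r → fromℚ (p ℚ.+ r) ≈ fromℚ p + fromℚ r
  fromℚ-+ p r = pointwise λ _ → refl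

  fromℚ-* : ∀ p r → fromℚ (p ℚ.* r) ≈ fromℚ p * fromℚ r
  fromℚ-* p r = pointwise λ _ → refl

  fromℚ-neg : ∀ p → fromℚ (ℚ.- p) ≈ - fromℚ p
  fromℚ-neg p = pointwise λ _ → refl

ℝ-almostCommutativeRing : AlmostCommutativeRing _ _
ℝ-almostCommutativeRing = fromCommutativeRing ℝ-commutativeRing

fromℚ-morphism : ℚ.+-*-rawRing -Raw-AlmostCommutative⟶ ℝ-almostCommutativeRing
fromℚ-morphism = record
  { ⟦_⟧ = fromℚ
  ; +-homo = fromℚ-+
  ; *-homo = fromℚ-*
  ; -‿homo = fromℚ-neg
  ; 0-homo = ≈-refl
  ; 1-homo = ≈-refl
  }

private
  fromℚ-coeff≟ : ∀ p r → Maybe (fromℚ p ≈ fromℚ r)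
  fromℚ-coeff≟ p r with p ℚ.≟ r
  ... | yes e = just (R.reflexive (cong fromℚ e))
  ... | no _  = nothing

-- Rational coefficients, because the identities for the square root contain ½.
module ℝ-Solver = RingSolver ℚ.+-*-rawRing ℝ-almostCommutativeRing fromℚ-morphism fromℚ-coeff≟

private
  p<r⇒p-r<0 : ∀ p r → p ℚ.< r → p ℚ.- r ℚ.< 0ℚ
  p<r⇒p-r<0 p r p<r = subst (p ℚ.- r ℚ.<_) (ℚ.+-inverseʳ r) (ℚ.+-monoˡ-< (ℚ.- r) {p} {r} p<r)

  p<p+r : ∀ p r → 0ℚ ℚ.< r → p ℚ.< p ℚ.+ r
  p<p+r p r 0<r = subst (ℚ._< p ℚ.+ r) (ℚ.+-identityʳ p) (ℚ.+-monoʳ-< p {0ℚ} {r} 0<r)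

opaque
  unfolding fromℚ

  ≤-pointwise : ∀ {x y} → (∀ n → seq x n ℚ.≤ seq y n) → x ≤ y
  ≤-pointwise {x} {y} p = mk≤ λ ε 0<ε → 0 , λ n _ → ℚ.≤-<-trans
    (subst (seq x n ℚ.- seq y n ℚ.≤_) (ℚ.+-inverseʳ (seq y n)) (ℚ.+-monoˡ-≤ (ℚ.- seq y n) (p n))) 0<ε

  ≤-reflexive : ∀ {x y} → x ≈ y → x ≤ y
  ≤-reflexive e = mk≤ λ ε 0<ε → let (N , c) = close e ε 0<ε in
    N , λ n p → ℚ.≤-<-trans (∣∣-mono _) (c n p)

  ≤-trans : ∀ {x y z} → x ≤ y → y ≤ z → x ≤ z
  ≤-trans {x} {y} {z} p r = mk≤ λ ε 0<ε →
    let (M , c) = excess p (½* ε) (½-pos 0<ε)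
        (N , d) = excess r (½* ε) (½-pos 0<ε)
    in M ℕ.⊔ N , λ n k → let (Mn , Nn) = ⊔-bounds M N k in
      subst (ℚ._< ε) (telescope (seq x n) (seq y n) (seq z n)) (halves (c n Mn) (d n Nn))

  ≤-antisym : ∀ {x y} → x ≤ y → y ≤ x → x ≈ y
  ≤-antisym {x} {y} p r = mk≈ λ ε 0<ε →
    let (M , c) = excess p ε 0<ε
        (N , d) = excess r ε 0<ε
    in M ℕ.⊔ N , λ n k → let (Mn , Nn) = ⊔-bounds M N k in
      ∣∣< (seq x n ℚ.- seq y n) (c n Mn) (subst (ℚ._< ε) (sym (neg-sub (seq x n) (seq y n))) (d n Nn))
    where
      ∣∣< : ∀ a {ε} → a ℚ.< ε → ℚ.- a ℚ.< ε → ℚ.∣ a ∣ ℚ.< ε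
      ∣∣< a p r with ℚ.∣p∣≡p∨∣p∣≡-p a
      ... | inj₁ e = subst (ℚ._< _) (sym e) p
      ... | inj₂ e = subst (ℚ._< _) (sym e) r

  +-mono-≤ : ∀ {x y u v} → x ≤ u → y ≤ v → x + y ≤ u + v
  +-mono-≤ {x} {y} {u} {v} p r = mk≤ λ ε 0<ε →
    let (M , c) = excess p (½* ε) (½-pos 0<ε)
        (N , d) = excess r (½* ε) (½-pos 0<ε)
    in M ℕ.⊔ N , λ n k → let (Mn , Nn) = ⊔-bounds M N k in
      subst (ℚ._< ε) (+-sub (seq x n) (seq y n) (seq u n) (seq v n)) (halves (c n Mn) (d n Nn))

  neg-mono-≤ : ∀ {x y} → x ≤ y → - y ≤ - x
  neg-mono-≤ {x} {y} p = mk≤ λ ε 0<ε → let (N , c) = excess p ε 0<ε in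
    N , λ n k → subst (ℚ._< ε) (eq (seq x n) (seq y n)) (c n k)
    where
      open ℚSolver
      eq : ∀ a b → a ℚ.- b ≡ ℚ.- b ℚ.- ℚ.- a
      eq = solve 2 (λ a b → a :- b := :- b :- (:- a)) refl

  <⇒≤ : ∀ {x y} → x < y → x ≤ y
  <⇒≤ {x} {y} (mk< g 0<g N p) = mk≤ λ ε 0<ε → N , λ n k → ℚ.<-trans
    (p<r⇒p-r<0 (seq x n) (seq y n) (ℚ.<-trans (p<p+r (seq x n) g 0<g) (p n k))) 0<ε

  <-≤-trans : ∀ {x y z} → x < y → y ≤ z → x < z
  <-≤-trans {x} {y} {z} (mk< g 0<g N p) r =
    let (M , c) = excess r (½* g) (½-pos 0<g) in
    mk< (½* g) (½-pos 0<g) (N ℕ.⊔ M) λ n k → let (Nn , Mn) = ⊔-bounds N M k in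
      subst₂ ℚ._<_
        (trans (cong (λ h → seq x n ℚ.+ h ℚ.- ½* g) (sym (½+½ g))) (eq₁ (seq x n) (½* g)))
        (eq₂ (seq y n) (seq z n))
        (ℚ.+-mono-< (p n Nn) (ℚ.neg-antimono-< (c n Mn)))
    where
      open ℚSolver
      eq₁ : ∀ a h → a ℚ.+ (h ℚ.+ h) ℚ.- h ≡ a ℚ.+ h
      eq₁ = solve 2 (λ a h → a :+ (h :+ h) :- h := a :+ h) refl
      eq₂ : ∀ b c → b ℚ.+ ℚ.- (b ℚ.- c) ≡ c
      eq₂ = solve 2 (λ b c → b :+ :- (b :- c) := c) refl

  ≤-<-trans : ∀ {x y z} → x ≤ y → y < z → x < z
  ≤-<-trans {x} {y} {z} r (mk< g 0<g N p) =
    let (M , c) = excess r (½* g) (½-pos 0<g) in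
    mk< (½* g) (½-pos 0<g) (N ℕ.⊔ M) λ n k → let (Nn , Mn) = ⊔-bounds N M k in
      ℚ.≤-<-trans (ℚ.≤-reflexive (eq₁ (seq x n) (seq y n) (½* g))) (ℚ.<-trans
        (ℚ.+-monoˡ-< (seq y n ℚ.+ ½* g) (c n Mn))
        (ℚ.≤-<-trans (ℚ.≤-reflexive (trans (eq₂ (½* g) (seq y n)) (cong (seq y n ℚ.+_) (½+½ g)))) (p n Nn)))
    where
      open ℚSolver
      eq₁ : ∀ a b h → a ℚ.+ h ≡ a ℚ.- b ℚ.+ (b ℚ.+ h)
      eq₁ = solve 3 (λ a b h → a :+ h := a :- b :+ (b :+ h)) refl
      eq₂ : ∀ h b → h ℚ.+ (b ℚ.+ h) ≡ b ℚ.+ (h ℚ.+ h)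
      eq₂ = solve 2 (λ h b → h :+ (b :+ h) := b :+ (h :+ h)) refl

  x≤∣x∣ : ∀ x → x ≤ ∣ x ∣
  x≤∣x∣ x = ≤-pointwise λ n → ∣∣-mono (seq x n)

  ∣-x∣≈∣x∣ : ∀ x → ∣ - x ∣ ≈ ∣ x ∣
  ∣-x∣≈∣x∣ x = pointwise λ n → ℚ.∣-p∣≡∣p∣ (seq x n)

  ∣x*y∣≈∣x∣*∣y∣ : ∀ x y → ∣ x * y ∣ ≈ ∣ x ∣ * ∣ y ∣
  ∣x*y∣≈∣x∣*∣y∣ x y = pointwise λ n → ℚ.∣p*q∣≡∣p∣*∣q∣ (seq x n) (seq y n)

  ∣x+y∣≤∣x∣+∣y∣ : ∀ x y → ∣ x + y ∣ ≤ ∣ x ∣ + ∣ y ∣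
  ∣x+y∣≤∣x∣+∣y∣ x y = ≤-pointwise λ n → ℚ.∣p+q∣≤∣p∣+∣q∣ (seq x n) (seq y n)

  ∣∣-cong : ∀ {x y} → x ≈ y → ∣ x ∣ ≈ ∣ y ∣
  ∣∣-cong {x} {y} e = mk≈ λ ε 0<ε → let (N , c) = close e ε 0<ε in
    N , λ n p → ℚ.≤-<-trans (ℚ-Lemmas.dist-∣∣ (seq x n) (seq y n)) (c n p)

  ∣x∣≤y : ∀ {x y} → x ≤ y → - x ≤ y → ∣ x ∣ ≤ y
  ∣x∣≤y {x} {y} p r = mk≤ λ ε 0<ε →
    let (M , c) = excess p ε 0<ε
        (N , d) = excess r ε 0<ε
    in M ℕ.⊔ N , λ n k → let (Mn , Nn) = ⊔-bounds M N k in
      by-sign (seq x n) (c n Mn) (d n Nn)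
    where
      by-sign : ∀ a {b ε} → a ℚ.- b ℚ.< ε → ℚ.- a ℚ.- b ℚ.< ε → ℚ.∣ a ∣ ℚ.- b ℚ.< ε
      by-sign a p r with ℚ.∣p∣≡p∨∣p∣≡-p a
      ... | inj₁ e rewrite e = p
      ... | inj₂ e rewrite e = r

  -- The source of `*-nonneg`. The terms of a nonnegative real may be negative, but the real equals
  -- its absolute value, and products of absolute values are nonnegative term by term.
  0≤∣x∣*∣y∣ : ∀ x y → 0ℝ ≤ ∣ x ∣ * ∣ y ∣
  0≤∣x∣*∣y∣ x y = ≤-pointwise λ n →
    subst (0ℚ ℚ.≤_) (ℚ.∣p*q∣≡∣p∣*∣q∣ (seq x n) (seq y n)) (ℚ.0≤∣p∣ (seq x n ℚ.* seq y n))

  fromℚ-mono-≤ : ∀ {p r} → p ℚ.≤ r → fromℚ p ≤ fromℚ r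
  fromℚ-mono-≤ p≤r = ≤-pointwise λ _ → p≤r

  fromℚ-cancel-≤ : ∀ {p r} → fromℚ p ≤ fromℚ r → p ℚ.≤ r
  fromℚ-cancel-≤ {p} {r} h with p ℚ.≤? r
  ... | yes p≤r = p≤r
  ... | no p≰r =
    let (N , c) = excess h (p ℚ.- r) (subst (ℚ._< p ℚ.- r) (ℚ.+-inverseʳ r) (ℚ.+-monoˡ-< (ℚ.- r) {r} {p} (ℚ.≰⇒> p≰r)))
    in ⊥-elim (ℚ.<-irrefl refl (c N ℕ.≤-refl))

  fromℚ-pos : ∀ {p} → 0ℚ ℚ.< p → 0ℝ < fromℚ p
  fromℚ-pos {p} 0<p = mk< (½* p) (½-pos 0<p) 0 λ _ _ →
    subst₂ ℚ._<_ (sym (ℚ.+-identityˡ (½* p))) (½+½ p) (p<p+r (½* p) (½* p) (½-pos 0<p))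

  fromℚ-∣∣ : ∀ p → fromℚ ℚ.∣ p ∣ ≈ ∣ fromℚ p ∣
  fromℚ-∣∣ p = pointwise λ _ → refl

  rational-below : ∀ {x} → 0ℝ < x → ∃[ g ] 0ℚ ℚ.< g × fromℚ g < x
  rational-below {x} (mk< g 0<g N p) = ½* g , ½-pos 0<g , mk< (½* g) (½-pos 0<g) N λ n k →
    subst (ℚ._< seq x n) (trans (ℚ.+-identityˡ g) (sym (½+½ g))) (p n k)

  ≤-by-ε : ∀ {x y} → (∀ ε → 0ℚ ℚ.< ε → x ≤ y + fromℚ ε) → x ≤ y
  ≤-by-ε {x} {y} h = mk≤ λ ε 0<ε →
    let (N , c) = excess (h (½* ε) (½-pos 0<ε)) (½* ε) (½-pos 0<ε) in
    N , λ n k → subst₂ ℚ._<_ (eq (seq x n) (seq y n) (½* ε)) (½+½ ε) (ℚ.+-monoˡ-< (½* ε) (c n k))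
    where
      open ℚSolver
      eq : ∀ a b h → a ℚ.- (b ℚ.+ h) ℚ.+ h ≡ a ℚ.- b
      eq = solve 3 (λ a b h → a :- (b :+ h) :+ h := a :- b) refl

  seq-approximates : ∀ x ε → 0ℚ ℚ.< ε → ∃[ N ] ∀ n → N ℕ.≤ n → ∣ fromℚ (seq x n) - x ∣ ≤ fromℚ ε
  seq-approximates x ε 0<ε = let (N , c) = cauchy x ε 0<ε in
    N , λ n p → mk≤ λ η 0<η → N , λ m k → ℚ.<-trans
      (p<r⇒p-r<0 _ ε (c n m p k)) 0<η

open ℝ-Solver using (solve; _:=_; _:+_; _:*_; _:-_; :-_; con)
open Exp R.commutativeSemiring using (^-congˡ; ^-homo-*; ^-distrib-*; ^-assocʳ)

≤-refl : ∀ {x} → x ≤ x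
≤-refl = ≤-reflexive ≈-refl

<-trans : ∀ {x y z} → x < y → y < z → x < z
<-trans p r = <-≤-trans p (<⇒≤ r)

opaque
  unfolding fromℚ

  <-irrefl : ∀ {x} → x < x → ⊥
  <-irrefl {x} (mk< g 0<g N p) = ℚ.<-irrefl refl (ℚ.<-trans (p<p+r (seq x N) g 0<g) (p N ℕ.≤-refl))

≤-isPreorder : IsPreorder _≈_ _≤_
≤-isPreorder = record { isEquivalence = R.isEquivalence ; reflexive = ≤-reflexive ; trans = ≤-trans }

module ≤-Reasoning = Triple ≤-isPreorder
  (λ p r → <-irrefl (<-trans p r)) <-trans
  ((λ e p → <-≤-trans p (≤-reflexive e)) , (λ e p → ≤-<-trans (≤-reflexive (≈-sym e)) p))
  <⇒≤ <-≤-trans ≤-<-trans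
  hiding (step-≈; step-≈˘)

≤-respˡ : ∀ {x y z} → x ≈ y → x ≤ z → y ≤ z
≤-respˡ e p = ≤-trans (≤-reflexive (≈-sym e)) p

≤-respʳ : ∀ {x y z} → y ≈ z → x ≤ y → x ≤ z
≤-respʳ e p = ≤-trans p (≤-reflexive e)

∣x∣≤y⇒x≤y : ∀ {x y} → ∣ x ∣ ≤ y → x ≤ y
∣x∣≤y⇒x≤y p = ≤-trans (x≤∣x∣ _) p

0≤∣x∣ : ∀ x → 0ℝ ≤ ∣ x ∣
0≤∣x∣ x = ≤-respʳ (≈-trans (R.*-cong (≈-refl {∣ x ∣}) ∣1∣≈1) (R.*-identityʳ _)) (0≤∣x∣*∣y∣ x 1ℝ)
  where
    ∣1∣≈1 : ∣ 1ℝ ∣ ≈ 1ℝ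
    ∣1∣≈1 = ≈-sym (fromℚ-∣∣ 1ℚ)

0≤x⇒∣x∣≈x : ∀ {x} → 0ℝ ≤ x → ∣ x ∣ ≈ x
0≤x⇒∣x∣≈x {x} 0≤x = ≤-antisym (∣x∣≤y ≤-refl (≤-trans
  (≤-respʳ (solve 0 (:- con 0ℚ := con 0ℚ) ≈-refl) (neg-mono-≤ 0≤x)) 0≤x)) (x≤∣x∣ x)

*-nonneg : ∀ {x y} → 0ℝ ≤ x → 0ℝ ≤ y → 0ℝ ≤ x * y
*-nonneg {x} {y} 0≤x 0≤y = ≤-respʳ (R.*-cong (0≤x⇒∣x∣≈x 0≤x) (0≤x⇒∣x∣≈x 0≤y)) (0≤∣x∣*∣y∣ x y)

≤⇒0≤- : ∀ {x y} → x ≤ y → 0ℝ ≤ y - x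
≤⇒0≤- {x} p = ≤-respˡ (R.-‿inverseʳ x) (+-mono-≤ p ≤-refl)

0≤-⇒≤ : ∀ {x y} → 0ℝ ≤ y - x → x ≤ y
0≤-⇒≤ {x} {y} p = ≤-respˡ (R.+-identityˡ x)
  (≤-respʳ (solve 2 (λ x y → y :- x :+ x := y) ≈-refl x y) (+-mono-≤ p (≤-refl {x})))

*-monoʳ-≤ : ∀ {x y c} → 0ℝ ≤ c → x ≤ y → c * x ≤ c * y
*-monoʳ-≤ {x} {y} {c} 0≤c p = 0≤-⇒≤ (≤-respʳ
  (solve 3 (λ x y c → c :* (y :- x) := c :* y :- c :* x) ≈-refl x y c)
  (*-nonneg 0≤c (≤⇒0≤- p)))

*-mono-≤ : ∀ {x y u v} → 0ℝ ≤ x → 0ℝ ≤ v → x ≤ u → y ≤ v → x * y ≤ u * v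
*-mono-≤ 0≤x 0≤v p r = ≤-trans (*-monoʳ-≤ 0≤x r)
  (≤-respˡ (R.*-comm _ _) (≤-respʳ (R.*-comm _ _) (*-monoʳ-≤ 0≤v p)))

∣x-y∣≈∣y-x∣ : ∀ x y → ∣ x - y ∣ ≈ ∣ y - x ∣
∣x-y∣≈∣y-x∣ x y = ≈-trans (≈-sym (∣-x∣≈∣x∣ _))
  (∣∣-cong (solve 2 (λ x y → :- (x :- y) := y :- x) ≈-refl x y))

triangle : ∀ x y z → ∣ x - z ∣ ≤ ∣ x - y ∣ + ∣ y - z ∣
triangle x y z = ≤-respˡ (∣∣-cong (solve 3 (λ x y z → (x :- y) :+ (y :- z) := x :- z) ≈-refl x y z))
  (∣x+y∣≤∣x∣+∣y∣ (x - y) (y - z))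

∣x-y∣≤0⇒x≈y : ∀ {x y} → ∣ x - y ∣ ≤ 0ℝ → x ≈ y
∣x-y∣≤0⇒x≈y {x} {y} p = ≤-antisym
  (0≤-⇒≤ (≤-respʳ (solve 2 (λ x y → :- (x :- y) := y :- x) ≈-refl x y)
    (≤-respˡ (solve 0 (:- con 0ℚ := con 0ℚ) ≈-refl) (neg-mono-≤ (∣x∣≤y⇒x≤y p)))))
  (0≤-⇒≤ (≤-respʳ (solve 2 (λ x y → :- (y :- x) := x :- y) ≈-refl x y)
    (≤-respˡ (solve 0 (:- con 0ℚ := con 0ℚ) ≈-refl) (neg-mono-≤ (∣x∣≤y⇒x≤y (≤-respˡ (∣x-y∣≈∣y-x∣ x y) p))))))

-- Limits and completeness

module ≈-Reasoning = SetoidReasoning R.setoid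

fromℚ-½+½ : ∀ ε → fromℚ (½* ε) + fromℚ (½* ε) ≈ fromℚ ε
fromℚ-½+½ ε = ≈-trans (≈-sym (fromℚ-+ _ _)) (R.reflexive (cong fromℚ (½+½ ε)))

abs-bound : ∀ x → ∃[ B ] 0ℚ ℚ.< B × ∣ x ∣ ≤ fromℚ B
abs-bound x =
  let (N , c) = seq-approximates x 1ℚ ℚ-Lemmas.0<1
      a = seq x N
  in ℚ.∣ a ∣ ℚ.+ 1ℚ
   , ℚ.≤-<-trans (ℚ.0≤∣p∣ a) (subst (ℚ._< ℚ.∣ a ∣ ℚ.+ 1ℚ) (ℚ.+-identityʳ _) (ℚ.+-monoʳ-< ℚ.∣ a ∣ {0ℚ} {1ℚ} ℚ-Lemmas.0<1))
   , (begin
      ∣ x ∣                                     ≈⟨ ∣∣-cong (solve 2 (λ x a → x := (x :- a) :+ a) ≈-refl x (fromℚ a)) ⟩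
      ∣ (x - fromℚ a) + fromℚ a ∣               ≤⟨ ∣x+y∣≤∣x∣+∣y∣ _ _ ⟩
      ∣ x - fromℚ a ∣ + ∣ fromℚ a ∣             ≤⟨ +-mono-≤ (≤-respˡ (∣x-y∣≈∣y-x∣ _ _) (c N ℕ.≤-refl)) (≤-reflexive (≈-sym (fromℚ-∣∣ a))) ⟩
      1ℝ + fromℚ ℚ.∣ a ∣                        ≈⟨ R.+-comm _ _ ⟩
      fromℚ ℚ.∣ a ∣ + 1ℝ                        ≈⟨ ≈-sym (fromℚ-+ _ _) ⟩
      fromℚ (ℚ.∣ a ∣ ℚ.+ 1ℚ)                    ∎)
  where open ≤-Reasoning

-- Below every positive real lies a positive rational, so rational tolerances and weak bounds
-- suffice.
⟶-intro : ∀ {u l} → (∀ ε → 0ℚ ℚ.< ε → ∃[ N ] ∀ n → N ℕ.≤ n → ∣ u n - l ∣ ≤ fromℚ ε) → u ⟶ l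
⟶-intro h ε 0<ε =
  let (g , 0<g , g<ε) = rational-below 0<ε
      (N , c) = h g 0<g
  in N , λ n p → ≤-<-trans (c n p) g<ε

⟶-elim : ∀ {u l} → u ⟶ l → ∀ ε → 0ℚ ℚ.< ε → ∃[ N ] ∀ n → N ℕ.≤ n → ∣ u n - l ∣ ≤ fromℚ ε
⟶-elim h ε 0<ε = let (N , c) = h (fromℚ ε) (fromℚ-pos 0<ε) in N , λ n p → <⇒≤ (c n p)

module _ where
  open ≤-Reasoning

  ⟶-+ : ∀ {u v k l} → u ⟶ k → v ⟶ l → (λ n → u n + v n) ⟶ (k + l)
  ⟶-+ {u} {v} {k} {l} U V = ⟶-intro λ ε 0<ε →
    let (M , c) = ⟶-elim U (½* ε) (½-pos 0<ε)
        (N , d) = ⟶-elim V (½* ε) (½-pos 0<ε)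
    in M ℕ.⊔ N , λ n p → let (Mn , Nn) = ⊔-bounds M N p in begin
      ∣ u n + v n - (k + l) ∣
        ≈⟨ ∣∣-cong (solve 4 (λ a b k l → a :+ b :- (k :+ l) := (a :- k) :+ (b :- l)) ≈-refl (u n) (v n) k l) ⟩
      ∣ (u n - k) + (v n - l) ∣         ≤⟨ ∣x+y∣≤∣x∣+∣y∣ _ _ ⟩
      ∣ u n - k ∣ + ∣ v n - l ∣         ≤⟨ +-mono-≤ (c n Mn) (d n Nn) ⟩
      fromℚ (½* ε) + fromℚ (½* ε)       ≈⟨ fromℚ-½+½ ε ⟩
      fromℚ ε                           ∎

  ⟶-scale : ∀ {u l} c → u ⟶ l → (λ n → c * u n) ⟶ (c * l)
  ⟶-scale {u} {l} c U = ⟶-intro λ ε 0<ε →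
    let (B , 0<B , b) = abs-bound c
        (δ , 0<δ , Bδ) = split 0<B 0<ε
        (N , d) = ⟶-elim U δ 0<δ
    in N , λ n p → begin
      ∣ c * u n - c * l ∣      ≈⟨ ∣∣-cong (solve 3 (λ c a b → c :* a :- c :* b := c :* (a :- b)) ≈-refl c (u n) l) ⟩
      ∣ c * (u n - l) ∣        ≈⟨ ∣x*y∣≈∣x∣*∣y∣ _ _ ⟩
      ∣ c ∣ * ∣ u n - l ∣      ≤⟨ *-mono-≤ (0≤∣x∣ c) (<⇒≤ (fromℚ-pos 0<δ)) b (d n p) ⟩
      fromℚ B * fromℚ δ        ≈⟨ ≈-sym (fromℚ-* B δ) ⟩
      fromℚ (B ℚ.* δ)          ≈⟨ R.reflexive (cong fromℚ Bδ) ⟩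
      fromℚ (½* ε)             ≤⟨ fromℚ-mono-≤ (subst₂ ℚ._≤_ (ℚ.+-identityʳ (½* ε)) (½+½ ε)
                                    (ℚ.+-monoʳ-≤ (½* ε) {0ℚ} {½* ε} (ℚ.<⇒≤ (½-pos 0<ε)))) ⟩
      fromℚ ε                  ∎

  ⟶-unique : ∀ {u k l} → u ⟶ k → u ⟶ l → k ≈ l
  ⟶-unique {u} {k} {l} U V = ∣x-y∣≤0⇒x≈y (≤-by-ε λ ε 0<ε →
    let (M , c) = ⟶-elim U (½* ε) (½-pos 0<ε)
        (N , d) = ⟶-elim V (½* ε) (½-pos 0<ε)
        n = M ℕ.⊔ N
    in begin
      ∣ k - l ∣                     ≤⟨ triangle k (u n) l ⟩
      ∣ k - u n ∣ + ∣ u n - l ∣     ≤⟨ +-mono-≤ (≤-respˡ (∣x-y∣≈∣y-x∣ _ _) (c n (ℕ.m≤m⊔n M N))) (d n (ℕ.m≤n⊔m M N)) ⟩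
      fromℚ (½* ε) + fromℚ (½* ε)   ≈⟨ fromℚ-½+½ ε ⟩
      fromℚ ε                       ≈⟨ ≈-sym (R.+-identityˡ _) ⟩
      0ℝ + fromℚ ε                  ∎)

  ⟶-cong : ∀ {u v k l} → (∀ n → u n ≈ v n) → k ≈ l → u ⟶ k → v ⟶ l
  ⟶-cong {u} {v} {k} {l} e f U ε 0<ε = let (N , c) = U ε 0<ε in
    N , λ n p → ≤-<-trans (≤-reflexive (∣∣-cong (R.+-cong (≈-sym (e n)) (R.-‿cong (≈-sym f))))) (c n p)

  ⟶-const : ∀ l → (λ _ → l) ⟶ l
  ⟶-const l ε 0<ε = 0 , λ _ _ → ≤-<-trans
    (≤-reflexive (≈-trans (∣∣-cong (R.-‿inverseʳ l)) (0≤x⇒∣x∣≈x ≤-refl))) 0<ε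

  ⟶-suc : ∀ {u l} → u ⟶ l → (λ n → u (suc n)) ⟶ l
  ⟶-suc U ε 0<ε = let (N , c) = U ε 0<ε in N , λ n p → c (suc n) (ℕ.m≤n⇒m≤1+n p)

  ⟶-suc⁻¹ : ∀ {u l} → (λ n → u (suc n)) ⟶ l → u ⟶ l
  ⟶-suc⁻¹ U ε 0<ε = let (N , c) = U ε 0<ε in suc N , λ where (suc n) (ℕ.s≤s p) → c n p

  ⟶-≤ : ∀ {u l y} → (∀ n → u n ≤ y) → u ⟶ l → l ≤ y
  ⟶-≤ {u} {l} {y} h U = ≤-by-ε λ ε 0<ε → let (N , c) = ⟶-elim U ε 0<ε in begin
    l                  ≈⟨ solve 2 (λ l a → l := a :+ (l :- a)) ≈-refl l (u N) ⟩
    u N + (l - u N)    ≤⟨ +-mono-≤ (h N) (∣x∣≤y⇒x≤y (≤-respˡ (∣x-y∣≈∣y-x∣ _ _) (c N ℕ.≤-refl))) ⟩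
    y + fromℚ ε        ∎

  ⟶-squeeze : ∀ {u v l} → (∀ n → ∣ u n - l ∣ ≤ v n) → v ⟶ 0ℝ → u ⟶ l
  ⟶-squeeze {u} {v} {l} h V = ⟶-intro λ ε 0<ε → let (N , c) = ⟶-elim V ε 0<ε in
    N , λ n p → begin
      ∣ u n - l ∣   ≤⟨ h n ⟩
      v n           ≈⟨ solve 1 (λ x → x := x :- con 0ℚ) ≈-refl (v n) ⟩
      v n - 0ℝ      ≤⟨ ∣x∣≤y⇒x≤y (c n p) ⟩
      fromℚ ε       ∎

natℚ : ℕ → ℚ
natℚ n = mkℚ (+ n) 0 (Coprime.sym (1-coprimeTo n))

1/suc : ℕ → ℚ
1/suc n = ℚ.1/ natℚ (suc n)

1/suc-pos : ∀ n → 0ℚ ℚ.< 1/suc n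
1/suc-pos n = ℚ.positive⁻¹ (1/suc n)

natℚ-suc : ∀ n → natℚ (suc n) ≡ 1ℚ ℚ.+ natℚ n
natℚ-suc n = ℚ.toℚᵘ-injective (ℚᵘ.≃-sym (ℚᵘ.≃-trans (ℚ.toℚᵘ-homo-+ 1ℚ (natℚ n))
  (*≡* (cong (λ z → z ℤ.* (+ 1)) (cong (λ z → (+ 1) ℤ.+ z) (ℤ.*-identityʳ (+ n)))))))

1/suc-archimedean : ∀ ε → 0ℚ ℚ.< ε → ∃[ N ] ∀ n → N ℕ.≤ n → 1/suc n ℚ.≤ ε
1/suc-archimedean ε 0<ε = bound ε (ℚ.positive 0<ε)
  where
    bound : ∀ ε → ℚ.Positive ε → ∃[ N ] ∀ n → N ℕ.≤ n → 1/suc n ℚ.≤ ε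
    -- Here ε = (a + 1)/(d + 1), so 1/(n + 1) ≤ 1/(d + 1) ≤ ε once d ≤ n.
    bound (mkℚ (+ suc a) d _) _ = d , λ n d≤n → ℚ.*≤* (subst₂ ℤ._≤_
      (sym (ℤ.*-identityˡ (+ suc d))) (ℤ.pos-* (suc a) (suc n))
      (ℤ.+≤+ (ℕ.≤-trans (ℕ.s≤s d≤n) (ℕ.m≤m+n (suc n) (a ℕ.* suc n)))))

-- The limit is a diagonal sequence: its k-th term is a rational within 1/(k + 1) of `u k`.
complete : ∀ {u} → (∀ ε → 0ℚ ℚ.< ε → ∃[ N ] ∀ m n → N ℕ.≤ m → N ℕ.≤ n → ∣ u m - u n ∣ ≤ fromℚ ε) →
           ∃[ l ] u ⟶ l
complete {u} U = l , ⟶-intro λ ε 0<ε →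
  let h = ½* ε ; 0<h = ½-pos 0<ε
      (M , c) = 1/suc-archimedean h 0<h
      (N , d) = seq-approximates l h 0<h
  in M ℕ.⊔ N , λ n p → let (Mn , Nn) = ⊔-bounds M N p in begin
    ∣ u n - l ∣                             ≤⟨ triangle (u n) (fromℚ (a n)) l ⟩
    ∣ u n - fromℚ (a n) ∣ + ∣ fromℚ (a n) - l ∣
      ≤⟨ +-mono-≤ (≤-respˡ (∣x-y∣≈∣y-x∣ _ _) (≤-trans (a≈u n) (fromℚ-mono-≤ (c n Mn)))) (d n Nn) ⟩
    fromℚ h + fromℚ h                       ≈⟨ fromℚ-½+½ ε ⟩
    fromℚ ε                                 ∎
  where
    open ≤-Reasoning

    a : ℕ → ℚ
    a k = let (N , _) = seq-approximates (u k) (1/suc k) (1/suc-pos k) in seq (u k) N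

    a≈u : ∀ k → ∣ fromℚ (a k) - u k ∣ ≤ fromℚ (1/suc k)
    a≈u k = let (N , c) = seq-approximates (u k) (1/suc k) (1/suc-pos k) in c N ℕ.≤-refl

    l : ℝ
    l = mkℝ a λ ε 0<ε →
      -- The three errors are ε/8, ε/4 and ε/8. They add up to ε/2, and the slack yields the strict
      -- inequality.
      let h = ½* ε ; 0<h = ½-pos 0<ε
          k = ½* h ; 0<k = ½-pos 0<h
          j = ½* k ; 0<j = ½-pos 0<k
          (M , c) = 1/suc-archimedean j 0<j
          (N , d) = U k 0<k
      in M ℕ.⊔ N , λ m n p r →
        let (Mm , Nm) = ⊔-bounds M N p ; (Mn , Nn) = ⊔-bounds M N r in
        ℚ.≤-<-trans {ℚ.∣ a m ℚ.- a n ∣} {h} (fromℚ-cancel-≤ (begin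
          fromℚ ℚ.∣ a m ℚ.- a n ∣           ≈⟨ fromℚ-∣∣ _ ⟩
          ∣ fromℚ (a m ℚ.- a n) ∣           ≈⟨ ∣∣-cong (≈-trans (fromℚ-+ _ _) (R.+-congˡ (fromℚ-neg _))) ⟩
          ∣ fromℚ (a m) - fromℚ (a n) ∣     ≤⟨ triangle _ (u m) _ ⟩
          ∣ fromℚ (a m) - u m ∣ + ∣ u m - fromℚ (a n) ∣
            ≤⟨ +-mono-≤ (≤-trans (a≈u m) (fromℚ-mono-≤ (c m Mm))) (triangle _ (u n) _) ⟩
          fromℚ j + (∣ u m - u n ∣ + ∣ u n - fromℚ (a n) ∣)
            ≤⟨ +-mono-≤ ≤-refl (+-mono-≤ (d m n Nm Nn)
                 (≤-respˡ (∣x-y∣≈∣y-x∣ _ _) (≤-trans (a≈u n) (fromℚ-mono-≤ (c n Mn))))) ⟩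
          fromℚ j + (fromℚ k + fromℚ j)     ≈⟨ solve 2 (λ j k → j :+ (k :+ j) := (j :+ j) :+ k) ≈-refl (fromℚ j) (fromℚ k) ⟩
          (fromℚ j + fromℚ j) + fromℚ k     ≈⟨ R.+-congʳ (fromℚ-½+½ k) ⟩
          fromℚ k + fromℚ k                 ≈⟨ fromℚ-½+½ h ⟩
          fromℚ h                           ∎))
        (subst₂ ℚ._<_ (ℚ.+-identityʳ h) (½+½ ε) (ℚ.+-monoʳ-< h {0ℚ} {h} 0<h))

-- Series and the geometric comparison test

⟶-drop : ∀ {u l} N → u ⟶ l → (λ n → u (n ℕ.+ N)) ⟶ l
⟶-drop N U ε 0<ε = let (M , c) = U ε 0<ε in M , λ n p → c (n ℕ.+ N) (ℕ.≤-trans p (ℕ.m≤m+n n N))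

⟶-neg : ∀ {u l} → u ⟶ l → (λ n → - u n) ⟶ (- l)
⟶-neg U = ⟶-cong (λ n → minus _) (minus _) (⟶-scale (- 1ℝ) U)
  where
    minus : ∀ x → - 1ℝ * x ≈ - x
    minus = solve 1 (λ x → :- con 1ℚ :* x := :- x) ≈-refl

⟶-∣∣≤ : ∀ {u l y} → (∀ n → ∣ u n ∣ ≤ y) → u ⟶ l → ∣ l ∣ ≤ y
⟶-∣∣≤ h U = ∣x∣≤y (⟶-≤ (λ n → ∣x∣≤y⇒x≤y (h n)) U)
  (⟶-≤ (λ n → ∣x∣≤y⇒x≤y (≤-respˡ (≈-sym (∣-x∣≈∣x∣ _)) (h n))) (⟶-neg U))

⟶-≥ : ∀ {u l y} → (∀ n → y ≤ u n) → u ⟶ l → y ≤ l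
⟶-≥ h U = ≤-respˡ (minus-minus _) (≤-respʳ (minus-minus _) (neg-mono-≤ (⟶-≤ (λ n → neg-mono-≤ (h n)) (⟶-neg U))))
  where
    minus-minus : ∀ x → - - x ≈ x
    minus-minus = solve 1 (λ x → :- (:- x) := x) ≈-refl

∑<-cong : ∀ {f g} → (∀ m → f m ≈ g m) → ∀ n → ∑< n f ≈ ∑< n g
∑<-cong e zero    = ≈-refl
∑<-cong e (suc n) = R.+-cong (∑<-cong e n) (e n)

∑<-+ : ∀ f g n → ∑< n f + ∑< n g ≈ ∑< n (λ m → f m + g m)
∑<-+ f g zero    = R.+-identityˡ 0ℝ
∑<-+ f g (suc n) = ≈-trans
  (solve 4 (λ a b c d → (a :+ b) :+ (c :+ d) := (a :+ c) :+ (b :+ d)) ≈-refl (∑< n f) (f n) (∑< n g) (g n))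
  (R.+-congʳ (∑<-+ f g n))

∑<-scale : ∀ c f n → c * ∑< n f ≈ ∑< n (λ m → c * f m)
∑<-scale c f zero    = R.zeroʳ c
∑<-scale c f (suc n) = ≈-trans (R.distribˡ c _ _) (R.+-congʳ (∑<-scale c f n))

∑<-suc : ∀ f n → ∑< (suc n) f ≈ f 0 + ∑< n (λ m → f (suc m))
∑<-suc f zero    = R.+-comm _ _
∑<-suc f (suc n) = ≈-trans (R.+-congʳ (∑<-suc f n)) (R.+-assoc _ _ _)

∑∞-cong : ∀ {f g S T} → (∀ m → f m ≈ g m) → S ≈ T → ∑∞ f ≈ S → ∑∞ g ≈ T
∑∞-cong e = ⟶-cong (∑<-cong e)

∑∞-+ : ∀ {f g S T} → ∑∞ f ≈ S → ∑∞ g ≈ T → ∑∞ (λ m → f m + g m) ≈ (S + T)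
∑∞-+ F G = ⟶-cong (∑<-+ _ _) ≈-refl (⟶-+ F G)

∑∞-scale : ∀ {f S} c → ∑∞ f ≈ S → ∑∞ (λ m → c * f m) ≈ (c * S)
∑∞-scale c F = ⟶-cong (∑<-scale c _) ≈-refl (⟶-scale c F)

∑∞-suc : ∀ {f S} → ∑∞ f ≈ S → ∑∞ (λ m → f (suc m)) ≈ (S - f 0)
∑∞-suc {f} {S} F = ⟶-cong
  (λ n → ≈-trans (R.+-congʳ (∑<-suc f n))
    (solve 2 (λ a b → (a :+ b) :- a := b) ≈-refl (f 0) (∑< n (λ m → f (suc m)))))
  ≈-refl (⟶-+ (⟶-suc F) (⟶-const (- f 0)))

1/suc⟶0 : (λ n → fromℚ (1/suc n)) ⟶ 0ℝ
1/suc⟶0 = ⟶-intro λ ε 0<ε → let (N , c) = 1/suc-archimedean ε 0<ε in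
  N , λ n p → begin
    ∣ fromℚ (1/suc n) - 0ℝ ∣    ≈⟨ ∣∣-cong (solve 1 (λ x → x :- con 0ℚ := x) ≈-refl _) ⟩
    ∣ fromℚ (1/suc n) ∣         ≈⟨ 0≤x⇒∣x∣≈x (<⇒≤ (fromℚ-pos (1/suc-pos n))) ⟩
    fromℚ (1/suc n)             ≤⟨ fromℚ-mono-≤ (c n p) ⟩
    fromℚ ε                     ∎
  where open ≤-Reasoning

^-nonneg : ∀ {x} → 0ℝ ≤ x → ∀ n → 0ℝ ≤ x ^ n
^-nonneg 0≤x zero    = <⇒≤ 0<1
^-nonneg 0≤x (suc n) = *-nonneg 0≤x (^-nonneg 0≤x n)

^≤1 : ∀ {x} → 0ℝ ≤ x → x ≤ 1ℝ → ∀ n → x ^ n ≤ 1ℝ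
^≤1 0≤x x≤1 zero    = ≤-refl
^≤1 0≤x x≤1 (suc n) = ≤-respʳ (R.*-identityˡ 1ℝ) (*-mono-≤ 0≤x (<⇒≤ 0<1) x≤1 (^≤1 0≤x x≤1 n))

1/-cancel : ∀ {x} (0<x : 0ℝ < x) y → x * (1/ x ⟨ 0<x ⟩ * y) ≈ y
1/-cancel 0<x y = ≈-trans (≈-sym (R.*-assoc _ _ _)) (≈-trans (R.*-congʳ (*-inverseʳ 0<x)) (R.*-identityˡ y))

module Geometric {r : ℝ} (0<r : 0ℝ < r) (r<1 : r < 1ℝ) where

  private
    0<1-r : 0ℝ < 1ℝ - r
    0<1-r = <⇒0<- r<1

    0≤r : 0ℝ ≤ r
    0≤r = <⇒≤ 0<r

  r^≤1 : ∀ n → r ^ n ≤ 1ℝ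
  r^≤1 = ^≤1 0≤r (<⇒≤ r<1)

  1/[1-r] : ℝ
  1/[1-r] = 1/ 1ℝ - r ⟨ 0<1-r ⟩

  0≤1/[1-r] : 0ℝ ≤ 1/[1-r]
  0≤1/[1-r] = <⇒≤ (1/-pos 0<1-r)

  -- Summing 1 ≥ rᵏ ≥ rⁿ over k < n.
  n*r^n[1-r]≤1-r^n : ∀ n → fromℚ (natℚ n) * (r ^ n * (1ℝ - r)) ≤ 1ℝ - r ^ n
  n*r^n[1-r]≤1-r^n zero = ≤-reflexive (solve 1 (λ r → con 0ℚ :* (con 1ℚ :* (con 1ℚ :- r)) := con 1ℚ :- con 1ℚ) ≈-refl r)
  n*r^n[1-r]≤1-r^n (suc n) = begin
    fromℚ (natℚ (suc n)) * (r * y * (1ℝ - r))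
      ≈⟨ R.*-congʳ (≈-trans (R.reflexive (cong fromℚ (natℚ-suc n))) (fromℚ-+ _ _)) ⟩
    (1ℝ + x) * (r * y * (1ℝ - r))
      ≈⟨ solve 3 (λ x r y → (con 1ℚ :+ x) :* (r :* y :* (con 1ℚ :- r)) :=
           r :* (x :* (y :* (con 1ℚ :- r))) :+ r :* y :* (con 1ℚ :- r)) ≈-refl x r y ⟩
    r * (x * (y * (1ℝ - r))) + r * y * (1ℝ - r)
      ≤⟨ +-mono-≤ (*-monoʳ-≤ 0≤r (n*r^n[1-r]≤1-r^n n)) ≤-refl ⟩
    r * (1ℝ - y) + r * y * (1ℝ - r)
      ≈⟨ solve 2 (λ r y → r :* (con 1ℚ :- y) :+ r :* y :* (con 1ℚ :- r) :=
           con 1ℚ :- r :* y :- (con 1ℚ :- r) :* (con 1ℚ :- r :* y)) ≈-refl r y ⟩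
    1ℝ - r * y - (1ℝ - r) * (1ℝ - r * y)
      ≤⟨ +-mono-≤ ≤-refl (neg-mono-≤ (*-nonneg (<⇒≤ 0<1-r) (≤⇒0≤- (r^≤1 (suc n))))) ⟩
    1ℝ - r * y - 0ℝ
      ≈⟨ solve 1 (λ z → z :- con 0ℚ := z) ≈-refl _ ⟩
    1ℝ - r * y  ∎
    where
      open ≤-Reasoning
      x = fromℚ (natℚ n)
      y = r ^ n

  -- The preceding estimate gives (n + 1) rⁿ⁺¹ (1 - r) ≤ 1, hence rⁿ⁺¹ ≤ 1/((n + 1)(1 - r)).
  r^⟶0 : (λ n → r ^ n) ⟶ 0ℝ
  r^⟶0 = ⟶-suc⁻¹ (⟶-squeeze bound (⟶-cong (λ _ → ≈-refl) (R.zeroʳ _) (⟶-scale 1/[1-r] 1/suc⟶0)))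
    where
      open ≤-Reasoning
      bound : ∀ n → ∣ r ^ suc n - 0ℝ ∣ ≤ 1/[1-r] * fromℚ (1/suc n)
      bound n = begin
        ∣ y - 0ℝ ∣                            ≈⟨ ∣∣-cong (solve 1 (λ x → x :- con 0ℚ := x) ≈-refl _) ⟩
        ∣ y ∣                                 ≈⟨ 0≤x⇒∣x∣≈x (^-nonneg 0≤r (suc n)) ⟩
        y                                     ≈⟨ solve 1 (λ y → y := con 1ℚ :* (con 1ℚ :* y)) ≈-refl y ⟩
        1ℝ * (1ℝ * y)                         ≈⟨ R.*-cong (≈-sym (≈-trans (≈-sym (fromℚ-* _ _))
                                                   (R.reflexive (cong fromℚ (ℚ.*-inverseˡ (natℚ (suc n)))))))
                                                   (R.*-congʳ (≈-sym (*-inverseʳ 0<1-r))) ⟩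
        (d * k) * (((1ℝ - r) * 1/[1-r]) * y)  ≈⟨ solve 5 (λ d k r g y → (d :* k) :* (((con 1ℚ :- r) :* g) :* y) :=
                                                   (g :* d) :* (k :* (y :* (con 1ℚ :- r)))) ≈-refl d k r 1/[1-r] y ⟩
        (1/[1-r] * d) * (k * (y * (1ℝ - r)))  ≤⟨ *-monoʳ-≤ 0≤gd (n*r^n[1-r]≤1-r^n (suc n)) ⟩
        (1/[1-r] * d) * (1ℝ - y)              ≤⟨ *-monoʳ-≤ 0≤gd (+-mono-≤ ≤-refl (neg-mono-≤ (^-nonneg 0≤r (suc n)))) ⟩
        (1/[1-r] * d) * (1ℝ - 0ℝ)             ≈⟨ solve 1 (λ x → x :* (con 1ℚ :- con 0ℚ) := x) ≈-refl _ ⟩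
        1/[1-r] * d                           ∎
        where
          y = r ^ suc n
          d = fromℚ (1/suc n)
          k = fromℚ (natℚ (suc n))
          0≤gd : 0ℝ ≤ 1/[1-r] * d
          0≤gd = *-nonneg 0≤1/[1-r] (<⇒≤ (fromℚ-pos (1/suc-pos n)))

  c*r^⟶0 : ∀ c → (λ n → c * r ^ n) ⟶ 0ℝ
  c*r^⟶0 c = ⟶-cong (λ _ → ≈-refl) (R.zeroʳ c) (⟶-scale c r^⟶0)

  c*r^-eventually≤ : ∀ c {ε} → 0ℝ < ε → ∃[ N ] ∀ n → N ℕ.≤ n → c * r ^ n ≤ ε
  c*r^-eventually≤ c {ε} 0<ε = let (N , h) = c*r^⟶0 c ε 0<ε in
    N , λ n p → ≤-respˡ (solve 1 (λ x → x :- con 0ℚ := x) ≈-refl _) (∣x∣≤y⇒x≤y (<⇒≤ (h n p)))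

  geometric : ∑∞ (λ n → r ^ n) ≈ 1/[1-r]
  geometric = ⟶-cong partial (solve 1 (λ g → g :- con 0ℚ := g) ≈-refl _)
    (⟶-+ (⟶-const 1/[1-r]) (⟶-neg (c*r^⟶0 1/[1-r])))
    where
      open ≈-Reasoning
      telescoped : ∀ n → (1ℝ - r) * ∑< n (λ k → r ^ k) ≈ 1ℝ - r ^ n
      telescoped zero = solve 1 (λ r → (con 1ℚ :- r) :* con 0ℚ := con 1ℚ :- con 1ℚ) ≈-refl r
      telescoped (suc n) = ≈-trans (R.distribˡ _ _ _) (≈-trans (R.+-congʳ (telescoped n))
        (solve 2 (λ r y → (con 1ℚ :- y) :+ (con 1ℚ :- r) :* y := con 1ℚ :- r :* y) ≈-refl r (r ^ n)))

      partial : ∀ n → 1/[1-r] - 1/[1-r] * r ^ n ≈ ∑< n (λ k → r ^ k)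
      partial n = begin
        1/[1-r] - 1/[1-r] * r ^ n     ≈⟨ solve 2 (λ g y → g :- g :* y := g :* (con 1ℚ :- y)) ≈-refl _ _ ⟩
        1/[1-r] * (1ℝ - r ^ n)        ≈⟨ R.*-congˡ (≈-sym (telescoped n)) ⟩
        1/[1-r] * ((1ℝ - r) * s)      ≈⟨ solve 3 (λ g r s → g :* ((con 1ℚ :- r) :* s) := (con 1ℚ :- r) :* (g :* s)) ≈-refl 1/[1-r] r s ⟩
        (1ℝ - r) * (1/[1-r] * s)      ≈⟨ 1/-cancel 0<1-r s ⟩
        s                             ∎
        where s = ∑< n (λ k → r ^ k)

  -- Beyond convergence, the explicit `tail≤` is what later gives the fixed point of the square
  -- root, the positivity of `W` and the exchange of summations.
  module Comparison {f : ℕ → ℝ} {B : ℝ} (0≤B : 0ℝ ≤ B) (∣f∣≤ : ∀ n → ∣ f n ∣ ≤ B * r ^ n) where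
    open ≤-Reasoning

    private
      G : ℝ
      G = B * 1/[1-r]

      0≤G : 0ℝ ≤ G
      0≤G = *-nonneg 0≤B 0≤1/[1-r]

      -- The majorant telescopes: B rᵐ = G (rᵐ - rᵐ⁺¹) with G = B/(1 - r).
      increments : ∀ N k → ∣ ∑< (k ℕ.+ N) f - ∑< N f ∣ ≤ G * (r ^ N - r ^ (k ℕ.+ N))
      increments N zero = ≤-trans
        (≤-reflexive (≈-trans (∣∣-cong (R.-‿inverseʳ _)) (0≤x⇒∣x∣≈x ≤-refl)))
        (≤-reflexive (solve 2 (λ g y → con 0ℚ := g :* (y :- y)) ≈-refl G (r ^ N)))
      increments N (suc k) = begin
        ∣ (s + f m) - s₀ ∣                ≈⟨ ∣∣-cong (solve 3 (λ s f s₀ → (s :+ f) :- s₀ := (s :- s₀) :+ f) ≈-refl s (f m) s₀) ⟩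
        ∣ (s - s₀) + f m ∣                ≤⟨ ∣x+y∣≤∣x∣+∣y∣ _ _ ⟩
        ∣ s - s₀ ∣ + ∣ f m ∣              ≤⟨ +-mono-≤ (increments N k) (∣f∣≤ m) ⟩
        G * (x - y) + B * y               ≈⟨ R.+-congˡ (R.*-congʳ (≈-sym (≈-trans (R.*-congˡ (*-inverseʳ 0<1-r)) (R.*-identityʳ B)))) ⟩
        G * (x - y) + B * ((1ℝ - r) * 1/[1-r]) * y
          ≈⟨ solve 5 (λ B g r x y → (B :* g) :* (x :- y) :+ B :* ((con 1ℚ :- r) :* g) :* y := (B :* g) :* (x :- r :* y))
               ≈-refl B 1/[1-r] r x y ⟩
        G * (x - r * y)                   ∎
        where
          m = k ℕ.+ N
          s = ∑< m f
          s₀ = ∑< N f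
          x = r ^ N
          y = r ^ m

      drift : ∀ N k → ∣ ∑< (k ℕ.+ N) f - ∑< N f ∣ ≤ G * r ^ N
      drift N k = ≤-trans (increments N k) (*-monoʳ-≤ 0≤G (≤-respʳ (solve 1 (λ x → x :- con 0ℚ := x) ≈-refl _)
        (+-mono-≤ ≤-refl (neg-mono-≤ (^-nonneg 0≤r (k ℕ.+ N))))))

      drift′ : ∀ {N m} → N ℕ.≤ m → ∣ ∑< m f - ∑< N f ∣ ≤ G * r ^ N
      drift′ {N} {m} N≤m = subst (λ m → ∣ ∑< m f - ∑< N f ∣ ≤ G * r ^ N) (ℕ.m∸n+n≡m N≤m) (drift N (m ℕ.∸ N))

      converges : ∃[ S ] ∑∞ f ≈ S
      converges = complete λ ε 0<ε →
        let (N , h) = c*r^-eventually≤ (G + G) (fromℚ-pos 0<ε) in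
        N , λ m n N≤m N≤n → begin
          ∣ ∑< m f - ∑< n f ∣                            ≤⟨ triangle _ (∑< N f) _ ⟩
          ∣ ∑< m f - ∑< N f ∣ + ∣ ∑< N f - ∑< n f ∣      ≤⟨ +-mono-≤ (drift′ N≤m) (≤-respˡ (∣x-y∣≈∣y-x∣ _ _) (drift′ N≤n)) ⟩
          G * r ^ N + G * r ^ N                          ≈⟨ ≈-sym (R.distribʳ _ _ _) ⟩
          (G + G) * r ^ N                                ≤⟨ h N ℕ.≤-refl ⟩
          fromℚ ε                                        ∎

    opaque

      total : ℝ
      total = proj₁ converges

      ∑∞f≈total : ∑∞ f ≈ total
      ∑∞f≈total = proj₂ converges

    tail≤ : ∀ N → ∣ total - ∑< N f ∣ ≤ B * 1/[1-r] * r ^ N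
    tail≤ N = ⟶-∣∣≤ (drift N) (⟶-+ (⟶-drop N ∑∞f≈total) (⟶-const (- ∑< N f)))

  -- Induction on M by shifting f. A bound B rⁿ for the shifted sequence reads (B/r) rⁿ⁺¹ for f, and
  -- ∣f 0∣ covers the first term; the sum of the two constants stands in for their maximum.
  ratio-bound : ∀ {f} M → (∀ n → M ℕ.≤ n → ∣ f (suc n) ∣ ≤ r * ∣ f n ∣) →
                ∃[ B ] 0ℝ ≤ B × ∀ n → ∣ f n ∣ ≤ B * r ^ n
  ratio-bound {f} zero h = ∣ f 0 ∣ , 0≤∣x∣ _ , bound
    where
      open ≤-Reasoning
      bound : ∀ n → ∣ f n ∣ ≤ ∣ f 0 ∣ * r ^ n
      bound zero    = ≤-reflexive (≈-sym (R.*-identityʳ _))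
      bound (suc n) = begin
        ∣ f (suc n) ∣              ≤⟨ h n ℕ.z≤n ⟩
        r * ∣ f n ∣                ≤⟨ *-monoʳ-≤ 0≤r (bound n) ⟩
        r * (∣ f 0 ∣ * r ^ n)      ≈⟨ solve 3 (λ r a b → r :* (a :* b) := a :* (r :* b)) ≈-refl _ _ _ ⟩
        ∣ f 0 ∣ * (r * r ^ n)      ∎
  ratio-bound {f} (suc M) h =
    let (B , 0≤B , b) = ratio-bound {λ n → f (suc n)} M λ n p → h (suc n) (ℕ.s≤s p)
        r⁻¹ = 1/ r ⟨ 0<r ⟩
        0≤B/r = *-nonneg (<⇒≤ (1/-pos 0<r)) 0≤B
    in ∣ f 0 ∣ + r⁻¹ * B , ≤-respˡ (R.+-identityˡ 0ℝ) (+-mono-≤ (0≤∣x∣ _) 0≤B/r) , λ where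
      zero → begin
        ∣ f 0 ∣                         ≈⟨ solve 1 (λ x → x := x :+ con 0ℚ) ≈-refl _ ⟩
        ∣ f 0 ∣ + 0ℝ                    ≤⟨ +-mono-≤ ≤-refl 0≤B/r ⟩
        ∣ f 0 ∣ + r⁻¹ * B               ≈⟨ ≈-sym (R.*-identityʳ _) ⟩
        (∣ f 0 ∣ + r⁻¹ * B) * 1ℝ        ∎
      (suc n) → begin
        ∣ f (suc n) ∣                               ≤⟨ b n ⟩
        B * r ^ n                                   ≈⟨ R.+-identityˡ _ ⟨
        0ℝ + B * r ^ n                              ≤⟨ +-mono-≤ (*-nonneg (0≤∣x∣ (f 0)) (^-nonneg 0≤r (suc n)))
                                                        (≤-reflexive (≈-sym (≈-trans (R.*-congˡ (1/-cancel 0<r B)) (R.*-comm _ _)))) ⟩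
        ∣ f 0 ∣ * (r * r ^ n) + r ^ n * (r * (r⁻¹ * B))
          ≈⟨ solve 4 (λ a r y c → a :* (r :* y) :+ y :* (r :* c) := (a :+ c) :* (r :* y)) ≈-refl ∣ f 0 ∣ r (r ^ n) (r⁻¹ * B) ⟩
        (∣ f 0 ∣ + r⁻¹ * B) * (r * r ^ n)           ∎
    where open ≤-Reasoning

-- Square roots and q-numbers

*-mono-nonneg : ∀ {x y u v} → 0ℝ ≤ x → 0ℝ ≤ y → x ≤ u → y ≤ v → x * y ≤ u * v
*-mono-nonneg 0≤x 0≤y p r = *-mono-≤ 0≤x (≤-trans 0≤y r) p r

-- √(1 - q) = 1 - z, where z ≤ q is the fixed point of the contraction z ↦ ½ (q + z²).
module SquareRoot {q : ℝ} (0<q : 0ℝ < q) (q<1 : q < 1ℝ) where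
  open Geometric 0<q q<1

  private
    h : ℝ
    h = fromℚ ½

    0≤h : 0ℝ ≤ h
    0≤h = <⇒≤ (fromℚ-pos (ℚ.positive⁻¹ ½))

    z : ℕ → ℝ
    z zero    = 0ℝ
    z (suc n) = h * (q + z n * z n)

    0≤z : ∀ n → 0ℝ ≤ z n
    0≤z zero    = ≤-refl
    0≤z (suc n) = *-nonneg 0≤h (≤-respˡ (R.+-identityˡ 0ℝ) (+-mono-≤ (<⇒≤ 0<q) (*-nonneg (0≤z n) (0≤z n))))

    average≤q : ∀ {x y} → x ≤ q → y ≤ q → h * (x + y) ≤ q
    average≤q x≤q y≤q = ≤-respʳ (solve 1 (λ q → con ½ :* (q :+ q) := q) ≈-refl q) (*-monoʳ-≤ 0≤h (+-mono-≤ x≤q y≤q))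

    z≤q : ∀ n → z n ≤ q
    z≤q zero    = <⇒≤ 0<q
    z≤q (suc n) = average≤q ≤-refl (≤-respʳ (R.*-identityˡ q)
      (*-mono-nonneg (0≤z n) (0≤z n) (≤-trans (z≤q n) (<⇒≤ q<1)) (z≤q n)))

    ∣½[x+y]∣≤q : ∀ {x y} → 0ℝ ≤ x → 0ℝ ≤ y → x ≤ q → y ≤ q → ∣ h * (x + y) ∣ ≤ q
    ∣½[x+y]∣≤q 0≤x 0≤y x≤q y≤q = ≤-respˡ
      (≈-sym (0≤x⇒∣x∣≈x (*-nonneg 0≤h (≤-respˡ (R.+-identityˡ 0ℝ) (+-mono-≤ 0≤x 0≤y)))))
      (average≤q x≤q y≤q)

    d : ℕ → ℝ
    d n = z (suc n) - z n

    -- The difference factors as ½(x + y)(x - y), and both iterates lie between 0 and q.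
    ∣d∣-suc : ∀ n → 0 ℕ.≤ n → ∣ d (suc n) ∣ ≤ q * ∣ d n ∣
    ∣d∣-suc n _ = begin
      ∣ h * (q + x * x) - h * (q + y * y) ∣
        ≈⟨ ∣∣-cong (solve 4 (λ h q x y → h :* (q :+ x :* x) :- h :* (q :+ y :* y) := h :* (x :+ y) :* (x :- y)) ≈-refl h q x y) ⟩
      ∣ h * (x + y) * (x - y) ∣       ≈⟨ ∣x*y∣≈∣x∣*∣y∣ _ _ ⟩
      ∣ h * (x + y) ∣ * ∣ x - y ∣     ≤⟨ *-mono-nonneg (0≤∣x∣ _) (0≤∣x∣ _)
                                          (∣½[x+y]∣≤q (0≤z (suc n)) (0≤z n) (z≤q (suc n)) (z≤q n)) ≤-refl ⟩
      q * ∣ x - y ∣                   ∎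
      where
        open ≤-Reasoning
        x = z (suc n)
        y = z n

    module Bound where
      B = proj₁ (ratio-bound {d} 0 ∣d∣-suc)
      open Comparison {d} (proj₁ (proj₂ (ratio-bound {d} 0 ∣d∣-suc))) (proj₂ (proj₂ (ratio-bound {d} 0 ∣d∣-suc))) public

    Z : ℝ
    Z = Bound.total

    ∑d≈z : ∀ n → ∑< n d ≈ z n
    ∑d≈z zero    = ≈-refl
    ∑d≈z (suc n) = ≈-trans (R.+-congʳ (∑d≈z n))
      (solve 2 (λ x y → x :+ (y :- x) := y) ≈-refl (z n) (z (suc n)))

    z⟶Z : z ⟶ Z
    z⟶Z = ⟶-cong ∑d≈z ≈-refl Bound.∑∞f≈total

    Z≤q : Z ≤ q
    Z≤q = ⟶-≤ z≤q z⟶Z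

    -- The contraction estimate together with the tail bound shows that `z (suc n)` also tends to
    -- ½(q + Z²); uniqueness of limits concludes.
    Z-fixed : Z ≈ h * (q + Z * Z)
    Z-fixed = ⟶-unique (⟶-suc z⟶Z) (⟶-squeeze close-to (c*r^⟶0 (q * (Bound.B * 1/[1-r]))))
      where
        open ≤-Reasoning
        close-to : ∀ n → ∣ z (suc n) - h * (q + Z * Z) ∣ ≤ q * (Bound.B * 1/[1-r]) * q ^ n
        close-to n = begin
          ∣ h * (q + x * x) - h * (q + Z * Z) ∣
            ≈⟨ ∣∣-cong (solve 4 (λ h q x y → h :* (q :+ x :* x) :- h :* (q :+ y :* y) := h :* (x :+ y) :* (x :- y)) ≈-refl h q x Z) ⟩
          ∣ h * (x + Z) * (x - Z) ∣       ≈⟨ ∣x*y∣≈∣x∣*∣y∣ _ _ ⟩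
          ∣ h * (x + Z) ∣ * ∣ x - Z ∣     ≤⟨ *-mono-nonneg (0≤∣x∣ _) (0≤∣x∣ _)
                                              (∣½[x+y]∣≤q (0≤z n) (⟶-≥ 0≤z z⟶Z) (z≤q n) Z≤q)
                                              (≤-respˡ (≈-trans (∣∣-cong (R.+-congˡ (R.-‿cong (∑d≈z n)))) (∣x-y∣≈∣y-x∣ _ _))
                                                (Bound.tail≤ n)) ⟩
          q * (Bound.B * 1/[1-r] * q ^ n) ≈⟨ ≈-sym (R.*-assoc _ _ _) ⟩
          q * (Bound.B * 1/[1-r]) * q ^ n ∎
          where x = z n

  opaque

    √ : ℝ
    √ = 1ℝ - Z

    0<√ : 0ℝ < √
    0<√ = <-≤-trans (<⇒0<- q<1) (+-mono-≤ ≤-refl (neg-mono-≤ Z≤q))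

    √*√ : √ * √ ≈ 1ℝ - q
    √*√ = begin
      (1ℝ - Z) * (1ℝ - Z)
        ≈⟨ solve 1 (λ z → (con 1ℚ :- z) :* (con 1ℚ :- z) := con 1ℚ :- (z :+ z) :+ z :* z) ≈-refl Z ⟩
      1ℝ - (Z + Z) + Z * Z
        ≈⟨ R.+-congʳ (R.+-congˡ (R.-‿cong (R.+-cong Z-fixed Z-fixed))) ⟩
      1ℝ - (h * (q + Z * Z) + h * (q + Z * Z)) + Z * Z
        ≈⟨ solve 2 (λ q z → con 1ℚ :- (con ½ :* (q :+ z :* z) :+ con ½ :* (q :+ z :* z)) :+ z :* z := con 1ℚ :- q) ≈-refl q Z ⟩
      1ℝ - q ∎
      where open ≈-Reasoning

1/-unique : ∀ {x} (0<x : 0ℝ < x) {y} → x * y ≈ 1ℝ → y ≈ 1/ x ⟨ 0<x ⟩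
1/-unique {x} 0<x {y} e = begin
  y                             ≈⟨ 1/-cancel 0<x y ⟨
  x * (1/ x ⟨ 0<x ⟩ * y)        ≈⟨ solve 3 (λ x i y → x :* (i :* y) := i :* (x :* y)) ≈-refl x _ y ⟩
  1/ x ⟨ 0<x ⟩ * (x * y)        ≈⟨ R.*-congˡ e ⟩
  1/ x ⟨ 0<x ⟩ * 1ℝ             ≈⟨ R.*-identityʳ _ ⟩
  1/ x ⟨ 0<x ⟩                  ∎
  where open ≈-Reasoning

module q-Numbers (q : ℝ) (0<q : 0ℝ < q) (q<1 : q < 1ℝ) where
  open q-Calculus q 0<q q<1

  [1-q]*[m] : ∀ m → (1ℝ - q) * [ m ] ≈ 1ℝ - q^ m
  [1-q]*[m] m = ≈-trans (R.*-congˡ (R.*-comm _ _)) (1/-cancel 0<1-q _)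

  -- Lets `term-bound` drop the factor [m + 1] from the ratio of consecutive terms.
  1≤[suc_] : ∀ m → 1ℝ ≤ [ + suc m ]
  1≤[suc m ] = ≤-respˡ (*-inverseʳ 0<1-q) (*-mono-≤ (<⇒≤ 0<1-q) (<⇒≤ (1/-pos 0<1-q))
    (+-mono-≤ ≤-refl (neg-mono-≤ (≤-respʳ (R.*-identityʳ q)
      (*-monoʳ-≤ (<⇒≤ 0<q) (Geometric.r^≤1 0<q q<1 m))))) ≤-refl)

-- The q-exponential

suc-C-2 : ∀ m → suc m C 2 ≡ m ℕ.+ m C 2
suc-C-2 m = trans (sym (nCk+nC[k+1]≡[n+1]C[k+1] m 1)) (cong (ℕ._+ m C 2) (nC1≡n m))

-- With X₀ = - p / (1 - p), the value E_p(pᵏ X₀) is (p^{k+1}; p)_∞.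
module q-Exponential (p : ℝ) (0<p : 0ℝ < p) (p<1 : p < 1ℝ) where
  open q-Calculus p 0<p p<1
  open q-Numbers p 0<p p<1
  open Geometric 0<p p<1

  term : ℝ → ℕ → ℝ
  term X m = p ^ (m C 2) * X ^ m / [ m ]! ⟨ [ m ]!-pos ⟩

  term-suc : ∀ X m → [ + suc m ] * term X (suc m) ≈ p ^ m * X * term X m
  term-suc X m = begin
    k * (p ^ (suc m C 2) * (X * X ^ m) * A)
      ≈⟨ R.*-congˡ (R.*-congʳ (R.*-congʳ (≈-trans (R.reflexive (cong (p ^_) (suc-C-2 m))) (^-homo-* p m (m C 2))))) ⟩
    k * (p ^ m * p ^ (m C 2) * (X * X ^ m) * A)
      ≈⟨ solve 6 (λ k a b x y A → k :* (a :* b :* (x :* y) :* A) := (a :* x) :* (b :* y :* (k :* A))) ≈-refl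
           k (p ^ m) (p ^ (m C 2)) X (X ^ m) A ⟩
    (p ^ m * X) * (p ^ (m C 2) * X ^ m * (k * A))
      ≈⟨ R.*-congˡ (R.*-congˡ (1/-unique [ m ]!-pos (≈-trans (≈-sym (R.*-assoc _ _ _)) (*-inverseʳ [ suc m ]!-pos)))) ⟩
    (p ^ m * X) * term X m ∎
    where
      open ≈-Reasoning
      k = [ + suc m ]
      A = 1/ [ suc m ]! ⟨ [ suc m ]!-pos ⟩

  term-zero : ∀ X → term X 0 ≈ 1ℝ
  term-zero X = ≈-trans (R.*-congʳ (R.*-identityˡ 1ℝ)) (*-inverseʳ [ 0 ]!-pos)

  term-scale : ∀ c X m → term (c * X) m ≈ c ^ m * term X m
  term-scale c X m = ≈-trans (R.*-congʳ (R.*-congˡ (^-distrib-* c X m)))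
    (solve 4 (λ a c x d → a :* (c :* x) :* d := c :* (a :* x :* d)) ≈-refl (p ^ (m C 2)) (c ^ m) (X ^ m) _)

  -- Consecutive terms have ratio pᵐ X/[m + 1] with [m + 1] ≥ 1, so the ratio is at most p as soon
  -- as pᵐ ∣X∣ ≤ p. Hence the series converges for every X.
  term-bound : ∀ X → ∃[ B ] 0ℝ ≤ B × ∀ m → ∣ term X m ∣ ≤ B * p ^ m
  term-bound X =
    let (M , h) = c*r^-eventually≤ ∣ X ∣ 0<p in
    ratio-bound {term X} M λ m M≤m → begin
      ∣ term X (suc m) ∣                    ≈⟨ R.*-identityˡ _ ⟨
      1ℝ * ∣ term X (suc m) ∣               ≤⟨ *-mono-≤ (<⇒≤ 0<1) (0≤∣x∣ _) (≤-trans (1≤[suc m ]) (x≤∣x∣ _)) ≤-refl ⟩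
      ∣ [ + suc m ] ∣ * ∣ term X (suc m) ∣  ≈⟨ ∣x*y∣≈∣x∣*∣y∣ _ _ ⟨
      ∣ [ + suc m ] * term X (suc m) ∣      ≈⟨ ∣∣-cong (term-suc X m) ⟩
      ∣ p ^ m * X * term X m ∣              ≈⟨ ≈-trans (∣x*y∣≈∣x∣*∣y∣ _ _) (R.*-congʳ (∣x*y∣≈∣x∣*∣y∣ _ _)) ⟩
      ∣ p ^ m ∣ * ∣ X ∣ * ∣ term X m ∣      ≈⟨ R.*-congʳ (≈-trans (R.*-comm _ _) (R.*-congˡ (0≤x⇒∣x∣≈x (^-nonneg (<⇒≤ 0<p) m)))) ⟩
      ∣ X ∣ * p ^ m * ∣ term X m ∣          ≤⟨ *-mono-nonneg (*-nonneg (0≤∣x∣ X) (^-nonneg (<⇒≤ 0<p) m)) (0≤∣x∣ _) (h m M≤m) ≤-refl ⟩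
      p * ∣ term X m ∣                      ∎
    where open ≤-Reasoning

  private
    module Sum (X : ℝ) = Comparison {term X} (proj₁ (proj₂ (term-bound X))) (proj₂ (proj₂ (term-bound X)))

  opaque

    E : ℝ → ℝ
    E = Sum.total

    E-series : ∀ X → E[ X ]≈ E X
    E-series = Sum.∑∞f≈total

  -- The sum is built from a bound found for the given X, so invariance has to come from uniqueness
  -- of limits.
  E-cong : ∀ {X Y} → X ≈ Y → E X ≈ E Y
  E-cong {X} {Y} e = ⟶-unique (E-series X)
    (∑∞-cong (λ m → R.*-congʳ (R.*-congˡ (^-congˡ m (≈-sym e)))) ≈-refl (E-series Y))

  -- The p-difference equation of the exponential, obtained termwise: (1 - pᵐ⁺¹) times term m + 1 at
  -- X equals (1 - p) X times term m at pX.
  E-functional : ∀ X → E X ≈ (1ℝ + (1ℝ - p) * X) * E (p * X)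
  E-functional X = begin
    E X                                       ≈⟨ solve 2 (λ a b → a := (a :- b :- con 0ℚ) :+ b) ≈-refl (E X) (E (p * X)) ⟩
    (E X - E (p * X) - 0ℝ) + E (p * X)        ≈⟨ R.+-congʳ (⟶-unique differences (∑∞-scale ((1ℝ - p) * X) (E-series (p * X)))) ⟩
    (1ℝ - p) * X * E (p * X) + E (p * X)      ≈⟨ solve 2 (λ a e → a :* e :+ e := (con 1ℚ :+ a) :* e) ≈-refl ((1ℝ - p) * X) _ ⟩
    (1ℝ + (1ℝ - p) * X) * E (p * X)           ∎
    where
      open ≈-Reasoning

      d : ℕ → ℝ
      d m = term X m + (- 1ℝ) * term (p * X) m

      d-zero : d 0 ≈ 0ℝ
      d-zero = ≈-trans (R.+-cong (term-zero X) (R.*-congˡ (term-zero (p * X)))) (solve 0 (con 1ℚ :+ (:- con 1ℚ) :* con 1ℚ := con 0ℚ) ≈-refl)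

      d-suc : ∀ m → d (suc m) ≈ (1ℝ - p) * X * term (p * X) m
      d-suc m = begin
        t + (- 1ℝ) * term (p * X) (suc m)             ≈⟨ R.+-congˡ (R.*-congˡ (term-scale p X (suc m))) ⟩
        t + (- 1ℝ) * (p ^ suc m * t)                  ≈⟨ solve 2 (λ t a → t :+ (:- con 1ℚ) :* (a :* t) := (con 1ℚ :- a) :* t) ≈-refl t (p ^ suc m) ⟩
        (1ℝ - p ^ suc m) * t                          ≈⟨ R.*-congʳ ([1-q]*[m] (+ suc m)) ⟨
        (1ℝ - p) * [ + suc m ] * t                    ≈⟨ R.*-assoc _ _ _ ⟩
        (1ℝ - p) * ([ + suc m ] * t)                  ≈⟨ R.*-congˡ (term-suc X m) ⟩
        (1ℝ - p) * (p ^ m * X * term X m)             ≈⟨ solve 4 (λ p a x t → (con 1ℚ :- p) :* (a :* x :* t) := (con 1ℚ :- p) :* x :* (a :* t)) ≈-refl p (p ^ m) X (term X m) ⟩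
        (1ℝ - p) * X * (p ^ m * term X m)             ≈⟨ R.*-congˡ (term-scale p X m) ⟨
        (1ℝ - p) * X * term (p * X) m                 ∎
        where t = term X (suc m)

      differences : ∑∞ (λ m → (1ℝ - p) * X * term (p * X) m) ≈ (E X - E (p * X) - 0ℝ)
      differences = ∑∞-cong d-suc
        (R.+-cong (R.+-congˡ (solve 1 (λ e → (:- con 1ℚ) :* e := :- e) ≈-refl _)) (R.-‿cong d-zero))
        (∑∞-suc (∑∞-+ (E-series X) (∑∞-scale (- 1ℝ) (E-series (p * X)))))

  0<1-p : 0ℝ < 1ℝ - p
  0<1-p = <⇒0<- p<1

  -- For p = q² this is the argument - q²x²/[2]_q of the weight at x = ± ν.
  X₀ : ℝ
  X₀ = - (p / (1ℝ - p) ⟨ 0<1-p ⟩)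

  [1-p]*X₀ : (1ℝ - p) * X₀ ≈ - p
  [1-p]*X₀ = ≈-trans (solve 3 (λ p i d → d :* (:- (p :* i)) := :- (d :* (i :* p))) ≈-refl p _ _) (R.-‿cong (1/-cancel 0<1-p p))

  -- The coefficients (-1)ᵐ p^(m(m+1)/2) / ((1 - p)⋯(1 - pᵐ)) of Euler's expansion of (pz; p)_∞ in
  -- powers of z.
  t : ℕ → ℝ
  t = term X₀

  t-suc : ∀ m → (1ℝ - p ^ suc m) * t (suc m) ≈ - (p ^ suc m * t m)
  t-suc m = begin
    (1ℝ - p ^ suc m) * t (suc m)              ≈⟨ R.*-congʳ ([1-q]*[m] (+ suc m)) ⟨
    (1ℝ - p) * [ + suc m ] * t (suc m)        ≈⟨ R.*-assoc _ _ _ ⟩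
    (1ℝ - p) * ([ + suc m ] * t (suc m))      ≈⟨ R.*-congˡ (term-suc X₀ m) ⟩
    (1ℝ - p) * (p ^ m * X₀ * t m)             ≈⟨ solve 4 (λ d a x t → d :* (a :* x :* t) := d :* x :* (a :* t)) ≈-refl _ _ _ _ ⟩
    (1ℝ - p) * X₀ * (p ^ m * t m)             ≈⟨ R.*-congʳ [1-p]*X₀ ⟩
    - p * (p ^ m * t m)                       ≈⟨ solve 3 (λ p a t → :- p :* (a :* t) := :- (p :* a :* t)) ≈-refl _ _ _ ⟩
    - (p ^ suc m * t m)                       ∎
    where open ≈-Reasoning

  W : ℕ → ℝ
  W k = E (p ^ k * X₀)

  W-suc : ∀ k → W k ≈ (1ℝ - p ^ suc k) * W (suc k)
  W-suc k = begin
    E (p ^ k * X₀)                                            ≈⟨ E-functional (p ^ k * X₀) ⟩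
    (1ℝ + (1ℝ - p) * (p ^ k * X₀)) * E (p * (p ^ k * X₀))     ≈⟨ R.*-cong (R.+-congˡ factor) (E-cong (≈-sym (R.*-assoc p (p ^ k) X₀))) ⟩
    (1ℝ - p ^ suc k) * W (suc k)                              ∎
    where
      open ≈-Reasoning
      factor : (1ℝ - p) * (p ^ k * X₀) ≈ - (p * p ^ k)
      factor = begin
        (1ℝ - p) * (p ^ k * X₀)   ≈⟨ solve 3 (λ d a x → d :* (a :* x) := (d :* x) :* a) ≈-refl (1ℝ - p) (p ^ k) X₀ ⟩
        (1ℝ - p) * X₀ * p ^ k     ≈⟨ R.*-congʳ [1-p]*X₀ ⟩
        - p * p ^ k               ≈⟨ solve 2 (λ p a → :- p :* a := :- (p :* a)) ≈-refl p (p ^ k) ⟩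
        - (p * p ^ k)             ∎

  private
    opaque

      B : ℝ
      B = proj₁ (term-bound X₀)

      0≤B : 0ℝ ≤ B
      0≤B = proj₁ (proj₂ (term-bound X₀))

      ∣t∣≤ : ∀ m → ∣ t m ∣ ≤ B * p ^ m
      ∣t∣≤ = proj₂ (proj₂ (term-bound X₀))

    term-lattice-bound : ∀ k m → ∣ term (p ^ k * X₀) m ∣ ≤ (p ^ k) ^ m * (B * p ^ m)
    term-lattice-bound k m = begin
      ∣ term (p ^ k * X₀) m ∣       ≈⟨ ≈-trans (∣∣-cong (term-scale (p ^ k) X₀ m)) (∣x*y∣≈∣x∣*∣y∣ _ _) ⟩
      ∣ (p ^ k) ^ m ∣ * ∣ t m ∣     ≈⟨ R.*-congʳ (0≤x⇒∣x∣≈x 0≤pkm) ⟩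
      (p ^ k) ^ m * ∣ t m ∣         ≤⟨ *-monoʳ-≤ 0≤pkm (∣t∣≤ m) ⟩
      (p ^ k) ^ m * (B * p ^ m)     ∎
      where
        open ≤-Reasoning
        0≤pkm : 0ℝ ≤ (p ^ k) ^ m
        0≤pkm = ^-nonneg (^-nonneg (<⇒≤ 0<p) k) m

    p^k^m≤1 : ∀ k m → (p ^ k) ^ m ≤ 1ℝ
    p^k^m≤1 k = ^≤1 (^-nonneg (<⇒≤ 0<p) k) (r^≤1 k)

    0≤Bp^ : ∀ m → 0ℝ ≤ B * p ^ m
    0≤Bp^ m = *-nonneg 0≤B (^-nonneg (<⇒≤ 0<p) m)

  W-bound : ℝ
  W-bound = B * 1/[1-r]

  0≤W-bound : 0ℝ ≤ W-bound
  0≤W-bound = *-nonneg 0≤B 0≤1/[1-r]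

  -- The bound is uniform in k because (pᵏ)ᵐ ≤ 1. This uniformity is what justifies exchanging the
  -- sums over k and m.
  W-partial : ∀ k M → ∣ W k - ∑< M (λ m → (p ^ k) ^ m * t m) ∣ ≤ W-bound * p ^ M
  W-partial k M = ≤-respˡ
    -- `C` uses the one bound `B` for all k, whereas `E` was summed with a bound of its own;
    -- uniqueness of limits identifies the two sums.
    (∣∣-cong (R.+-cong (⟶-unique C.∑∞f≈total (E-series _)) (R.-‿cong (∑<-cong (term-scale (p ^ k) X₀) M))))
    (C.tail≤ M)
    where
      f-bound : ∀ m → ∣ term (p ^ k * X₀) m ∣ ≤ B * p ^ m
      f-bound m = ≤-trans (term-lattice-bound k m)
        (≤-respʳ (R.*-identityˡ _) (*-mono-≤ (^-nonneg (^-nonneg (<⇒≤ 0<p) k) m) (0≤Bp^ m) (p^k^m≤1 k m) ≤-refl))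
      module C = Comparison {term (p ^ k * X₀)} 0≤B f-bound

  ∣W∣≤ : ∀ k → ∣ W k ∣ ≤ W-bound
  ∣W∣≤ k = ≤-respˡ (∣∣-cong (solve 1 (λ w → w :- con 0ℚ := w) ≈-refl _))
    (≤-respʳ (R.*-identityʳ _) (W-partial k 0))

  private
    -- Every term after the zeroth contains a factor pᵏ.
    ∣W-1∣≤ : ∀ k → ∣ W k - 1ℝ ∣ ≤ W-bound * p ^ k
    ∣W-1∣≤ k = begin
      ∣ W k - 1ℝ ∣                    ≈⟨ ∣∣-cong (R.+-congˡ (R.-‿cong (≈-sym (term-zero (p ^ k * X₀))))) ⟩
      ∣ W k - f 0 ∣                   ≈⟨ ∣∣-cong (⟶-unique (∑∞-suc (E-series _)) C.∑∞f≈total) ⟩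
      ∣ C.total ∣                     ≈⟨ ∣∣-cong (solve 1 (λ w → w := w :- con 0ℚ) ≈-refl _) ⟩
      ∣ C.total - 0ℝ ∣                ≤⟨ C.tail≤ 0 ⟩
      p ^ k * B * 1/[1-r] * 1ℝ        ≈⟨ solve 3 (λ a b g → a :* b :* g :* con 1ℚ := b :* g :* a) ≈-refl _ _ _ ⟩
      W-bound * p ^ k                 ∎
      where
        open ≤-Reasoning
        f = term (p ^ k * X₀)
        0≤p^ : ∀ n → 0ℝ ≤ p ^ n
        0≤p^ = ^-nonneg (<⇒≤ 0<p)
        f-suc-bound : ∀ m → ∣ f (suc m) ∣ ≤ p ^ k * B * p ^ m
        f-suc-bound m = begin
          ∣ f (suc m) ∣                                  ≤⟨ term-lattice-bound k (suc m) ⟩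
          p ^ k * (p ^ k) ^ m * (B * (p * p ^ m))        ≈⟨ solve 5 (λ a c b p d → a :* c :* (b :* (p :* d)) := (c :* p) :* (a :* b :* d)) ≈-refl _ _ _ _ _ ⟩
          ((p ^ k) ^ m * p) * (p ^ k * B * p ^ m)        ≤⟨ *-mono-≤ (*-nonneg (^-nonneg (0≤p^ k) m) (<⇒≤ 0<p)) (*-nonneg (*-nonneg (0≤p^ k) 0≤B) (0≤p^ m))
                                                             (≤-respʳ (R.*-identityˡ 1ℝ) (*-mono-nonneg (^-nonneg (0≤p^ k) m) (<⇒≤ 0<p) (p^k^m≤1 k m) (<⇒≤ p<1))) ≤-refl ⟩
          1ℝ * (p ^ k * B * p ^ m)                       ≈⟨ R.*-identityˡ _ ⟩
          p ^ k * B * p ^ m                              ∎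
        f-suc : ℕ → ℝ
        f-suc m = f (suc m)
        module C = Comparison {f-suc} (*-nonneg (0≤p^ k) 0≤B) f-suc-bound

    -- Positivity starts far out, where W is at least ½. The relation `W-suc` carries it down to W 0
    -- by multiplication and from there up to every k by division.
    0<W-large : ∃[ K ] 0ℝ < W K
    0<W-large =
      let (K , h) = c*r^-eventually≤ W-bound {fromℚ ½} (fromℚ-pos (ℚ.positive⁻¹ ½)) in
      K , (begin-strict
        0ℝ                          <⟨ fromℚ-pos (ℚ.positive⁻¹ ½) ⟩
        fromℚ ½                     ≈⟨ solve 0 (con ½ := con 1ℚ :- con ½) ≈-refl ⟩
        1ℝ - fromℚ ½                ≤⟨ +-mono-≤ ≤-refl (neg-mono-≤ (∣x∣≤y⇒x≤y (≤-respˡ (∣x-y∣≈∣y-x∣ _ _)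
                                         (≤-trans (∣W-1∣≤ K) (h K ℕ.≤-refl))))) ⟩
        1ℝ - (1ℝ - W K)             ≈⟨ solve 1 (λ w → con 1ℚ :- (con 1ℚ :- w) := w) ≈-refl _ ⟩
        W K                         ∎)
      where open ≤-Reasoning

    0<W-zero : ∀ K → 0ℝ < W K → 0ℝ < W 0
    0<W-zero zero    h = h
    0<W-zero (suc K) h = 0<W-zero K (<-respʳ-≈ (≈-sym (W-suc K)) (*-pos (0<1-x^suc 0<p p<1 K) h))

  0<W : ∀ k → 0ℝ < W k
  0<W zero    = let (K , h) = 0<W-large in 0<W-zero K h
  0<W (suc k) = <-respʳ-≈ (≈-trans (R.*-congˡ (W-suc k)) (≈-trans
    (solve 3 (λ i d w → i :* (d :* w) := d :* (i :* w)) ≈-refl _ _ _) (1/-cancel 0<1-p^ (W (suc k)))))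
    (*-pos (1/-pos 0<1-p^) (0<W k))
    where
      0<1-p^ : 0ℝ < 1ℝ - p ^ suc k
      0<1-p^ = 0<1-x^suc 0<p p<1 k

-- Jackson sums of the weight

*-cancelˡ : ∀ {x y z} → 0ℝ < x → x * y ≈ x * z → y ≈ z
*-cancelˡ {x} {y} {z} 0<x e = begin
  y                         ≈⟨ 1/-cancel 0<x y ⟨
  x * (1/ x ⟨ 0<x ⟩ * y)    ≈⟨ solve 3 (λ x i y → x :* (i :* y) := i :* (x :* y)) ≈-refl x _ y ⟩
  1/ x ⟨ 0<x ⟩ * (x * y)    ≈⟨ R.*-congˡ e ⟩
  1/ x ⟨ 0<x ⟩ * (x * z)    ≈⟨ solve 3 (λ x i y → i :* (x :* y) := x :* (i :* y)) ≈-refl x _ z ⟩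
  x * (1/ x ⟨ 0<x ⟩ * z)    ≈⟨ 1/-cancel 0<x z ⟩
  z                         ∎
  where open ≈-Reasoning

0<1-x⇒x<1 : ∀ {x} → 0ℝ < 1ℝ - x → x < 1ℝ
0<1-x⇒x<1 {x} h = <-respʳ-≈ (solve 1 (λ x → con 1ℚ :- x :+ x := con 1ℚ) ≈-refl x) (0<x⇒y<y+x h)

[x*x]^n≈x^2n : ∀ x n → (x * x) ^ n ≈ x ^ (2 ℕ.* n)
[x*x]^n≈x^2n x zero    = ≈-refl
[x*x]^n≈x^2n x (suc n) = ≈-trans (≈-trans (R.*-congˡ ([x*x]^n≈x^2n x n)) (R.*-assoc x x _))
  (R.reflexive (cong (x ^_) (sym (ℕ.*-suc 2 n))))

module LatticeSums (q : ℝ) (0<q : 0ℝ < q) (q<1 : q < 1ℝ) where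
  open Gaussian q 0<q q<1
  open Geometric 0<q q<1

  p : ℝ
  p = q * q

  0<p : 0ℝ < p
  0<p = *-pos 0<q 0<q

  p<1 : p < 1ℝ
  p<1 = *-<1 0<q q<1 q<1 0<q

  open q-Exponential p 0<p p<1 using (W; W-suc; W-bound; 0≤W-bound; ∣W∣≤; 0<W; W-partial; t; t-suc; term-zero; X₀)

  -- The k-th term of the Jackson sum of xʲ w at an endpoint y = ± ν, with yʲ taken out so that both
  -- endpoints share the same sum.
  σ : ℕ → ℕ → ℝ
  σ j k = q ^ k * ((q ^ k) ^ j * W k)

  private
    0≤q^ : ∀ k → 0ℝ ≤ q ^ k
    0≤q^ = ^-nonneg (<⇒≤ 0<q)

    ∣q^*x∣≤ : ∀ k {x y} → ∣ x ∣ ≤ y → ∣ q ^ k * x ∣ ≤ y * q ^ k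
    ∣q^*x∣≤ k {x} {y} h = begin
      ∣ q ^ k * x ∣         ≈⟨ ∣x*y∣≈∣x∣*∣y∣ _ _ ⟩
      ∣ q ^ k ∣ * ∣ x ∣     ≈⟨ R.*-congʳ (0≤x⇒∣x∣≈x (0≤q^ k)) ⟩
      q ^ k * ∣ x ∣         ≤⟨ *-monoʳ-≤ (0≤q^ k) h ⟩
      q ^ k * y             ≈⟨ R.*-comm _ _ ⟩
      y * q ^ k             ∎
      where open ≤-Reasoning

    σ-bound : ∀ j k → ∣ σ j k ∣ ≤ W-bound * q ^ k
    σ-bound j k = ∣q^*x∣≤ k (begin
      ∣ (q ^ k) ^ j * W k ∣         ≈⟨ ∣x*y∣≈∣x∣*∣y∣ _ _ ⟩
      ∣ (q ^ k) ^ j ∣ * ∣ W k ∣     ≈⟨ R.*-congʳ (0≤x⇒∣x∣≈x (^-nonneg (0≤q^ k) j)) ⟩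
      (q ^ k) ^ j * ∣ W k ∣         ≤⟨ *-mono-nonneg (^-nonneg (0≤q^ k) j) (0≤∣x∣ _) (^≤1 (0≤q^ k) (r^≤1 k) j) (∣W∣≤ k) ⟩
      1ℝ * W-bound                  ≈⟨ R.*-identityˡ _ ⟩
      W-bound                       ∎)
      where open ≤-Reasoning

    module Σσ (j : ℕ) = Comparison {σ j} 0≤W-bound (σ-bound j)

  opaque

    S : ℕ → ℝ
    S = Σσ.total

    ∑σ≈S : ∀ j → ∑∞ (σ j) ≈ S j
    ∑σ≈S = Σσ.∑∞f≈total

  S-step : ∀ j → S (2 ℕ.+ j) ≈ (1ℝ - q ^ suc j) * S j
  S-step j = begin
    S (2 ℕ.+ j)                       ≈⟨ solve 2 (λ s t → t := s :- (s :- t)) ≈-refl (S j) (S (2 ℕ.+ j)) ⟩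
    S j - (S j - S (2 ℕ.+ j))         ≈⟨ R.+-congˡ (R.-‿cong (⟶-unique shifted (∑∞-scale (q ^ suc j) (∑σ≈S j)))) ⟩
    S j - q ^ suc j * S j             ≈⟨ solve 2 (λ s a → s :- a :* s := (con 1ℚ :- a) :* s) ≈-refl (S j) (q ^ suc j) ⟩
    (1ℝ - q ^ suc j) * S j            ∎
    where
      open ≈-Reasoning

      -- At x = qᵏ⁺¹ the difference contains 1 - x² = 1 - pᵏ⁺¹, exactly the factor that turns
      -- `W (suc k)` into `W k`.
      termwise : ∀ k → σ j (suc k) + (- 1ℝ) * σ (2 ℕ.+ j) (suc k) ≈ q ^ suc j * σ j k
      termwise k = begin
        (q * x) * (qx^j * w) + (- 1ℝ) * ((q * x) * (((q * x) * ((q * x) * qx^j)) * w))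
          ≈⟨ solve 4 (λ q x a w → (q :* x) :* (a :* w) :+ (:- con 1ℚ) :* ((q :* x) :* (((q :* x) :* ((q :* x) :* a)) :* w)) :=
               q :* x :* a :* ((con 1ℚ :- (q :* q) :* (x :* x)) :* w)) ≈-refl q x qx^j w ⟩
        q * x * qx^j * ((1ℝ - (q * q) * (x * x)) * w)
          ≈⟨ R.*-cong (R.*-congˡ (^-distrib-* q x j))
               (≈-trans (R.*-congʳ (R.+-congˡ (R.-‿cong (R.*-congˡ (≈-sym (^-distrib-* q q k)))))) (≈-sym (W-suc k))) ⟩
        q * x * (q ^ j * x ^ j) * W k
          ≈⟨ solve 5 (λ q x a b w → q :* x :* (a :* b) :* w := q :* a :* (x :* (b :* w))) ≈-refl q x (q ^ j) (x ^ j) (W k) ⟩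
        q ^ suc j * σ j k ∎
        where
          x = q ^ k
          w = W (suc k)
          qx^j = (q * x) ^ j

      shifted : ∑∞ (λ k → q ^ suc j * σ j k) ≈ (S j - S (2 ℕ.+ j))
      shifted = ∑∞-cong termwise (begin
        (S j - σ j 0) + (- 1ℝ) * (S (2 ℕ.+ j) - σ (2 ℕ.+ j) 0)
          -- Both series have the same term at k = 0, where the lattice factor is 1, so dropping it
          -- from each leaves no boundary term.
          ≈⟨ solve 4 (λ s t o w → s :- con 1ℚ :* (o :* w) :+ (:- con 1ℚ) :* (t :- con 1ℚ :* ((con 1ℚ :* (con 1ℚ :* o)) :* w)) := s :- t)
               ≈-refl (S j) (S (2 ℕ.+ j)) (1ℝ ^ j) (W 0) ⟩
        S j - S (2 ℕ.+ j) ∎)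
        (∑∞-+ (∑∞-suc (∑σ≈S j)) (∑∞-scale (- 1ℝ) (∑∞-suc (∑σ≈S (2 ℕ.+ j)))))

  -- All terms are nonnegative, so the sum is at least its first term `W 0`. The partial sums are
  -- taken from length 1 on, as the empty one is 0.
  0<S₀ : 0ℝ < S 0
  0<S₀ = <-≤-trans (0<W 0) (⟶-≥ W₀≤ (⟶-suc (∑σ≈S 0)))
    where
      W₀≤ : ∀ n → W 0 ≤ ∑< (suc n) (σ 0)
      W₀≤ zero = ≤-reflexive (solve 1 (λ w → w := con 0ℚ :+ con 1ℚ :* (con 1ℚ :* w)) ≈-refl (W 0))
      W₀≤ (suc n) = ≤-respˡ (R.+-identityʳ _) (+-mono-≤ (W₀≤ n)
        (*-nonneg (0≤q^ (suc n)) (*-nonneg (<⇒≤ 0<1) (<⇒≤ (0<W (suc n))))))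

  private
    0<1-q^odd : ∀ m → 0ℝ < 1ℝ - q ^ suc (2 ℕ.* m)
    0<1-q^odd m = 0<1-x^suc 0<q q<1 (2 ℕ.* m)

    g : ℕ → ℝ
    g m = 1/ 1ℝ - q ^ suc (2 ℕ.* m) ⟨ 0<1-q^odd m ⟩

    ∑-power : ∀ m → ∑∞ (λ k → q ^ k * ((p ^ k) ^ m * t m)) ≈ (t m * g m)
    ∑-power m = ∑∞-cong
      (λ k → begin
        t m * r ^ k                       ≈⟨ R.*-congˡ (^-distrib-* q (q ^ (2 ℕ.* m)) k) ⟩
        t m * (q ^ k * (q ^ (2 ℕ.* m)) ^ k)
          ≈⟨ R.*-congˡ (R.*-congˡ (≈-trans (^-congˡ k (≈-sym ([x*x]^n≈x^2n q m))) (^-swap k))) ⟩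
        t m * (q ^ k * (p ^ k) ^ m)       ≈⟨ solve 3 (λ t a b → t :* (a :* b) := a :* (b :* t)) ≈-refl (t m) (q ^ k) ((p ^ k) ^ m) ⟩
        q ^ k * ((p ^ k) ^ m * t m)       ∎)
      (R.*-congˡ (1/-unique (0<1-q^odd m) (*-inverseʳ _)))
      (∑∞-scale (t m) (Geometric.geometric (^-pos 0<q (suc (2 ℕ.* m))) (0<1-x⇒x<1 (0<1-q^odd m))))
      where
        open ≈-Reasoning
        r = q ^ suc (2 ℕ.* m)
        ^-swap : ∀ k → (p ^ m) ^ k ≈ (p ^ k) ^ m
        ^-swap k = ≈-trans (^-assocʳ p m k)
          (≈-trans (R.reflexive (cong (p ^_) (ℕ.*-comm m k))) (≈-sym (^-assocʳ p k m)))

    W≤ : ℕ → ℕ → ℝ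
    W≤ M k = ∑< M (λ m → (p ^ k) ^ m * t m)

    ∑-partial : ∀ M → ∑∞ (λ k → q ^ k * W≤ M k) ≈ ∑< M (λ m → t m * g m)
    ∑-partial zero = ∑∞-cong (λ k → ≈-trans (R.zeroˡ _) (≈-sym (R.zeroʳ _))) (R.zeroˡ _) (∑∞-scale 0ℝ geometric)
    ∑-partial (suc M) = ∑∞-cong (λ k → ≈-sym (R.distribˡ _ _ _)) ≈-refl (∑∞-+ (∑-partial M) (∑-power M))

    remainder : ℕ → ℕ → ℝ
    remainder M k = q ^ k * (W k - W≤ M k)

    module Remainder (M : ℕ) = Comparison {remainder M}
      (*-nonneg 0≤W-bound (^-nonneg (<⇒≤ 0<p) M)) (λ k → ∣q^*x∣≤ k (W-partial k M))

    ∑-remainder : ∀ M → ∑∞ (remainder M) ≈ (S 0 - ∑< M (λ m → t m * g m))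
    ∑-remainder M = ∑∞-cong
      (λ k → solve 3 (λ a w v → a :* (con 1ℚ :* w) :+ (:- con 1ℚ) :* (a :* v) := a :* (w :- v)) ≈-refl (q ^ k) (W k) (W≤ M k))
      (R.+-congˡ (solve 1 (λ x → (:- con 1ℚ) :* x := :- x) ≈-refl _))
      (∑∞-+ (∑σ≈S 0) (∑∞-scale (- 1ℝ) (∑-partial M)))

    -- The double sum of qᵏ (pᵏ)ᵐ t m, taken over k first, is geometric in k. Only finitely many m
    -- are exchanged at a time; what remains, summed over all k, is at most a constant times p^M.
    ∑-swapped : ∑∞ (λ m → t m * g m) ≈ S 0
    ∑-swapped = ⟶-squeeze bound (Geometric.c*r^⟶0 0<p p<1 (W-bound * 1/[1-r]))
      where
        open ≤-Reasoning
        bound : ∀ M → ∣ ∑< M (λ m → t m * g m) - S 0 ∣ ≤ W-bound * 1/[1-r] * p ^ M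
        bound M = begin
          ∣ ∑< M (λ m → t m * g m) - S 0 ∣    ≈⟨ ∣x-y∣≈∣y-x∣ _ _ ⟩
          ∣ S 0 - ∑< M (λ m → t m * g m) ∣    ≈⟨ ∣∣-cong (⟶-unique (∑-remainder M) (Remainder.∑∞f≈total M)) ⟩
          ∣ Remainder.total M ∣               ≈⟨ ∣∣-cong (solve 1 (λ w → w := w :- con 0ℚ) ≈-refl (Remainder.total M)) ⟩
          ∣ Remainder.total M - 0ℝ ∣          ≤⟨ Remainder.tail≤ M 0 ⟩
          W-bound * p ^ M * 1/[1-r] * 1ℝ      ≈⟨ solve 3 (λ a b c → a :* b :* c :* con 1ℚ := a :* c :* b) ≈-refl W-bound (p ^ M) 1/[1-r] ⟩
          W-bound * 1/[1-r] * p ^ M           ∎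

    even-product : ℕ → ℝ
    even-product m = ∏< m (λ i → 1ℝ - q ^ suc (suc (2 ℕ.* i)))

    t*even-product : ∀ m → even-product m * t m ≈ (- 1ℝ) ^ m * q ^ (m ℕ.* (m ℕ.+ 1))
    t*even-product zero = R.*-congˡ (term-zero X₀)
    t*even-product (suc m) = begin
      P * (1ℝ - q ^ suc (suc (2 ℕ.* m))) * t (suc m)
        ≈⟨ R.*-assoc _ _ _ ⟩
      P * ((1ℝ - q ^ suc (suc (2 ℕ.* m))) * t (suc m))
        ≈⟨ R.*-congˡ (R.*-congʳ (R.+-congˡ (R.-‿cong (≈-trans (≈-sym (R.*-assoc q q _)) (R.*-congˡ (≈-sym ([x*x]^n≈x^2n q m))))))) ⟩
      P * ((1ℝ - p ^ suc m) * t (suc m))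
        ≈⟨ R.*-congˡ (t-suc m) ⟩
      P * (- (p ^ suc m * t m))
        ≈⟨ solve 3 (λ P a t → P :* (:- (a :* t)) := (:- con 1ℚ) :* (a :* (P :* t))) ≈-refl P (p ^ suc m) (t m) ⟩
      - 1ℝ * (p ^ suc m * (P * t m))
        ≈⟨ R.*-congˡ (R.*-cong ([x*x]^n≈x^2n q (suc m)) (t*even-product m)) ⟩
      - 1ℝ * (q ^ (2 ℕ.* suc m) * ((- 1ℝ) ^ m * q ^ (m ℕ.* (m ℕ.+ 1))))
        ≈⟨ solve 4 (λ e a b c → e :* (a :* (b :* c)) := e :* b :* (a :* c)) ≈-refl (- 1ℝ) (q ^ (2 ℕ.* suc m)) ((- 1ℝ) ^ m) (q ^ (m ℕ.* (m ℕ.+ 1))) ⟩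
      (- 1ℝ) ^ suc m * (q ^ (2 ℕ.* suc m) * q ^ (m ℕ.* (m ℕ.+ 1)))
        ≈⟨ R.*-congˡ (≈-trans (≈-sym (^-homo-* q (2 ℕ.* suc m) (m ℕ.* (m ℕ.+ 1)))) (R.reflexive (cong (q ^_) (exponent m)))) ⟩
      (- 1ℝ) ^ suc m * q ^ (suc m ℕ.* (suc m ℕ.+ 1)) ∎
      where
        open ≈-Reasoning
        P = even-product m
        exponent : ∀ m → 2 ℕ.* suc m ℕ.+ m ℕ.* (m ℕ.+ 1) ≡ suc m ℕ.* (suc m ℕ.+ 1)
        exponent = ℕSolver.solve 1 (λ m → conₙ 2 *ₙ (conₙ 1 +ₙ m) +ₙ m *ₙ (m +ₙ conₙ 1) =ₙ (conₙ 1 +ₙ m) *ₙ (conₙ 1 +ₙ m +ₙ conₙ 1)) refl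
          where open ℕSolver renaming (con to conₙ; _:*_ to _*ₙ_; _:+_ to _+ₙ_; _:=_ to _=ₙ_)

  normalization-series :
    ∑∞ (λ m → (- 1ℝ) ^ m * q ^ (m ℕ.* (m ℕ.+ 1)) / denominator m ⟨ denominator-pos m ⟩) ≈ S 0
  normalization-series = ∑∞-cong termwise ≈-refl ∑-swapped
    where
      open ≈-Reasoning
      termwise : ∀ m → t m * g m ≈ (- 1ℝ) ^ m * q ^ (m ℕ.* (m ℕ.+ 1)) / denominator m ⟨ denominator-pos m ⟩
      termwise m = *-cancelˡ (denominator-pos m) (begin
        a * P * (t m * g m)           ≈⟨ solve 4 (λ a P t g → a :* P :* (t :* g) := (a :* g) :* (P :* t)) ≈-refl a P (t m) (g m) ⟩
        a * g m * (P * t m)           ≈⟨ R.*-cong (*-inverseʳ (0<1-q^odd m)) (t*even-product m) ⟩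
        1ℝ * N                        ≈⟨ R.*-identityˡ N ⟩
        N                             ≈⟨ ≈-trans (R.*-congˡ (R.*-comm _ _)) (1/-cancel (denominator-pos m) N) ⟨
        a * P * (N / denominator m ⟨ denominator-pos m ⟩) ∎)
        where
          a = 1ℝ - q ^ suc (2 ℕ.* m)
          P = even-product m
          N = (- 1ℝ) ^ m * q ^ (m ℕ.* (m ℕ.+ 1))

-- The Jackson integral of monomials

module JacksonIntegral (q : ℝ) (0<q : 0ℝ < q) (q<1 : q < 1ℝ) where
  open q-Calculus q 0<q q<1

  ∫-cong : ∀ {a b f g I J} → (∀ x → f x ≈ g x) → I ≈ J → ∫[ a , b ] f ≈ I → ∫[ a , b ] g ≈ J
  ∫-cong f≈g I≈J (Jb , Ja , (S , s , eb) , (T , t , ea) , e) =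
    Jb , Ja , (S , ∑∞-cong (λ m → R.*-congˡ (f≈g _)) ≈-refl s , eb)
            , (T , ∑∞-cong (λ m → R.*-congˡ (f≈g _)) ≈-refl t , ea)
            , ≈-trans (≈-sym I≈J) e

  ∫-+ : ∀ {a b f g I J} → ∫[ a , b ] f ≈ I → ∫[ a , b ] g ≈ J → ∫[ a , b ] (λ x → f x + g x) ≈ (I + J)
  ∫-+ {a} {b} (Jb , Ja , (S , s , eb) , (T , t , ea) , e) (Jb′ , Ja′ , (S′ , s′ , eb′) , (T′ , t′ , ea′) , e′) =
    Jb + Jb′ , Ja + Ja′
    , (S + S′ , ∑∞-cong (λ m → ≈-sym (R.distribˡ _ _ _)) ≈-refl (∑∞-+ s s′) , ≈-trans (R.+-cong eb eb′) (≈-sym (R.distribˡ _ _ _)))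
    , (T + T′ , ∑∞-cong (λ m → ≈-sym (R.distribˡ _ _ _)) ≈-refl (∑∞-+ t t′) , ≈-trans (R.+-cong ea ea′) (≈-sym (R.distribˡ _ _ _)))
    , ≈-trans (R.+-cong e e′) (solve 4 (λ a b c d → a :- b :+ (c :- d) := a :+ c :- (b :+ d)) ≈-refl Jb Ja Jb′ Ja′)

  ∫-scale : ∀ {a b f I} c → ∫[ a , b ] f ≈ I → ∫[ a , b ] (λ x → c * f x) ≈ (c * I)
  ∫-scale {a} {b} {f} c (Jb , Ja , (S , s , eb) , (T , t , ea) , e) =
    c * Jb , c * Ja
    , (c * S , ∑∞-cong (λ m → swap c (q ^ m) _) ≈-refl (∑∞-scale c s) , ≈-trans (R.*-congˡ eb) (swap c _ S))
    , (c * T , ∑∞-cong (λ m → swap c (q ^ m) _) ≈-refl (∑∞-scale c t) , ≈-trans (R.*-congˡ ea) (swap c _ T))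
    , ≈-trans (R.*-congˡ e) (solve 3 (λ c a b → c :* (a :- b) := c :* a :- c :* b) ≈-refl c Jb Ja)
    where
      swap : ∀ x y z → x * (y * z) ≈ y * (x * z)
      swap = solve 3 (λ x y z → x :* (y :* z) := y :* (x :* z)) ≈-refl

module GaussianMoments (q : ℝ) (0<q : 0ℝ < q) (q<1 : q < 1ℝ) where
  open q-Calculus q 0<q q<1
  open Gaussian q 0<q q<1
  open q-Numbers q 0<q q<1
  open JacksonIntegral q 0<q q<1
  open SquareRoot 0<q q<1 public
  open LatticeSums q 0<q q<1 using (S; S-step; ∑σ≈S; 0<S₀; p; 0<p; p<1; normalization-series)
  open q-Exponential p 0<p p<1 using (E; E-series; E-cong; W; X₀; [1-p]*X₀; 0<1-p)

  ν : ℝ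
  ν = 1/ √ ⟨ 0<√ ⟩

  private
    i₂ : ℝ
    i₂ = 1/ [ + 2 ] ⟨ [suc 1 ]-pos ⟩

  w : ℝ → ℝ
  w x = E (- (q ^ 2 * x ^ 2 / [ + 2 ] ⟨ [suc 1 ]-pos ⟩))

  w-isGaussianWeight : IsGaussianWeight w
  w-isGaussianWeight x = E-series _

  c : ℝ
  c = (1ℝ + 1ℝ) * √ * S 0

  c-isNormalization : IsNormalization √ c
  c-isNormalization = S 0 , normalization-series , ≈-refl

  0<c : 0ℝ < c
  0<c = *-pos (*-pos (+-pos 0<1 0<1) 0<√) 0<S₀

  private
    √*ν : √ * ν ≈ 1ℝ
    √*ν = *-inverseʳ 0<√

    [1-q]*ν : (1ℝ - q) * ν ≈ √
    [1-q]*ν = begin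
      (1ℝ - q) * ν       ≈⟨ R.*-congʳ √*√ ⟨
      √ * √ * ν          ≈⟨ R.*-assoc _ _ _ ⟩
      √ * (√ * ν)        ≈⟨ R.*-congˡ √*ν ⟩
      √ * 1ℝ             ≈⟨ R.*-identityʳ _ ⟩
      √                  ∎
      where open ≈-Reasoning

    [1-q]*ν*ν : (1ℝ - q) * (ν * ν) ≈ 1ℝ
    [1-q]*ν*ν = ≈-trans (≈-sym (R.*-assoc _ _ _)) (≈-trans (R.*-congʳ [1-q]*ν) √*ν)

    -- Rests on 1 - q² = (1 - q)[2]_q and (1 - q) ν² = 1. Only y² enters, so the same lemma serves
    -- both endpoints.
    exponent-on-lattice : ∀ m {y} → y * y ≈ ν * ν → - (q ^ 2 * (q ^ m * y) ^ 2 * i₂) ≈ p ^ m * X₀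
    exponent-on-lattice m {y} yy = *-cancelˡ 0<1-p (begin
      (1ℝ - q * q) * - (q ^ 2 * (a * y) ^ 2 * i₂)
        ≈⟨ R.*-congʳ (≈-trans (R.+-congˡ (R.-‿cong (R.*-congˡ (≈-sym (R.*-identityʳ q))))) (≈-sym ([1-q]*[m] (+ 2)))) ⟩
      ((1ℝ - q) * [ + 2 ]) * - (q ^ 2 * (a * y) ^ 2 * i₂)
        ≈⟨ solve 6 (λ d b q a y i → (d :* b) :* (:- ((q :* (q :* con 1ℚ)) :* ((a :* y) :* ((a :* y) :* con 1ℚ)) :* i)) :=
             :- ((q :* q) :* (a :* a) :* (d :* (y :* y)) :* (b :* i))) ≈-refl (1ℝ - q) [ + 2 ] q a y i₂ ⟩
      - ((q * q) * (a * a) * ((1ℝ - q) * (y * y)) * ([ + 2 ] * i₂))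
        ≈⟨ R.-‿cong (R.*-cong (R.*-cong (R.*-congˡ (≈-sym (^-distrib-* q q m))) (≈-trans (R.*-congˡ yy) [1-q]*ν*ν)) (*-inverseʳ [suc 1 ]-pos)) ⟩
      - (p * p ^ m * 1ℝ * 1ℝ)
        ≈⟨ solve 2 (λ p b → :- (p :* b :* con 1ℚ :* con 1ℚ) := b :* (:- p)) ≈-refl p (p ^ m) ⟩
      p ^ m * (- p)
        ≈⟨ R.*-congˡ [1-p]*X₀ ⟨
      p ^ m * ((1ℝ - p) * X₀)
        ≈⟨ solve 3 (λ b d x → b :* (d :* x) := d :* (b :* x)) ≈-refl (p ^ m) (1ℝ - p) X₀ ⟩
      (1ℝ - p) * (p ^ m * X₀) ∎)
      where
        open ≈-Reasoning
        a = q ^ m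

    ∑-monomial : ∀ j {y} → y * y ≈ ν * ν → ∑∞ (λ m → q ^ m * ((q ^ m * y) ^ j * w (q ^ m * y))) ≈ (y ^ j * S j)
    ∑-monomial j {y} yy = ∑∞-cong
      (λ m → begin
        y ^ j * (q ^ m * ((q ^ m) ^ j * W m))
          ≈⟨ solve 4 (λ y a b w → y :* (a :* (b :* w)) := a :* ((b :* y) :* w)) ≈-refl (y ^ j) (q ^ m) ((q ^ m) ^ j) (W m) ⟩
        q ^ m * ((q ^ m) ^ j * y ^ j * W m)
          ≈⟨ R.*-congˡ (R.*-cong (≈-sym (^-distrib-* (q ^ m) y j)) (E-cong (≈-sym (exponent-on-lattice m yy)))) ⟩
        q ^ m * ((q ^ m * y) ^ j * w (q ^ m * y)) ∎)
      ≈-refl (∑∞-scale (y ^ j) (∑σ≈S j))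
      where open ≈-Reasoning

  -- The even values are [1][3]⋯[2m - 1], the q-analogue of the Gaussian moments.
  moment : ℕ → ℝ
  moment zero          = 1ℝ
  moment (suc zero)    = 0ℝ
  moment (suc (suc j)) = [ + suc j ] * moment j

  private
    J : ℕ → ℝ
    J j = (1ℝ - q) * ν * (ν ^ j * S j) - (1ℝ - q) * (- ν) * ((- ν) ^ j * S j)

    J≈moment : ∀ j → J j ≈ c * moment j
    J≈moment zero = begin
      (1ℝ - q) * ν * (1ℝ * S 0) - (1ℝ - q) * (- ν) * (1ℝ * S 0)
        ≈⟨ solve 3 (λ d v s → d :* v :* (con 1ℚ :* s) :- d :* (:- v) :* (con 1ℚ :* s) := (con 1ℚ :+ con 1ℚ) :* (d :* v) :* s) ≈-refl (1ℝ - q) ν (S 0) ⟩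
      (1ℝ + 1ℝ) * ((1ℝ - q) * ν) * S 0      ≈⟨ R.*-congʳ (R.*-congˡ [1-q]*ν) ⟩
      (1ℝ + 1ℝ) * √ * S 0                   ≈⟨ R.*-identityʳ _ ⟨
      c * 1ℝ                                ∎
      where open ≈-Reasoning
    J≈moment (suc zero) = ≈-trans
      (solve 3 (λ d v s → d :* v :* ((v :* con 1ℚ) :* s) :- d :* (:- v) :* (((:- v) :* con 1ℚ) :* s) := con 0ℚ) ≈-refl (1ℝ - q) ν (S 1))
      (≈-sym (R.zeroʳ c))
    J≈moment (suc (suc j)) = begin
      J (2 ℕ.+ j)
        ≈⟨ R.+-cong (R.*-congˡ (R.*-congˡ (S-step j))) (R.-‿cong (R.*-congˡ (R.*-congˡ (S-step j)))) ⟩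
      d * ν * ((ν * (ν * ν ^ j)) * (e * S j)) - d * (- ν) * ((- ν * (- ν * (- ν) ^ j)) * (e * S j))
        ≈⟨ solve 6 (λ d v e s a b → d :* v :* ((v :* (v :* a)) :* (e :* s)) :- d :* (:- v) :* ((:- v :* (:- v :* b)) :* (e :* s)) :=
             (e :* (v :* v)) :* (d :* v :* (a :* s) :- d :* (:- v) :* (b :* s))) ≈-refl d ν e (S j) (ν ^ j) ((- ν) ^ j) ⟩
      -- Since ν² = 1/(1 - q), the factor 1 - qʲ⁺¹ of the lattice shift becomes [j + 1].
      (e * (ν * ν)) * J j                   ≈⟨ R.*-cong (R.*-congˡ (1/-unique 0<1-q [1-q]*ν*ν)) (J≈moment j) ⟩
      [ + suc j ] * (c * moment j)          ≈⟨ solve 3 (λ x c m → x :* (c :* m) := c :* (x :* m)) ≈-refl [ + suc j ] c (moment j) ⟩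
      c * ([ + suc j ] * moment j)          ∎
      where
        open ≈-Reasoning
        d = 1ℝ - q
        e = 1ℝ - q ^ suc j

  ∫-monomial : ∀ j → ∫[ - ν , ν ] (λ x → x ^ j * w x) ≈ (c * moment j)
  ∫-monomial j = _ , _
    , (_ , ∑-monomial j ≈-refl , ≈-refl)
    , (_ , ∑-monomial j (solve 1 (λ v → (:- v) :* (:- v) := v :* v) ≈-refl ν) , ≈-refl)
    , ≈-sym (J≈moment j)

-- Orthogonality and lattice paths

module HermiteMoments (q : ℝ) (0<q : 0ℝ < q) (q<1 : q < 1ℝ) where
  open q-Calculus q 0<q q<1
  open q-Numbers q 0<q q<1
  open JacksonIntegral q 0<q q<1
  open GaussianMoments q 0<q q<1

  -- The coefficient in x H_h = H_{h+1} + weight h H_{h-1}. The value 0 at h = 0 lets `pred` stand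
  -- for h - 1 everywhere.
  weight : ℕ → ℝ
  weight zero    = 0ℝ
  weight (suc h) = q ^ h * [ + suc h ]

  -- L j a b is the normalized integral of xʲ H_a(x) H_b(x) w(x).
  L₀ : ℕ → ℕ → ℝ
  L₀ j zero          = moment j
  L₀ j (suc zero)    = moment (suc j)
  L₀ j (suc (suc a)) = L₀ (suc j) (suc a) - weight (suc a) * L₀ j a

  L : ℕ → ℕ → ℕ → ℝ
  L j a zero          = L₀ j a
  L j a (suc zero)    = L₀ (suc j) a
  L j a (suc (suc b)) = L (suc j) a (suc b) - weight (suc b) * L j a b

  private
    extract : ∀ {a b f g h I J} d → ∫[ a , b ] f ≈ (c * I) → ∫[ a , b ] g ≈ (c * J) →
              (∀ x → f x - d * g x ≈ h x) → ∫[ a , b ] h ≈ (c * (I - d * J))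
    extract {f = f} {g} {I = I} {J} d F G e = ∫-cong {f = λ x → f x + - d * g x}
      (λ x → ≈-trans (solve 3 (λ f g d → f :+ (:- d) :* g := f :- d :* g) ≈-refl (f x) (g x) d) (e x))
      (solve 4 (λ c i j d → c :* i :+ (:- d) :* (c :* j) := c :* (i :- d :* j)) ≈-refl c I J d)
      (∫-+ {f = f} {λ x → - d * g x} F (∫-scale {f = g} (- d) G))

  ∫-Hermite : ∀ j a → ∫[ - ν , ν ] (λ x → x ^ j * H a x * w x) ≈ (c * L₀ j a)
  ∫-Hermite j zero = ∫-cong (λ x → R.*-congʳ {w x} (≈-sym (R.*-identityʳ (x ^ j)))) ≈-refl (∫-monomial j)
  ∫-Hermite j (suc zero) = ∫-cong (λ x → R.*-congʳ {w x} (R.*-comm x (x ^ j))) ≈-refl (∫-monomial (suc j))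
  ∫-Hermite j (suc (suc a)) = extract (weight (suc a)) (∫-Hermite (suc j) (suc a)) (∫-Hermite j a)
    λ x → solve 6 (λ x y k h d w → (x :* y) :* k :* w :- d :* (y :* h :* w) := y :* (x :* k :- d :* h) :* w)
      ≈-refl x (x ^ j) (H (suc a) x) (H a x) (weight (suc a)) (w x)

  -- Reduces the integrals to `L`; orthogonality and the path expansion then use its recurrences
  -- alone.
  ∫-Hermite² : ∀ j a b → ∫[ - ν , ν ] (λ x → x ^ j * H a x * H b x * w x) ≈ (c * L j a b)
  ∫-Hermite² j a zero = ∫-cong (λ x → R.*-congʳ {w x} (≈-sym (R.*-identityʳ (x ^ j * H a x)))) ≈-refl (∫-Hermite j a)
  ∫-Hermite² j a (suc zero) = ∫-cong
    (λ x → solve 4 (λ x y k w → x :* y :* k :* w := y :* k :* x :* w) ≈-refl x (x ^ j) (H a x) (w x))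
    ≈-refl (∫-Hermite (suc j) a)
  ∫-Hermite² j a (suc (suc b)) = extract (weight (suc b)) (∫-Hermite² (suc j) a (suc b)) (∫-Hermite² j a b)
    λ x → solve 7 (λ x y g k h d w → (x :* y) :* g :* k :* w :- d :* (y :* g :* h :* w) := y :* g :* (x :* k :- d :* h) :* w)
      ≈-refl x (x ^ j) (H a x) (H (suc b) x) (H b x) (weight (suc b)) (w x)

  [2+n]≈1+q[1+n] : ∀ n → [ + suc (suc n) ] ≈ 1ℝ + q * [ + suc n ]
  [2+n]≈1+q[1+n] n = *-cancelˡ 0<1-q (begin
    (1ℝ - q) * [ + suc (suc n) ]             ≈⟨ [1-q]*[m] (+ suc (suc n)) ⟩
    1ℝ - q * q ^ suc n                       ≈⟨ solve 2 (λ q y → con 1ℚ :- q :* y := (con 1ℚ :- q) :+ q :* (con 1ℚ :- y)) ≈-refl q (q ^ suc n) ⟩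
    (1ℝ - q) + q * (1ℝ - q ^ suc n)          ≈⟨ R.+-congˡ (R.*-congˡ ([1-q]*[m] (+ suc n))) ⟨
    (1ℝ - q) + q * ((1ℝ - q) * [ + suc n ])  ≈⟨ solve 2 (λ q x → (con 1ℚ :- q) :+ q :* ((con 1ℚ :- q) :* x) := (con 1ℚ :- q) :* (con 1ℚ :+ q :* x)) ≈-refl q [ + suc n ] ⟩
    (1ℝ - q) * (1ℝ + q * [ + suc n ])        ∎)
    where open ≈-Reasoning

  [1]≈1 : [ + 1 ] ≈ 1ℝ
  [1]≈1 = *-cancelˡ 0<1-q (≈-trans ([1-q]*[m] (+ 1)) (solve 1 (λ q → con 1ℚ :- q :* con 1ℚ := (con 1ℚ :- q) :* con 1ℚ) ≈-refl q))

  -- q-integration by parts, with H_{a+1} w as a q-derivative of H_a w.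
  L₀-by-parts : ∀ a j → L₀ (suc j) (suc a) ≈ q ^ a * [ + suc j ] * L₀ j a
  L₀-by-parts zero j = R.*-congʳ (≈-sym (R.*-identityˡ _))
  L₀-by-parts (suc zero) j = begin
    L₀ (2 ℕ.+ j) 1 - (1ℝ * [ + 1 ]) * y
      ≈⟨ R.+-cong (≈-trans (L₀-by-parts zero (suc j)) (R.*-congʳ (R.*-congˡ ([2+n]≈1+q[1+n] j)))) (R.-‿cong (R.*-congʳ (R.*-congˡ [1]≈1))) ⟩
    1ℝ * (1ℝ + q * [ + suc j ]) * y - (1ℝ * 1ℝ) * y
      ≈⟨ solve 3 (λ q x y → con 1ℚ :* (con 1ℚ :+ q :* x) :* y :- (con 1ℚ :* con 1ℚ) :* y := (q :* con 1ℚ) :* x :* y) ≈-refl q [ + suc j ] y ⟩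
    q ^ 1 * [ + suc j ] * y ∎
    where
      open ≈-Reasoning
      y = moment (suc j)
  L₀-by-parts (suc (suc a)) j = begin
    L₀ (2 ℕ.+ j) (2 ℕ.+ a) - (q * e * [ + suc (suc a) ]) * y
      -- Both [j + 2] and [a + 2] are written as 1 + q[⋅], so that the constant parts cancel.
      ≈⟨ R.+-cong (≈-trans (L₀-by-parts (suc a) (suc j)) (R.*-congʳ (R.*-congˡ ([2+n]≈1+q[1+n] j))))
           (R.-‿cong (R.*-congʳ (R.*-congˡ ([2+n]≈1+q[1+n] a)))) ⟩
    q * e * (1ℝ + q * x) * y - (q * e * (1ℝ + q * z)) * y
      ≈⟨ solve 5 (λ q e x y z → q :* e :* (con 1ℚ :+ q :* x) :* y :- (q :* e :* (con 1ℚ :+ q :* z)) :* y :=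
           q :* (q :* e) :* x :* y :- q :* q :* e :* z :* y) ≈-refl q e x y z ⟩
    q * (q * e) * x * y - q * q * e * z * y
      -- Only the second `y` is replaced, by the case a of the lemma. The common factor then leaves
      -- `y - (e * z) * L₀ j a`, which is `L₀ j (suc (suc a))` by definition.
      ≈⟨ R.+-congˡ (R.-‿cong (R.*-congˡ (L₀-by-parts a j))) ⟩
    q * (q * e) * x * y - q * q * e * z * (e * x * L₀ j a)
      ≈⟨ solve 6 (λ q e x y z l → q :* (q :* e) :* x :* y :- q :* q :* e :* z :* (e :* x :* l) :=
           q :* (q :* e) :* x :* (y :- (e :* z) :* l)) ≈-refl q e x y z (L₀ j a) ⟩
    q ^ suc (suc a) * [ + suc j ] * (y - (e * z) * L₀ j a) ∎
    where
      open ≈-Reasoning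
      e = q ^ a
      x = [ + suc j ]
      y = L₀ (suc j) (suc a)
      z = [ + suc a ]

  -- By parts with j = 0, the leading term of the recurrence reduces to the same smaller case as the
  -- subtracted one.
  L₀-vanishes : ∀ a → L₀ 0 (suc a) ≈ 0ℝ
  L₀-vanishes zero = ≈-refl
  L₀-vanishes (suc zero) = ≈-trans (R.+-congʳ (R.*-congʳ (≈-sym (R.*-identityˡ _)))) (R.-‿inverseʳ _)
  L₀-vanishes (suc (suc a)) = begin
    L₀ 1 (suc (suc a)) - weight (suc (suc a)) * L₀ 0 (suc a)
      ≈⟨ R.+-cong (≈-trans (L₀-by-parts (suc a) 0) (R.*-congˡ (L₀-vanishes a))) (R.-‿cong (R.*-congˡ (L₀-vanishes a))) ⟩
    q ^ suc a * [ + 1 ] * 0ℝ - weight (suc (suc a)) * 0ℝ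
      ≈⟨ solve 2 (λ x y → x :* con 0ℚ :- y :* con 0ℚ := con 0ℚ) ≈-refl (q ^ suc a * [ + 1 ]) (weight (suc (suc a))) ⟩
    0ℝ ∎
    where open ≈-Reasoning

  -- For a = 0 the term with pred a has weight 0, as H₋₁ = 0.
  x*L₀ : ∀ j a → L₀ (suc j) a ≈ L₀ j (suc a) + weight a * L₀ j (pred a)
  x*L₀ j zero    = ≈-sym (≈-trans (R.+-congˡ (R.zeroˡ _)) (R.+-identityʳ _))
  x*L₀ j (suc a) = solve 2 (λ x y → x := x :- y :+ y) ≈-refl (L₀ (suc j) (suc a)) (weight (suc a) * L₀ j a)

  -- The recurrence that unfolds `L` in b is linear with coefficients independent of j and a, so the
  -- case of H_0 carries over.
  x*L : ∀ b j a → L (suc j) a b ≈ L j (suc a) b + weight a * L j (pred a) b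
  x*L zero          j a = x*L₀ j a
  x*L (suc zero)    j a = x*L₀ (suc j) a
  x*L (suc (suc b)) j a = ≈-trans
    (R.+-cong (x*L (suc b) (suc j) a) (R.-‿cong (R.*-congˡ (x*L b j a))))
    (solve 6 (λ x y u v d e → (x :+ d :* y) :- e :* (u :+ d :* v) := (x :- e :* u) :+ d :* (y :- e :* v)) ≈-refl
      (L (suc j) (suc a) (suc b)) (L (suc j) (pred a) (suc b)) (L j (suc a) b) (L j (pred a) b) (weight a) (weight (suc b)))

  norm² : ℕ → ℝ
  norm² zero    = 1ℝ
  norm² (suc b) = weight (suc b) * norm² b

  -- A Kronecker delta scaled by `norm²`. Peeling off both indices together exposes the factor
  -- needed in `weight*δ`.
  δ : ℕ → ℕ → ℝ
  δ zero    zero    = 1ℝ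
  δ zero    (suc b) = 0ℝ
  δ (suc a) zero    = 0ℝ
  δ (suc a) (suc b) = weight (suc b) * δ a b

  δ-diagonal : ∀ a → δ a a ≈ norm² a
  δ-diagonal zero    = ≈-refl
  δ-diagonal (suc a) = R.*-congˡ (δ-diagonal a)

  δ-off-diagonal : ∀ {a b} → a ≢ b → δ a b ≈ 0ℝ
  δ-off-diagonal {zero}  {zero}  a≢b = contradiction refl a≢b
  δ-off-diagonal {zero}  {suc b} a≢b = ≈-refl
  δ-off-diagonal {suc a} {zero}  a≢b = ≈-refl
  δ-off-diagonal {suc a} {suc b} a≢b = ≈-trans (R.*-congˡ (δ-off-diagonal (λ e → a≢b (cong suc e)))) (R.zeroʳ _)

  weight*δ : ∀ a b → weight a * δ (pred a) b ≈ δ a (suc b)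
  weight*δ zero    b = R.zeroˡ _
  weight*δ (suc a) b with a ℕ.≟ b
  ... | yes refl = ≈-refl
  ... | no a≢b   = ≈-trans (vanishes (weight (suc a))) (≈-sym (vanishes (weight (suc b))))
    where
      vanishes : ∀ x → x * δ a b ≈ 0ℝ
      vanishes x = ≈-trans (R.*-congˡ (δ-off-diagonal a≢b)) (R.zeroʳ x)

  -- The x in the recurrence for H_{b+2} is moved onto H_a. The term with H_{a+1} H_{b+1} then
  -- cancels the subtracted one, and the other gives the claim. Induction is on b for all a, since
  -- both neighbours of a occur.
  orthogonality : ∀ b a → L 0 a b ≈ δ a b
  orthogonality zero       zero    = ≈-refl
  orthogonality zero       (suc a) = L₀-vanishes a
  orthogonality (suc zero) a = begin
    L₀ 1 a                                    ≈⟨ x*L₀ 0 a ⟩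
    L₀ 0 (suc a) + weight a * L₀ 0 (pred a)   ≈⟨ R.+-cong (L₀-vanishes a) (R.*-congˡ (orthogonality zero (pred a))) ⟩
    0ℝ + weight a * δ (pred a) 0              ≈⟨ R.+-identityˡ _ ⟩
    weight a * δ (pred a) 0                   ≈⟨ weight*δ a 0 ⟩
    δ a 1                                     ∎
    where open ≈-Reasoning
  orthogonality (suc (suc b)) a = begin
    L 1 a (suc b) - e * L 0 a b
      ≈⟨ R.+-cong (x*L (suc b) 0 a) (R.-‿cong (R.*-congˡ (orthogonality b a))) ⟩
    (L 0 (suc a) (suc b) + weight a * L 0 (pred a) (suc b)) - e * δ a b
      ≈⟨ R.+-congʳ (R.+-cong (orthogonality (suc b) (suc a)) (R.*-congˡ (orthogonality (suc b) (pred a)))) ⟩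
    (e * δ a b + weight a * δ (pred a) (suc b)) - e * δ a b
      ≈⟨ solve 2 (λ x y → (x :+ y) :- x := y) ≈-refl (e * δ a b) (weight a * δ (pred a) (suc b)) ⟩
    weight a * δ (pred a) (suc b)
      ≈⟨ weight*δ a (suc b) ⟩
    δ a (suc (suc b)) ∎
    where
      open ≈-Reasoning
      e = weight (suc b)

  private
    both-vanish : ∀ {x y} z → x ≈ 0ℝ → y ≈ 0ℝ → x + z * y ≈ 0ℝ
    both-vanish z e f = ≈-trans (R.+-cong e (≈-trans (R.*-congˡ f) (R.zeroʳ z))) (R.+-identityˡ 0ℝ)

  -- Each factor x moves the first index by at most one, so m of them cannot bring a down to b. With
  -- its mirror image below, this discards the impossible branches in `L≈paths`.
  L-vanishes-above : ∀ m a b → m ℕ.+ b ℕ.< a → L m a b ≈ 0ℝ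
  L-vanishes-above zero    a b p = ≈-trans (orthogonality b a) (δ-off-diagonal (ℕ.>⇒≢ p))
  L-vanishes-above (suc m) a b p = ≈-trans (x*L b m a) (both-vanish (weight a)
    (L-vanishes-above m (suc a) b (ℕ.m≤n⇒m≤1+n (ℕ.<-trans (ℕ.n<1+n _) p)))
    (L-vanishes-above m (pred a) b (ℕ.suc[m]≤n⇒m≤pred[n] p)))

  L-vanishes-below : ∀ m a b → m ℕ.+ a ℕ.< b → L m a b ≈ 0ℝ
  L-vanishes-below zero    a b p = ≈-trans (orthogonality b a) (δ-off-diagonal (ℕ.<⇒≢ p))
  L-vanishes-below (suc m) a b p = ≈-trans (x*L b m a) (both-vanish (weight a)
    (L-vanishes-below m (suc a) b (subst (ℕ._< b) (sym (ℕ.+-suc m a)) p))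
    (L-vanishes-below m (pred a) b (ℕ.≤-<-trans (ℕ.+-monoʳ-≤ m (ℕ.pred[n]≤n {a})) (ℕ.<-trans (ℕ.n<1+n _) p))))

  -- The weight sum of the paths from height h with u up-steps and d down-steps,
  -- a down-step from height h having weight h; nonpositive heights contribute 0.
  paths : ℕ → ℕ → ℕ → ℝ
  paths u       zero    h = 1ℝ
  paths zero    (suc d) h = weight h * paths zero d (pred h)
  paths (suc u) (suc d) h = paths u (suc d) (suc h) + weight h * paths (suc u) d (pred h)

  -- Each factor x becomes a step of the first index by `x*L`, until orthogonality leaves `norm² b`.
  -- Once the steps of one kind are used up, a further such step would make b unreachable, so its
  -- branch vanishes.
  L≈paths : ∀ d u a b → a ℕ.+ u ≡ b ℕ.+ d → L (d ℕ.+ u) a b ≈ norm² b * paths u d a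
  L≈paths zero zero a b e rewrite trans (sym (ℕ.+-identityʳ a)) (trans e (ℕ.+-identityʳ b)) =
    ≈-trans (orthogonality b b) (≈-trans (δ-diagonal b) (≈-sym (R.*-identityʳ _)))
  L≈paths zero (suc u) a b e = begin
    L (suc u) a b                               ≈⟨ x*L b u a ⟩
    L u (suc a) b + weight a * L u (pred a) b
      ≈⟨ R.+-cong (L≈paths zero u (suc a) b (trans (sym (ℕ.+-suc a u)) e))
           (≈-trans (R.*-congˡ (L-vanishes-below u (pred a) b below)) (R.zeroʳ _)) ⟩
    norm² b * 1ℝ + 0ℝ                           ≈⟨ R.+-identityʳ _ ⟩
    norm² b * 1ℝ                                ∎
    where
      open ≈-Reasoning
      below : u ℕ.+ pred a ℕ.< b
      below = ℕ.≤-<-trans (ℕ.+-monoʳ-≤ u (ℕ.pred[n]≤n {a}))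
        (ℕ.≤-reflexive (trans (cong suc (ℕ.+-comm u a)) (trans (sym (ℕ.+-suc a u)) (trans e (ℕ.+-identityʳ b)))))
  L≈paths (suc d) zero zero b e = contradiction (trans e (ℕ.+-suc b d)) λ ()
  L≈paths (suc d) zero (suc a) b e = begin
    L (suc (d ℕ.+ 0)) (suc a) b                 ≈⟨ x*L b (d ℕ.+ 0) (suc a) ⟩
    L (d ℕ.+ 0) (suc (suc a)) b + weight (suc a) * L (d ℕ.+ 0) a b
      ≈⟨ R.+-cong (L-vanishes-above (d ℕ.+ 0) (suc (suc a)) b above) (R.*-congˡ (L≈paths d zero a b a+0≡b+d)) ⟩
    0ℝ + weight (suc a) * (norm² b * paths 0 d a)
      ≈⟨ solve 3 (λ x n p → con 0ℚ :+ x :* (n :* p) := n :* (x :* p)) ≈-refl (weight (suc a)) (norm² b) (paths 0 d a) ⟩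
    norm² b * (weight (suc a) * paths 0 d a)    ∎
    where
      open ≈-Reasoning
      a+0≡b+d : a ℕ.+ 0 ≡ b ℕ.+ d
      a+0≡b+d = ℕ.suc-injective (trans e (ℕ.+-suc b d))
      above : d ℕ.+ 0 ℕ.+ b ℕ.< suc (suc a)
      above = ℕ.s≤s (ℕ.m≤n⇒m≤1+n (ℕ.≤-reflexive
        (trans (cong (ℕ._+ b) (ℕ.+-identityʳ d)) (trans (ℕ.+-comm d b) (trans (sym a+0≡b+d) (ℕ.+-identityʳ a))))))
  L≈paths (suc d) (suc u) a b e = begin
    L (suc d ℕ.+ suc u) a b                     ≈⟨ x*L b (d ℕ.+ suc u) a ⟩
    L (d ℕ.+ suc u) (suc a) b + weight a * L (d ℕ.+ suc u) (pred a) b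
      ≈⟨ R.+-cong (≈-trans (R.reflexive (cong (λ m → L m (suc a) b) (ℕ.+-suc d u)))
                    (L≈paths (suc d) u (suc a) b (trans (sym (ℕ.+-suc a u)) e)))
           (down a e) ⟩
    norm² b * paths u (suc d) (suc a) + weight a * (norm² b * paths (suc u) d (pred a))
      ≈⟨ solve 4 (λ n p x r → n :* p :+ x :* (n :* r) := n :* (p :+ x :* r)) ≈-refl
           (norm² b) (paths u (suc d) (suc a)) (weight a) (paths (suc u) d (pred a)) ⟩
    norm² b * paths (suc u) (suc d) a           ∎
    where
      open ≈-Reasoning
      down : ∀ a → a ℕ.+ suc u ≡ b ℕ.+ suc d →
             weight a * L (d ℕ.+ suc u) (pred a) b ≈ weight a * (norm² b * paths (suc u) d (pred a))
      down zero    e = ≈-trans (R.zeroˡ _) (≈-sym (R.zeroˡ _))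
      down (suc a) e = R.*-congˡ (L≈paths d (suc u) a b (ℕ.suc-injective (trans e (ℕ.+-suc b d))))

  norm²≈ : ∀ s → norm² s ≈ q ^ (s C 2) * [ s ]!
  norm²≈ zero    = ≈-sym (R.*-identityˡ 1ℝ)
  norm²≈ (suc s) = begin
    q ^ s * [ + suc s ] * norm² s                   ≈⟨ R.*-congˡ (norm²≈ s) ⟩
    q ^ s * [ + suc s ] * (q ^ (s C 2) * [ s ]!)    ≈⟨ solve 4 (λ a b c d → a :* b :* (c :* d) := (a :* c) :* (d :* b)) ≈-refl (q ^ s) [ + suc s ] (q ^ (s C 2)) [ s ]! ⟩
    (q ^ s * q ^ (s C 2)) * [ suc s ]!              ≈⟨ R.*-congʳ (≈-trans (≈-sym (^-homo-* q s (s C 2))) (R.reflexive (cong (q ^_) (sym (suc-C-2 s))))) ⟩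
    q ^ (suc s C 2) * [ suc s ]!                    ∎
    where open ≈-Reasoning

-- The sum over Y(n, s)

-- Replaces the filter in `Y` by zero terms, so that the sum over tuples can be taken one entry at a
-- time.
guard : Bool → ℝ → ℝ
guard b x = if b then x else 0ℝ

guard-cong : ∀ b {x y} → x ≈ y → guard b x ≈ guard b y
guard-cong true  e = e
guard-cong false e = ≈-refl

module _ {A : Set} where

  ∑∈-cong : ∀ {f g : A → ℝ} → (∀ x → f x ≈ g x) → ∀ xs → ∑∈ xs f ≈ ∑∈ xs g
  ∑∈-cong e []       = ≈-refl
  ∑∈-cong e (x ∷ xs) = R.+-cong (e x) (∑∈-cong e xs)

  ∑∈-zero : ∀ (xs : List A) → ∑∈ xs (λ _ → 0ℝ) ≈ 0ℝ
  ∑∈-zero []       = ≈-refl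
  ∑∈-zero (x ∷ xs) = ≈-trans (R.+-identityˡ _) (∑∈-zero xs)

  ∑∈-scale : ∀ c (f : A → ℝ) xs → ∑∈ xs (λ x → c * f x) ≈ c * ∑∈ xs f
  ∑∈-scale c f []       = ≈-sym (R.zeroʳ c)
  ∑∈-scale c f (x ∷ xs) = ≈-trans (R.+-congˡ (∑∈-scale c f xs)) (≈-sym (R.distribˡ c _ _))

  ∑∈-++ : ∀ (f : A → ℝ) xs ys → ∑∈ (xs ++ ys) f ≈ ∑∈ xs f + ∑∈ ys f
  ∑∈-++ f []       ys = ≈-sym (R.+-identityˡ _)
  ∑∈-++ f (x ∷ xs) ys = ≈-trans (R.+-congˡ (∑∈-++ f xs ys)) (≈-sym (R.+-assoc _ _ _))

  ∑∈-map : ∀ {B : Set} (h : B → A) (f : A → ℝ) xs → ∑∈ (List.map h xs) f ≈ ∑∈ xs (f ∘ h)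
  ∑∈-map h f []       = ≈-refl
  ∑∈-map h f (x ∷ xs) = R.+-congˡ (∑∈-map h f xs)

  ∑∈-filter : ∀ {P : A → Set} (P? : Decidable P) (f : A → ℝ) xs →
              ∑∈ (filter P? xs) f ≈ ∑∈ xs (λ x → guard (does (P? x)) (f x))
  ∑∈-filter P? f [] = ≈-refl
  ∑∈-filter P? f (x ∷ xs) with does (P? x)
  ... | false = ≈-trans (∑∈-filter P? f xs) (≈-sym (R.+-identityˡ _))
  ... | true  = R.+-congˡ (∑∈-filter P? f xs)

  ∑∈-applyUpTo : ∀ (h : ℕ → A) (f : A → ℝ) m → ∑∈ (applyUpTo h m) f ≈ ∑< m (f ∘ h)
  ∑∈-applyUpTo h f zero    = ≈-refl
  ∑∈-applyUpTo h f (suc m) = ≈-trans (R.+-congˡ (∑∈-applyUpTo (h ∘ suc) f m)) (≈-sym (∑<-suc (f ∘ h) m))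

∑∈-tuples-suc : ∀ {A : Set} k (xs : List A) (f : Vec A (suc k) → ℝ) →
                ∑∈ (tuples xs (suc k)) f ≈ ∑∈ xs (λ x → ∑∈ (tuples xs k) (λ ν → f (x ∷ ν)))
∑∈-tuples-suc {A} k xs f = go xs
  where
    go : ∀ ys → ∑∈ (cartesianProductWith _∷_ ys (tuples xs k)) f ≈ ∑∈ ys (λ x → ∑∈ (tuples xs k) (λ ν → f (x ∷ ν)))
    go []       = ≈-refl
    go (y ∷ ys) = ≈-trans (∑∈-++ f (List.map (y ∷_) (tuples xs k)) _) (R.+-cong (∑∈-map (y ∷_) f (tuples xs k)) (go ys))

∑<-guard : ∀ (b : ℕ → Bool) (f : ℕ → ℝ) a → (∀ j → j ℕ.< a → b j ≡ false) → (∀ j → a ℕ.≤ j → b j ≡ true) →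
           ∀ u → ∑< (a ℕ.+ u) (λ j → guard (b j) (f j)) ≈ ∑< u (λ v → f (a ℕ.+ v))
∑<-guard b f a low high zero = subst (λ m → ∑< m (λ j → guard (b j) (f j)) ≈ 0ℝ) (sym (ℕ.+-identityʳ a)) (zeros a ℕ.≤-refl)
  where
    zeros : ∀ m → m ℕ.≤ a → ∑< m (λ j → guard (b j) (f j)) ≈ 0ℝ
    zeros zero    _ = ≈-refl
    zeros (suc m) p = ≈-trans (R.+-cong (zeros m (ℕ.<⇒≤ p)) (R.reflexive (cong (λ z → guard z (f m)) (low m p)))) (R.+-identityʳ 0ℝ)
∑<-guard b f a low high (suc u) = subst (λ m → ∑< m (λ j → guard (b j) (f j)) ≈ ∑< (suc u) (λ v → f (a ℕ.+ v))) (sym (ℕ.+-suc a u))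
  (R.+-cong (∑<-guard b f a low high u) (R.reflexive (cong (λ z → guard z (f (a ℕ.+ u))) (high (a ℕ.+ u) (ℕ.m≤m+n a u)))))

-- The lower bound and the position-dependent `W` are parameters so that removing the first entry
-- leaves a sum of the same kind, with that entry as new bound and `W` shifted.
chains : List ℤ → ℤ → ∀ k → (ℕ → ℤ → ℝ) → ℤ → ℝ
chains xs hi k W lo = ∑∈ (tuples xs k) λ μ →
  guard (does (linked? ℤ._≤?_ (lo ∷ (μ ∷ʳ hi)))) (product (λ (i : Fin k) → W (toℕ i) (lookup μ i)))

-- The test `linked?` computes to a conjunction whose first conjunct concerns only `lo` and x, so it
-- and the weight of x come out of the inner sum.
chains-suc : ∀ xs hi k W lo →
  chains xs hi (suc k) W lo ≈ ∑∈ xs (λ x → guard (does (lo ℤ.≤? x)) (W 0 x * chains xs hi k (W ∘ suc) x))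
chains-suc xs hi k W lo = ≈-trans (∑∈-tuples-suc k xs _) (∑∈-cong factor xs)
  where
    weight : ∀ {k} → (ℕ → ℤ → ℝ) → Vec ℤ k → ℝ
    weight {k} W μ = product (λ (i : Fin k) → W (toℕ i) (lookup μ i))

    linked : ∀ {k} → ℤ → Vec ℤ k → Bool
    linked x ν = does (linked? ℤ._≤?_ (x ∷ (ν ∷ʳ hi)))

    guard-∧ : ∀ b d x y → guard (b ∧ d) (x * y) ≈ guard b (x * guard d y)
    guard-∧ false d     x y = ≈-refl
    guard-∧ true  false x y = ≈-sym (R.zeroʳ x)
    guard-∧ true  true  x y = ≈-refl

    guard-∑∈ : ∀ {A : Set} b (f : A → ℝ) ys → ∑∈ ys (λ y → guard b (f y)) ≈ guard b (∑∈ ys f)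
    guard-∑∈ true  f ys = ≈-refl
    guard-∑∈ false f ys = ∑∈-zero ys

    factor : ∀ x → ∑∈ (tuples xs k) (λ ν → guard (linked lo (x ∷ ν)) (weight W (x ∷ ν)))
                 ≈ guard (does (lo ℤ.≤? x)) (W 0 x * chains xs hi k (W ∘ suc) x)
    factor x = ≈-trans (∑∈-cong (λ ν → guard-∧ (does (lo ℤ.≤? x)) (linked x ν) (W 0 x) (weight (W ∘ suc) ν)) (tuples xs k))
      (≈-trans (guard-∑∈ (does (lo ℤ.≤? x)) _ (tuples xs k))
        (guard-cong (does (lo ℤ.≤? x)) (∑∈-scale (W 0 x) (λ ν → guard (linked x ν) (weight (W ∘ suc) ν)) (tuples xs k))))

module PathSum (q : ℝ) (0<q : 0ℝ < q) (q<1 : q < 1ℝ) (n s : ℕ) where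
  open q-Calculus q 0<q q<1
  open HermiteMoments q 0<q q<1 using (weight; paths)

  hi : ℤ
  hi = + (n ℕ.+ s)

  factor : ℤ → ℝ
  factor z = (q^ z) * [ z ℤ.+ + 1 ]

  factor-weight : ∀ h → factor (+ h) ≈ weight (suc h)
  factor-weight h = R.reflexive (cong (λ m → q ^ h * [ + m ]) (ℕ.+-comm h 1))

  -- The case μ_i = i - 1, a down-step from height 0: the factor [0]_q is 0, which kills every
  -- sequence whose path would go below 0.
  factor-₋₁ : factor (-[1+ 0 ]) ≈ 0ℝ
  factor-₋₁ = solve 2 (λ x i → x :* ((con 1ℚ :- con 1ℚ) :* i) := con 0ℚ) ≈-refl (q^ -[1+ 0 ]) (1/ 1ℝ - q ⟨ 0<1-q ⟩)

  -- An entry μ_j is a down-step from height μ_j - j + 1, and the number of up-steps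
  -- made before it is μ_j - s.
  chains≈paths : ∀ k (W : ℕ → ℤ → ℝ) i → (∀ j x → W j x ≡ factor (x ℤ.- + suc (i ℕ.+ j))) →
    ∀ u a h → a ℕ.+ u ≡ n → s ℕ.+ a ≡ i ℕ.+ h → chains (range n s) hi k W (+ (s ℕ.+ a)) ≈ paths u k h
  -- Here i down-steps and a up-steps have been made, h is the current height and u up-steps remain.
  -- With no entry left, the only condition is lo ≤ n + s, which holds because a ≤ n.
  chains≈paths zero W i eW u a h a+u s+a = ≈-trans (R.+-identityʳ _)
    (R.reflexive (cong (λ b → guard (b ∧ true) 1ℝ) (dec-true (+ (s ℕ.+ a) ℤ.≤? hi) (ℤ.+≤+ s+a≤n+s))))
    where
      s+a≤n+s : s ℕ.+ a ℕ.≤ n ℕ.+ s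
      s+a≤n+s = subst (s ℕ.+ a ℕ.≤_) (ℕ.+-comm s n) (ℕ.+-monoʳ-≤ s (subst (a ℕ.≤_) a+u (ℕ.m≤m+n a u)))
  chains≈paths (suc k) W i eW u a h a+u s+a = begin
    chains (range n s) hi (suc k) W lo
      ≈⟨ chains-suc (range n s) hi k W lo ⟩
    ∑∈ (range n s) (λ x → guard (does (lo ℤ.≤? x)) (W 0 x * rest x))
      ≈⟨ ≈-trans (∑∈-map (λ j → + (s ℕ.+ j)) _ (upTo (suc n))) (∑∈-applyUpTo (λ j → j) _ (suc n)) ⟩
    ∑< (suc n) (λ j → guard (does (lo ℤ.≤? + (s ℕ.+ j))) (φ j))
      ≈⟨ R.reflexive (cong (λ m → ∑< m (λ j → guard (does (lo ℤ.≤? + (s ℕ.+ j))) (φ j))) (sym (trans (ℕ.+-suc a u) (cong suc a+u)))) ⟩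
    ∑< (a ℕ.+ suc u) (λ j → guard (does (lo ℤ.≤? + (s ℕ.+ j))) (φ j))
      -- Entries s + j with j < a lie below `lo`; the remaining u + 1 correspond to making v = 0,
      -- ..., u up-steps before the next down-step.
      ≈⟨ ∑<-guard (λ j → does (lo ℤ.≤? + (s ℕ.+ j))) φ a
           (λ j j<a → dec-false (lo ℤ.≤? + (s ℕ.+ j)) λ where (ℤ.+≤+ p) → ℕ.<⇒≱ j<a (ℕ.+-cancelˡ-≤ s a j p))
           (λ j a≤j → dec-true (lo ℤ.≤? + (s ℕ.+ j)) (ℤ.+≤+ (ℕ.+-monoʳ-≤ s a≤j)))
           (suc u) ⟩
    ∑< (suc u) (λ v → φ (a ℕ.+ v))
      ≈⟨ first-down u a h a+u s+a ⟩
    paths u (suc k) h ∎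
    where
      open ≈-Reasoning
      lo = + (s ℕ.+ a)

      rest : ℤ → ℝ
      rest = chains (range n s) hi k (W ∘ suc)

      φ : ℕ → ℝ
      φ j = W 0 (+ (s ℕ.+ j)) * rest (+ (s ℕ.+ j))

      -- The entry s + a means that the next step is already a down-step, from height h.
      down : ∀ u a h → a ℕ.+ u ≡ n → s ℕ.+ a ≡ i ℕ.+ h → φ a ≈ weight h * paths u k (pred h)
      down u a zero a+u s+a = ≈-trans (R.*-congʳ (≈-trans (R.reflexive (trans (eW 0 _) (cong factor step))) factor-₋₁))
        (≈-trans (R.zeroˡ _) (≈-sym (R.zeroˡ _)))
        where
          step : + (s ℕ.+ a) ℤ.- + suc (i ℕ.+ 0) ≡ -[1+ 0 ]
          step = trans (cong (λ m → + m ℤ.- + suc (i ℕ.+ 0)) s+a)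
            (trans (ℤ.m-n≡m⊖n (i ℕ.+ 0) (suc (i ℕ.+ 0))) (trans (cong (ℤ._⊖ suc (i ℕ.+ 0)) (sym (ℕ.+-identityʳ (i ℕ.+ 0))))
              (trans (cong (i ℕ.+ 0 ℕ.+ 0 ℤ.⊖_) (sym (ℕ.+-comm (i ℕ.+ 0) 1))) (ℤ.+-cancelˡ-⊖ (i ℕ.+ 0) 0 1))))
      down u a (suc h) a+u s+a = R.*-cong
        (≈-trans (R.reflexive (trans (eW 0 _) (cong factor step))) (factor-weight h))
        (chains≈paths k (W ∘ suc) (suc i)
          (λ j x → trans (eW (suc j) x) (cong (λ m → factor (x ℤ.- + suc m)) (ℕ.+-suc i j)))
          u a h a+u (trans s+a (ℕ.+-suc i h)))
        where
          step : + (s ℕ.+ a) ℤ.- + suc (i ℕ.+ 0) ≡ + h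
          step = trans (cong₂ (λ m l → + m ℤ.- + suc l) (trans s+a (ℕ.+-suc i h)) (ℕ.+-identityʳ i))
            (trans (ℤ.m-n≡m⊖n (suc i ℕ.+ h) (suc i)) (trans (cong (suc i ℕ.+ h ℤ.⊖_) (sym (ℕ.+-identityʳ (suc i)))) (ℤ.+-cancelˡ-⊖ (suc i) h 0)))

      -- Splitting off v = 0 separates an immediate down-step from the paths that begin with an
      -- up-step, as in the recursion of `paths`.
      first-down : ∀ u a h → a ℕ.+ u ≡ n → s ℕ.+ a ≡ i ℕ.+ h → ∑< (suc u) (λ v → φ (a ℕ.+ v)) ≈ paths u (suc k) h
      first-down zero a h a+u s+a = ≈-trans (R.+-identityˡ _)
        (≈-trans (R.reflexive (cong φ (ℕ.+-identityʳ a))) (down 0 a h a+u s+a))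
      first-down (suc u) a h a+u s+a = begin
        ∑< (suc (suc u)) (λ v → φ (a ℕ.+ v))
          ≈⟨ ∑<-suc (λ v → φ (a ℕ.+ v)) (suc u) ⟩
        φ (a ℕ.+ 0) + ∑< (suc u) (λ v → φ (a ℕ.+ suc v))
          ≈⟨ R.+-cong (R.reflexive (cong φ (ℕ.+-identityʳ a))) (∑<-cong (λ v → R.reflexive (cong φ (ℕ.+-suc a v))) (suc u)) ⟩
        φ a + ∑< (suc u) (λ v → φ (suc a ℕ.+ v))
          ≈⟨ R.+-cong (down (suc u) a h a+u s+a)
               (first-down u (suc a) (suc h) (trans (sym (ℕ.+-suc a u)) a+u)
                 (trans (ℕ.+-suc s a) (trans (cong suc s+a) (sym (ℕ.+-suc i h))))) ⟩
        weight h * paths (suc u) k (pred h) + paths u (suc k) (suc h)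
          ≈⟨ R.+-comm _ _ ⟩
        paths (suc u) (suc k) h ∎

  ∑Y≈paths : ∑∈ (Y n s) (λ μ → product (λ (i : Fin n) → factor (lookup μ i ℤ.- + suc (toℕ i)))) ≈ paths n n s
  ∑Y≈paths = ≈-trans (∑∈-filter (InY? n s) _ (tuples (range n s) n))
    (subst (λ m → chains (range n s) hi n W (+ m) ≈ paths n n s) (ℕ.+-identityʳ s)
      (chains≈paths n W 0 (λ _ _ → refl) n 0 s refl (ℕ.+-identityʳ s)))
    where
      W : ℕ → ℤ → ℝ
      W j x = factor (x ℤ.- + suc j)

theorem4p15 : (q : ℝ) (0<q : 0ℝ < q) (q<1 : q < 1ℝ) (n s : ℕ) →
    let open q-Calculus q 0<q q<1
        open Gaussian q 0<q q<1
    in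
    Σ[ √1-q ∈ ℝ ] Σ[ 0<√1-q ∈ 0ℝ < √1-q ]
    Σ[ w ∈ (ℝ → ℝ) ] Σ[ c ∈ ℝ ] Σ[ 0<c ∈ 0ℝ < c ] Σ[ I ∈ ℝ ]
    let ν = 1/ √1-q ⟨ 0<√1-q ⟩ in
      (√1-q * √1-q ≈ 1ℝ - q)
    × IsGaussianWeight w
    × IsNormalization √1-q c
    × (∫[ - ν , ν ] (λ x → x ^ (2 ℕ.* n) * H s x ^ 2 * w x) ≈ I)
    × 1/ q ^ (s C 2) * [ s ]! * c ⟨ *-pos (*-pos (^-pos 0<q (s C 2)) ([ s ]!-pos)) 0<c ⟩ * I
      ≈ ∑∈ (Y n s) (λ μ → product (λ (i : Fin n) →
          let μᵢ-i = lookup μ i ℤ.- + suc (toℕ i) in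
          (q^ μᵢ-i) * [ μᵢ-i ℤ.+ + 1 ]))
theorem4p15 q 0<q q<1 n s =
  √ , 0<√ , w , c , 0<c , c * L (2 ℕ.* n) s s , √*√ , w-isGaussianWeight , c-isNormalization
  , ∫-cong (λ x → R.*-congʳ {w x} (solve 2 (λ y h → y :* h :* h := y :* (h :* (h :* con 1ℚ))) ≈-refl (x ^ (2 ℕ.* n)) (H s x)))
      ≈-refl (∫-Hermite² (2 ℕ.* n) s s)
  , (begin
      1/ N * c ⟨ 0<Nc ⟩ * (c * L (2 ℕ.* n) s s)       ≈⟨ R.*-congˡ (R.*-congˡ L≈N*paths) ⟩
      1/ N * c ⟨ 0<Nc ⟩ * (c * (N * paths n n s))     ≈⟨ solve 4 (λ i c N x → i :* (c :* (N :* x)) := (N :* c) :* (i :* x)) ≈-refl _ c N (paths n n s) ⟩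
      N * c * (1/ N * c ⟨ 0<Nc ⟩ * paths n n s)       ≈⟨ 1/-cancel 0<Nc (paths n n s) ⟩
      paths n n s                                     ≈⟨ PathSum.∑Y≈paths q 0<q q<1 n s ⟨
      ∑∈ (Y n s) (λ μ → product (λ (i : Fin n) → PathSum.factor q 0<q q<1 n s (lookup μ i ℤ.- + suc (toℕ i)))) ∎)
  where
    open q-Calculus q 0<q q<1
    open JacksonIntegral q 0<q q<1 using (∫-cong)
    open GaussianMoments q 0<q q<1
    open HermiteMoments q 0<q q<1
    open ≈-Reasoning

    N : ℝ
    N = q ^ (s C 2) * [ s ]!

    0<Nc : 0ℝ < N * c
    0<Nc = *-pos (*-pos (^-pos 0<q (s C 2)) ([ s ]!-pos)) 0<c

    L≈N*paths : L (2 ℕ.* n) s s ≈ N * paths n n s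
    L≈N*paths = ≈-trans (R.reflexive (cong (λ m → L m s s) (cong (n ℕ.+_) (ℕ.+-identityʳ n))))
      (≈-trans (L≈paths n n s s refl) (R.*-congʳ (norm²≈ s)))
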